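{- Let $L,H$ be causal models in a Markov category $\mathcal C$, with variables $V_L,V_H$, and $V_H^{\rm nin}\subseteq V_H^{\rm out}$. A constructive abstraction $L\to H$ with variable alignment $(\pi,\tau)$ is equivalent to a downward abstraction $(\pi,\tau)\colon(\mathrm{Do}(V_L),L)\to(\mathrm{Do}(V_H),H)$ such that $\pi(V_H^{\rm in})=V_L^{\rm in}$. That is, restricting $\pi$ and $\tau$ to variables gives a bijection from such downward abstractions to constructive abstractions $L\to H$.
   Context: **Categories.** A Markov category is a symmetric monoidal category with terminal unit $I$ in which each object has a commutative comonoid structure (copy, discard) compatible with $\otimes$. Morphisms are called channels; $f$ is deterministic if $\mathrm{copy}\circ f=(f\otimes f)\circ\mathrm{copy}$. Functors between Markov categories are strong symmetric monoidal, preserve copy, and have deterministic structure isomorphisms; natural transformations are monoidal with deterministic components; "epic" means all components are epic. **Causal models.** An open DAG is a finite DAG with vertex set $V$ and a subset $V^{\rm in}\subseteq V$ of parentless vertices (inputs); $V^{\rm nin}=V\setminus V^{\rm in}$. A causal model $M$ over it in $\mathcal C$ consists of an object of $\mathcal C$ (again written $X$) for each vertex $X$, a channel (mechanism) $c_X\colon\bigotimes_{Y\in\mathrm{Pa}(X)}Y\to X$ for each $X\in V^{\rm nin}$, and a subset $V^{\rm out}\subseteq V$ of outputs. A set of variables is also used for the list of its elements (lists of distinct variables are considered up to permutation) and for the tensor of the corresponding objects. For $O\subseteq V$, $M^{O}\colon V^{\rm in}\to O$ is the channel obtained by wiring together, with copy maps, the mechanisms of all non-input variables having a directed path (possibly of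 length 0) to $O$, copying each $X\in O$ once more to form an output, and discarding inputs with no path to $O$. For $S\subseteq V^{\rm nin}$, $M_{\mathrm{Do}(S)}$ is the causal model obtained by deleting the mechanisms of all $X\in S$ and all edges into $S$ and making each $X\in S$ an input; so $M_{\mathrm{Do}(S)}^{O}\colon V^{\rm in}\otimes S\to O$. **Queries.** A query signature $Q$ is a set of objects (types) and a set of generators (queries), each with finite lists of input and output types; it freely generates a Markov category $\mathbf Q$ (objects: lists of types; morphisms: string diagrams). A model of $Q$ in $\mathcal C$ is a functor $[\![-]\!]\colon\mathbf Q\to\mathcal C$. The signature $\mathrm{Do}(V)$ has types $V$ and a query $\mathrm{Do}(S)\colon V^{\rm in}\otimes S\to O$ for each $S\subseteq V^{\rm nin}$, $O\subseteq V^{\rm out}$; a causal model $M$ over $V$ models it by interpreting variables as in $M$ and this query as $M_{\mathrm{Do}(S)}^{O}$. **Downward abstraction** $(\pi,\tau)\colon(Q_L,L)\to(Q_H,H)$: a functor $\pi\colon\mathbf Q_H\to\mathbf Q_L$ sending each query of $Q_H$ to a query (generator) of $Q_L$, and an epic natural transformation $\tau\colon[\![-]\!]_L\circ\pi\Rightarrow[\![-]\!]_H$. **Constructive abstraction.** A variable alignment $(\pi,\tau)$ from $V_L$ to $V_H$ is a family of pairwise disjoint subsets $\pi(X)\subseteq V_L$, $X\in V_H$, with $\pi(V_H^{\rm in})=V_L^{\rm in}$ and $\pi(V_H^{\rm out})\subseteq V_L^{\rm out}$ (with $\pi(S)=\bigcup_{X\in S}\pi(X)$), together with an epic deterministic channel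 $\tau_X\colon\pi(X)\to X$ in $\mathcal C$ for each $X\in V_H$; put $\tau_S=\bigotimes_{X\in S}\tau_X$; all tensor products of the $\tau_X$ are also required to be epic. It is a constructive abstraction $L\to H$ if for all $S\subseteq V_H^{\rm nin}$, $$\tau_{V_H^{\rm out}}\circ L_{\mathrm{Do}(\pi(S))}^{\pi(V_H^{\rm out})}=H_{\mathrm{Do}(S)}^{V_H^{\rm out}}\circ(\tau_{V_H^{\rm in}}\otimes\tau_S).$$ -}

module Defs where

open import Level using (Level; _⊔_; 0ℓ) renaming (suc to lsuc)
open import Axiom.UniquenessOfIdentityProofs.WithK using (uip)
open import Data.Bool.Base using (if_then_else_)
open import Data.Fin.Base using (Fin)
open import Data.Fin.Induction using (spo-wellFounded)
import Data.Fin.Properties as Fin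
open import Data.Fin.Subset using (Subset; _∈_; _∉_; _⊆_; _∪_; _∩_; ∁; ⋃; Empty; ⊥)
open import Data.Fin.Subset.Properties using (_∈?_; ∉⊥; x∈p∪q⁺; x∈p∪q⁻)
open import Data.List.Base using (List; []; _∷_; _++_; map; concatMap; filter; allFin)
open import Data.List.Membership.Propositional using () renaming (_∈_ to _∈ₗ_; _∉_ to _∉ₗ_)
open import Data.List.Membership.Propositional.Properties
  using (∈-filter⁺; ∈-filter⁻; ∈-allFin; ∈-++⁺ˡ; ∈-++⁺ʳ)
import Data.List.Membership.DecPropositional as DecMembership
open import Data.List.Properties using (++-assoc; ++-identityʳ)
open import Data.List.Relation.Binary.Permutation.Propositional using (_↭_; ↭-sym)
open import Data.List.Relation.Binary.Subset.Propositional using () renaming (_⊆_ to _⊆ₗ_)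
open import Data.List.Relation.Unary.Any using (here; there)
open import Data.Nat.Base using (ℕ)
open import Data.Product.Base using (Σ; Σ-syntax; ∃; ∃-syntax; _×_; _,_; proj₁; proj₂)
open import Data.Sum.Base using (_⊎_; inj₁; inj₂; [_,_]′)
open import Function.Base using () renaming (_∘_ to _∘′_)
open import Induction.WellFounded using (WellFounded; Acc; acc)
open import Relation.Binary.Bundles using (Setoid)
open import Relation.Binary.Construct.Closure.ReflexiveTransitive using (Star; ε; _◅_)
open import Relation.Binary.Construct.Closure.Transitive using (TransClosure; [_]; _∷_; wellFounded⁻)
  renaming (_++_ to _⁺++⁺_)
open import Relation.Binary.Structures using (IsEquivalence; IsStrictPartialOrder)
open import Relation.Binary.PropositionalEquality.Core as ≡ using (_≡_; _≢_)
open import Relation.Binary.PropositionalEquality.Properties using (isEquivalence)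
import Relation.Binary.Reasoning.Setoid as SetoidReasoning
open import Relation.Nullary.Decidable.Core using (yes; no; does)
open import Relation.Nullary.Negation.Core using (¬_; contradiction)

record MarkovCategory (o ℓ e : Level) : Set (lsuc (o ⊔ ℓ ⊔ e)) where
  infix  4 _⇒_ _≈_
  infixr 9 _∘_
  infixr 10 _⊗₀_ _⊗₁_
  field
    Obj : Set o
    _⇒_ : Obj → Obj → Set ℓ
    _≈_ : ∀ {A B} → A ⇒ B → A ⇒ B → Set e

    id  : ∀ {A} → A ⇒ A
    _∘_ : ∀ {A B C} → B ⇒ C → A ⇒ B → A ⇒ C
    equiv     : ∀ {A B} → IsEquivalence (_≈_ {A} {B})
    ∘-resp-≈  : ∀ {A B C} {f h : B ⇒ C} {g k : A ⇒ B} → f ≈ h → g ≈ k → f ∘ g ≈ h ∘ k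
    identityˡ : ∀ {A B} {f : A ⇒ B} → id ∘ f ≈ f
    identityʳ : ∀ {A B} {f : A ⇒ B} → f ∘ id ≈ f
    assoc     : ∀ {A B C D} {f : A ⇒ B} {g : B ⇒ C} {h : C ⇒ D} →
                (h ∘ g) ∘ f ≈ h ∘ (g ∘ f)

    unit : Obj
    _⊗₀_ : Obj → Obj → Obj
    _⊗₁_ : ∀ {A B C D} → A ⇒ B → C ⇒ D → A ⊗₀ C ⇒ B ⊗₀ D
    ⊗-resp-≈ : ∀ {A B C D} {f h : A ⇒ B} {g k : C ⇒ D} → f ≈ h → g ≈ k → f ⊗₁ g ≈ h ⊗₁ k
    ⊗-id     : ∀ {A B} → id {A} ⊗₁ id {B} ≈ id
    ⊗-∘      : ∀ {A B C A′ B′ C′} {f : A ⇒ B} {g : B ⇒ C} {f′ : A′ ⇒ B′} {g′ : B′ ⇒ C′} →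
               (g ∘ f) ⊗₁ (g′ ∘ f′) ≈ (g ⊗₁ g′) ∘ (f ⊗₁ f′)

    α⇒ : ∀ {A B C} → (A ⊗₀ B) ⊗₀ C ⇒ A ⊗₀ (B ⊗₀ C)
    α⇐ : ∀ {A B C} → A ⊗₀ (B ⊗₀ C) ⇒ (A ⊗₀ B) ⊗₀ C
    λ⇒ : ∀ {A} → unit ⊗₀ A ⇒ A
    λ⇐ : ∀ {A} → A ⇒ unit ⊗₀ A
    ρ⇒ : ∀ {A} → A ⊗₀ unit ⇒ A
    ρ⇐ : ∀ {A} → A ⇒ A ⊗₀ unit
    α-isoˡ : ∀ {A B C} → α⇐ ∘ α⇒ {A} {B} {C} ≈ id
    α-isoʳ : ∀ {A B C} → α⇒ ∘ α⇐ {A} {B} {C} ≈ id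
    λ-isoˡ : ∀ {A} → λ⇐ ∘ λ⇒ {A} ≈ id
    λ-isoʳ : ∀ {A} → λ⇒ ∘ λ⇐ {A} ≈ id
    ρ-isoˡ : ∀ {A} → ρ⇐ ∘ ρ⇒ {A} ≈ id
    ρ-isoʳ : ∀ {A} → ρ⇒ ∘ ρ⇐ {A} ≈ id
    α-natural : ∀ {A B C A′ B′ C′} {f : A ⇒ A′} {g : B ⇒ B′} {h : C ⇒ C′} →
                α⇒ ∘ ((f ⊗₁ g) ⊗₁ h) ≈ (f ⊗₁ (g ⊗₁ h)) ∘ α⇒
    λ-natural : ∀ {A B} {f : A ⇒ B} → λ⇒ ∘ (id ⊗₁ f) ≈ f ∘ λ⇒
    ρ-natural : ∀ {A B} {f : A ⇒ B} → ρ⇒ ∘ (f ⊗₁ id) ≈ f ∘ ρ⇒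
    triangle  : ∀ {A B} → (id {A} ⊗₁ λ⇒ {B}) ∘ α⇒ ≈ ρ⇒ ⊗₁ id
    pentagon  : ∀ {A B C D} →
                (id {A} ⊗₁ α⇒ {B} {C} {D}) ∘ (α⇒ ∘ (α⇒ ⊗₁ id)) ≈ α⇒ ∘ α⇒

    σ : ∀ {A B} → A ⊗₀ B ⇒ B ⊗₀ A
    σ-natural    : ∀ {A B A′ B′} {f : A ⇒ A′} {g : B ⇒ B′} →
                   σ ∘ (f ⊗₁ g) ≈ (g ⊗₁ f) ∘ σ
    σ-involutive : ∀ {A B} → σ ∘ σ {A} {B} ≈ id
    hexagon      : ∀ {A B C} →
                   α⇒ ∘ (σ ∘ α⇒ {A} {B} {C}) ≈ (id ⊗₁ σ) ∘ (α⇒ ∘ (σ ⊗₁ id))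

  exchange : ∀ {A B C} → A ⊗₀ (B ⊗₀ C) ⇒ B ⊗₀ (A ⊗₀ C)
  exchange = α⇒ ∘ ((σ ⊗₁ id) ∘ α⇐)

  interchange : ∀ {A A′ B B′} → (A ⊗₀ A′) ⊗₀ (B ⊗₀ B′) ⇒ (A ⊗₀ B) ⊗₀ (A′ ⊗₀ B′)
  interchange = α⇐ ∘ ((id ⊗₁ exchange) ∘ α⇒)

  field
    copy    : ∀ {A} → A ⇒ A ⊗₀ A
    discard : ∀ {A} → A ⇒ unit
    discard-unique   : ∀ {A} (f : A ⇒ unit) → f ≈ discard
    copy-assoc       : ∀ {A} → α⇒ ∘ ((copy ⊗₁ id) ∘ copy {A}) ≈ (id ⊗₁ copy) ∘ copy
    copy-unitˡ       : ∀ {A} → λ⇒ ∘ ((discard ⊗₁ id) ∘ copy {A}) ≈ id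
    copy-commutative : ∀ {A} → σ ∘ copy {A} ≈ copy
    copy-⊗           : ∀ {A B} → copy {A ⊗₀ B} ≈ interchange ∘ (copy ⊗₁ copy)

  Deterministic : ∀ {A B} → A ⇒ B → Set e
  Deterministic f = copy ∘ f ≈ (f ⊗₁ f) ∘ copy

  Epic : ∀ {A B} → A ⇒ B → Set (o ⊔ ℓ ⊔ e)
  Epic {A} {B} f = ∀ {C} (g h : B ⇒ C) → g ∘ f ≈ h ∘ f → g ≈ h

  homSetoid : Obj → Obj → Setoid ℓ e
  homSetoid A B = record { Carrier = A ⇒ B ; _≈_ = _≈_ ; isEquivalence = equiv }

module Reasoning {o ℓ e} (C : MarkovCategory o ℓ e) where
  open MarkovCategory C

  module _ {A B : Obj} where
    open SetoidReasoning (homSetoid A B) public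
    open IsEquivalence (equiv {A} {B}) public using (refl; sym; trans)

  ∘-respˡ : ∀ {A B C} {f h : B ⇒ C} {g : A ⇒ B} → f ≈ h → f ∘ g ≈ h ∘ g
  ∘-respˡ p = ∘-resp-≈ p refl

  ∘-respʳ : ∀ {A B C} {f : B ⇒ C} {g k : A ⇒ B} → g ≈ k → f ∘ g ≈ f ∘ k
  ∘-respʳ p = ∘-resp-≈ refl p

  ⊗-respˡ : ∀ {A B C D} {f h : A ⇒ B} {g : C ⇒ D} → f ≈ h → f ⊗₁ g ≈ h ⊗₁ g
  ⊗-respˡ p = ⊗-resp-≈ p refl

  ⊗-respʳ : ∀ {A B C D} {f : A ⇒ B} {g k : C ⇒ D} → g ≈ k → f ⊗₁ g ≈ f ⊗₁ k
  ⊗-respʳ p = ⊗-resp-≈ refl p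

  pullˡ : ∀ {A B C D} {a : C ⇒ D} {b : B ⇒ C} {c : B ⇒ D} {f : A ⇒ B} →
          a ∘ b ≈ c → a ∘ (b ∘ f) ≈ c ∘ f
  pullˡ p = trans (sym assoc) (∘-respˡ p)

  pushˡ : ∀ {A B C D} {a : C ⇒ D} {b : B ⇒ C} {c : B ⇒ D} {f : A ⇒ B} →
          c ≈ a ∘ b → c ∘ f ≈ a ∘ (b ∘ f)
  pushˡ p = trans (∘-respˡ p) assoc

  pullʳ : ∀ {A B C D} {f : C ⇒ D} {a : B ⇒ C} {b : A ⇒ B} {c : A ⇒ C} →
          a ∘ b ≈ c → (f ∘ a) ∘ b ≈ f ∘ c
  pullʳ p = trans assoc (∘-respʳ p)

  extendʳ : ∀ {A B B′ C D} {a : C ⇒ D} {b : B ⇒ C} {c : B′ ⇒ D} {d : B ⇒ B′} {f : A ⇒ B} →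
            a ∘ b ≈ c ∘ d → a ∘ (b ∘ f) ≈ c ∘ (d ∘ f)
  extendʳ p = trans (pullˡ p) assoc

  cancelˡ : ∀ {A B C} {a : C ⇒ B} {b : B ⇒ C} {f : A ⇒ B} → a ∘ b ≈ id → a ∘ (b ∘ f) ≈ f
  cancelˡ p = trans (pullˡ p) identityˡ

  cancelʳ : ∀ {A B C} {a : C ⇒ B} {b : B ⇒ C} {f : B ⇒ A} → a ∘ b ≈ id → (f ∘ a) ∘ b ≈ f
  cancelʳ p = trans (pullʳ p) identityʳ

  -- Stacking of commuting squares with vertical sides φ, ψ, χ.
  glue : ∀ {A B C A′ B′ C′} {φ : A′ ⇒ A} {ψ : B′ ⇒ B} {χ : C′ ⇒ C}
           {f : A ⇒ B} {g : B ⇒ C} {f′ : A′ ⇒ B′} {g′ : B′ ⇒ C′} →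
         g ∘ ψ ≈ χ ∘ g′ → f ∘ φ ≈ ψ ∘ f′ → (g ∘ f) ∘ φ ≈ χ ∘ (g′ ∘ f′)
  glue p q = trans (pullʳ q) (extendʳ p)

  glue-⊗ : ∀ {A B A′ B′ C D C′ D′} {φ : A′ ⇒ A} {ψ : B′ ⇒ B} {φ′ : C′ ⇒ C} {ψ′ : D′ ⇒ D}
             {f : A ⇒ B} {f′ : A′ ⇒ B′} {g : C ⇒ D} {g′ : C′ ⇒ D′} →
           f ∘ φ ≈ ψ ∘ f′ → g ∘ φ′ ≈ ψ′ ∘ g′ →
           (f ⊗₁ g) ∘ (φ ⊗₁ φ′) ≈ (ψ ⊗₁ ψ′) ∘ (f′ ⊗₁ g′)
  glue-⊗ p q = trans (sym ⊗-∘) (trans (⊗-resp-≈ p q) ⊗-∘)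

  idsq : ∀ {A B} {f : A ⇒ B} → id ∘ f ≈ f ∘ id
  idsq = trans identityˡ (sym identityʳ)

  id-⊗-∘ : ∀ {A B C D} {f : A ⇒ B} {g : B ⇒ C} → id {D} ⊗₁ (g ∘ f) ≈ (id ⊗₁ g) ∘ (id ⊗₁ f)
  id-⊗-∘ = trans (⊗-respˡ (sym identityˡ)) ⊗-∘

  ⊗-id-∘ : ∀ {A B C D} {f : A ⇒ B} {g : B ⇒ C} → (g ∘ f) ⊗₁ id {D} ≈ (g ⊗₁ id) ∘ (f ⊗₁ id)
  ⊗-id-∘ = trans (⊗-respʳ (sym identityˡ)) ⊗-∘

  ⊗-iso : ∀ {A B C D} {f : A ⇒ B} {g : B ⇒ A} {h : C ⇒ D} {k : D ⇒ C} →
          f ∘ g ≈ id → h ∘ k ≈ id → (f ⊗₁ h) ∘ (g ⊗₁ k) ≈ id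
  ⊗-iso p q = trans (sym ⊗-∘) (trans (⊗-resp-≈ p q) ⊗-id)

  ∘-iso : ∀ {A B C} {f : B ⇒ A} {g : A ⇒ B} {h : C ⇒ B} {k : B ⇒ C} →
          f ∘ g ≈ id → h ∘ k ≈ id → (f ∘ h) ∘ (k ∘ g) ≈ id
  ∘-iso p q = trans assoc (trans (∘-respʳ (cancelˡ q)) p)

  -- Cancelling a split epi (resp. split mono).
  epi : ∀ {A B C} {f : A ⇒ B} {g : B ⇒ A} {h k : B ⇒ C} → f ∘ g ≈ id → h ∘ f ≈ k ∘ f → h ≈ k
  epi {f = f} {g} {h} {k} p q = begin
    h             ≈⟨ cancelʳ p ⟨
    (h ∘ f) ∘ g   ≈⟨ ∘-respˡ q ⟩
    (k ∘ f) ∘ g   ≈⟨ cancelʳ p ⟩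
    k             ∎

  mono : ∀ {A B C} {f : A ⇒ B} {g : B ⇒ A} {h k : C ⇒ A} → g ∘ f ≈ id → f ∘ h ≈ f ∘ k → h ≈ k
  mono {f = f} {g} {h} {k} p q = begin
    h             ≈⟨ cancelˡ p ⟨
    g ∘ (f ∘ h)   ≈⟨ ∘-respʳ q ⟩
    g ∘ (f ∘ k)   ≈⟨ cancelˡ p ⟩
    k             ∎

  -- Inverting the vertical sides of a commuting square.
  flip-square : ∀ {A B A′ B′} {f : A ⇒ B} {f′ : A′ ⇒ B′} {φ : A′ ⇒ A} {φ⁻¹ : A ⇒ A′}
                  {ψ : B′ ⇒ B} {ψ⁻¹ : B ⇒ B′} →
                φ ∘ φ⁻¹ ≈ id → ψ⁻¹ ∘ ψ ≈ id → f ∘ φ ≈ ψ ∘ f′ → f′ ∘ φ⁻¹ ≈ ψ⁻¹ ∘ f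
  flip-square {f = f} {f′} {φ} {φ⁻¹} {ψ} {ψ⁻¹} p q r = begin
    f′ ∘ φ⁻¹              ≈⟨ ∘-respˡ (cancelˡ q) ⟨
    (ψ⁻¹ ∘ ψ ∘ f′) ∘ φ⁻¹  ≈⟨ ∘-respˡ (∘-respʳ r) ⟨
    (ψ⁻¹ ∘ f ∘ φ) ∘ φ⁻¹   ≈⟨ ∘-respˡ assoc ⟨
    ((ψ⁻¹ ∘ f) ∘ φ) ∘ φ⁻¹ ≈⟨ cancelʳ p ⟩
    ψ⁻¹ ∘ f               ∎

module Coherence {o ℓ e} (C : MarkovCategory o ℓ e) where
  open MarkovCategory C
  open Reasoning C

  id⊗-injective : ∀ {A B} {f g : A ⇒ B} → id {unit} ⊗₁ f ≈ id ⊗₁ g → f ≈ g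
  id⊗-injective p =
    epi λ-isoʳ (trans (sym λ-natural) (trans (∘-respʳ p) λ-natural))

  ⊗id-injective : ∀ {A B} {f g : A ⇒ B} → f ⊗₁ id {unit} ≈ g ⊗₁ id → f ≈ g
  ⊗id-injective p =
    epi ρ-isoʳ (trans (sym ρ-natural) (trans (∘-respʳ p) ρ-natural))

  α-naturalᵈ : ∀ {A A′ B C} {f : A ⇒ A′} → α⇒ {A′} {B} {C} ∘ ((f ⊗₁ id) ⊗₁ id) ≈ (f ⊗₁ id) ∘ α⇒
  α-naturalᵈ = trans α-natural (∘-respˡ (⊗-respʳ ⊗-id))

  α-naturalᵘ : ∀ {A B C C′} {f : C ⇒ C′} → α⇒ {A} {B} ∘ (id ⊗₁ f) ≈ (id ⊗₁ (id ⊗₁ f)) ∘ α⇒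
  α-naturalᵘ = trans (∘-respʳ (⊗-respˡ (sym ⊗-id))) α-natural

  λ-⊗ : ∀ {A B} → λ⇒ {A ⊗₀ B} ∘ α⇒ ≈ λ⇒ ⊗₁ id
  λ-⊗ = id⊗-injective (epi (∘-iso α-isoʳ (⊗-iso α-isoʳ identityˡ)) (begin
    (id ⊗₁ (λ⇒ ∘ α⇒)) ∘ (α⇒ ∘ (α⇒ ⊗₁ id))          ≈⟨ pushˡ id-⊗-∘ ⟩
    (id ⊗₁ λ⇒) ∘ ((id ⊗₁ α⇒) ∘ (α⇒ ∘ (α⇒ ⊗₁ id)))  ≈⟨ ∘-respʳ pentagon ⟩
    (id ⊗₁ λ⇒) ∘ (α⇒ ∘ α⇒)                         ≈⟨ pullˡ triangle ⟩
    (ρ⇒ ⊗₁ id) ∘ α⇒                                ≈⟨ α-naturalᵈ ⟨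
    α⇒ ∘ ((ρ⇒ ⊗₁ id) ⊗₁ id)                        ≈⟨ ∘-respʳ (⊗-respˡ triangle) ⟨
    α⇒ ∘ (((id ⊗₁ λ⇒) ∘ α⇒) ⊗₁ id)                 ≈⟨ ∘-respʳ ⊗-id-∘ ⟩
    α⇒ ∘ (((id ⊗₁ λ⇒) ⊗₁ id) ∘ (α⇒ ⊗₁ id))         ≈⟨ extendʳ α-natural ⟩
    (id ⊗₁ (λ⇒ ⊗₁ id)) ∘ (α⇒ ∘ (α⇒ ⊗₁ id))         ∎))

  ρ-⊗ : ∀ {A B} → ρ⇒ {A ⊗₀ B} ≈ (id ⊗₁ ρ⇒) ∘ α⇒
  ρ-⊗ = ⊗id-injective (mono α-isoˡ (begin
    α⇒ ∘ (ρ⇒ ⊗₁ id)                                        ≈⟨ ∘-respʳ triangle ⟨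
    α⇒ ∘ ((id ⊗₁ λ⇒) ∘ α⇒)                                 ≈⟨ extendʳ α-naturalᵘ ⟩
    (id ⊗₁ (id ⊗₁ λ⇒)) ∘ (α⇒ ∘ α⇒)                         ≈⟨ ∘-respʳ pentagon ⟨
    (id ⊗₁ (id ⊗₁ λ⇒)) ∘ ((id ⊗₁ α⇒) ∘ (α⇒ ∘ (α⇒ ⊗₁ id)))  ≈⟨ pullˡ (sym id-⊗-∘) ⟩
    (id ⊗₁ ((id ⊗₁ λ⇒) ∘ α⇒)) ∘ (α⇒ ∘ (α⇒ ⊗₁ id))          ≈⟨ ∘-respˡ (⊗-respʳ triangle) ⟩
    (id ⊗₁ (ρ⇒ ⊗₁ id)) ∘ (α⇒ ∘ (α⇒ ⊗₁ id))                 ≈⟨ extendʳ α-natural ⟨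
    α⇒ ∘ (((id ⊗₁ ρ⇒) ⊗₁ id) ∘ (α⇒ ⊗₁ id))                 ≈⟨ ∘-respʳ ⊗-id-∘ ⟨
    α⇒ ∘ (((id ⊗₁ ρ⇒) ∘ α⇒) ⊗₁ id)                         ∎))

  λ-unit≈ρ-unit : λ⇒ {unit} ≈ ρ⇒
  λ-unit≈ρ-unit = trans (discard-unique _) (sym (discard-unique _))

  λ-σ : ∀ {A} → λ⇒ {A} ∘ σ ≈ ρ⇒
  λ-σ = ⊗id-injective (mono σ-involutive (begin
    σ ∘ ((λ⇒ ∘ σ) ⊗₁ id)                      ≈⟨ ∘-respʳ ⊗-id-∘ ⟩
    σ ∘ ((λ⇒ ⊗₁ id) ∘ (σ ⊗₁ id))              ≈⟨ ∘-respʳ (∘-respˡ λ-⊗) ⟨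
    σ ∘ ((λ⇒ ∘ α⇒) ∘ (σ ⊗₁ id))               ≈⟨ ∘-respʳ assoc ⟩
    σ ∘ (λ⇒ ∘ (α⇒ ∘ (σ ⊗₁ id)))               ≈⟨ extendʳ λ-natural ⟨
    λ⇒ ∘ ((id ⊗₁ σ) ∘ (α⇒ ∘ (σ ⊗₁ id)))       ≈⟨ ∘-respʳ hexagon ⟨
    λ⇒ ∘ (α⇒ ∘ (σ ∘ α⇒))                      ≈⟨ pullˡ λ-⊗ ⟩
    (λ⇒ ⊗₁ id) ∘ (σ ∘ α⇒)                     ≈⟨ extendʳ σ-natural ⟨
    σ ∘ ((id ⊗₁ λ⇒) ∘ α⇒)                     ≈⟨ ∘-respʳ triangle ⟩
    σ ∘ (ρ⇒ ⊗₁ id)                            ∎))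

  ρ-σ : ∀ {A} → ρ⇒ {A} ∘ σ ≈ λ⇒
  ρ-σ = trans (∘-respˡ (sym λ-σ)) (cancelʳ σ-involutive)

  exchange-α : ∀ {A B C} → exchange {A} {B} {C} ∘ α⇒ ≈ α⇒ ∘ (σ ⊗₁ id)
  exchange-α = trans assoc (∘-respʳ (cancelʳ α-isoˡ))

  exchange-natural : ∀ {A B C A′ B′ C′} {f : A ⇒ A′} {g : B ⇒ B′} {h : C ⇒ C′} →
    exchange ∘ (f ⊗₁ (g ⊗₁ h)) ≈ (g ⊗₁ (f ⊗₁ h)) ∘ exchange
  exchange-natural =
    glue α-natural (glue (glue-⊗ σ-natural idsq)
      (sym (flip-square α-isoʳ α-isoˡ (sym α-natural))))

  exchange-involutive : ∀ {A B C} → exchange ∘ exchange {A} {B} {C} ≈ id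
  exchange-involutive = begin
    (α⇒ ∘ ((σ ⊗₁ id) ∘ α⇐)) ∘ (α⇒ ∘ ((σ ⊗₁ id) ∘ α⇐))
      ≈⟨ pullʳ (pullʳ (cancelˡ α-isoˡ)) ⟩
    α⇒ ∘ ((σ ⊗₁ id) ∘ ((σ ⊗₁ id) ∘ α⇐))
      ≈⟨ ∘-respʳ (cancelˡ (⊗-iso σ-involutive identityˡ)) ⟩
    α⇒ ∘ α⇐
      ≈⟨ α-isoʳ ⟩
    id ∎

  exchange-⊗₂ : ∀ {X Y Z W} →
    α⇒ {Y} {Z} {X ⊗₀ W} ∘ exchange ≈ (id ⊗₁ exchange) ∘ (exchange ∘ (id ⊗₁ α⇒))
  exchange-⊗₂ {X} {Y} {Z} {W} = epi (∘-iso α-isoʳ (⊗-iso α-isoʳ identityˡ)) (begin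
    (α⇒ ∘ exchange) ∘ (α⇒ ∘ (α⇒ ⊗₁ id))
      ≈⟨ pullʳ (pullˡ exchange-α) ⟩
    α⇒ ∘ ((α⇒ ∘ (σ ⊗₁ id)) ∘ (α⇒ ⊗₁ id))
      ≈⟨ ∘-respʳ assoc ⟩
    α⇒ ∘ (α⇒ ∘ ((σ ⊗₁ id) ∘ (α⇒ ⊗₁ id)))
      ≈⟨ extendʳ (trans (sym pentagon) (sym assoc)) ⟩
    ((id ⊗₁ α⇒) ∘ α⇒) ∘ ((α⇒ ⊗₁ id) ∘ ((σ ⊗₁ id) ∘ (α⇒ ⊗₁ id)))
      ≈⟨ ∘-respʳ (trans (∘-respʳ (sym ⊗-id-∘)) (sym ⊗-id-∘)) ⟩
    ((id ⊗₁ α⇒) ∘ α⇒) ∘ ((α⇒ ∘ (σ ∘ α⇒)) ⊗₁ id)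
      ≈⟨ ∘-respʳ (⊗-respˡ hexagon) ⟩
    ((id ⊗₁ α⇒) ∘ α⇒) ∘ (((id ⊗₁ σ) ∘ (α⇒ ∘ (σ ⊗₁ id))) ⊗₁ id)
      ≈⟨ ∘-respʳ ⊗-id-∘ ⟩
    ((id ⊗₁ α⇒) ∘ α⇒) ∘ (((id ⊗₁ σ) ⊗₁ id) ∘ ((α⇒ ∘ (σ ⊗₁ id)) ⊗₁ id))
      ≈⟨ pullʳ (extendʳ α-natural) ⟩
    (id ⊗₁ α⇒) ∘ ((id ⊗₁ (σ ⊗₁ id)) ∘ (α⇒ ∘ ((α⇒ ∘ (σ ⊗₁ id)) ⊗₁ id)))
      ≈⟨ pullˡ (sym id-⊗-∘) ⟩
    (id ⊗₁ (α⇒ ∘ (σ ⊗₁ id))) ∘ (α⇒ ∘ ((α⇒ ∘ (σ ⊗₁ id)) ⊗₁ id))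
      ≈⟨ ∘-respˡ (⊗-respʳ exchange-α) ⟨
    (id ⊗₁ (exchange ∘ α⇒)) ∘ (α⇒ ∘ ((α⇒ ∘ (σ ⊗₁ id)) ⊗₁ id))
      ≈⟨ pushˡ id-⊗-∘ ⟩
    (id ⊗₁ exchange) ∘ ((id ⊗₁ α⇒) ∘ (α⇒ ∘ ((α⇒ ∘ (σ ⊗₁ id)) ⊗₁ id)))
      ≈⟨ ∘-respʳ (∘-respʳ (∘-respʳ ⊗-id-∘)) ⟩
    (id ⊗₁ exchange) ∘ ((id ⊗₁ α⇒) ∘ (α⇒ ∘ ((α⇒ ⊗₁ id) ∘ ((σ ⊗₁ id) ⊗₁ id))))
      ≈⟨ ∘-respʳ (trans (∘-respʳ (sym assoc)) (extendʳ pentagon)) ⟩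
    (id ⊗₁ exchange) ∘ (α⇒ ∘ (α⇒ ∘ ((σ ⊗₁ id) ⊗₁ id)))
      ≈⟨ ∘-respʳ (∘-respʳ α-naturalᵈ) ⟩
    (id ⊗₁ exchange) ∘ (α⇒ ∘ ((σ ⊗₁ id) ∘ α⇒))
      ≈⟨ ∘-respʳ (extendʳ exchange-α) ⟨
    (id ⊗₁ exchange) ∘ (exchange ∘ (α⇒ ∘ α⇒))
      ≈⟨ ∘-respʳ (∘-respʳ pentagon) ⟨
    (id ⊗₁ exchange) ∘ (exchange ∘ ((id ⊗₁ α⇒) ∘ (α⇒ ∘ (α⇒ ⊗₁ id))))
      ≈⟨ trans assoc (∘-respʳ assoc) ⟨
    ((id ⊗₁ exchange) ∘ (exchange ∘ (id ⊗₁ α⇒))) ∘ (α⇒ ∘ (α⇒ ⊗₁ id)) ∎)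

  exchange-⊗₁ : ∀ {X Y Z W} →
    (id ⊗₁ α⇒) ∘ exchange {X ⊗₀ Y} {Z} {W} ≈ exchange ∘ ((id ⊗₁ exchange) ∘ α⇒)
  exchange-⊗₁ = begin
    (id ⊗₁ α⇒) ∘ exchange
      ≈⟨ cancelˡ exchange-involutive ⟨
    exchange ∘ (exchange ∘ ((id ⊗₁ α⇒) ∘ exchange))
      ≈⟨ ∘-respʳ (cancelˡ (⊗-iso identityˡ exchange-involutive)) ⟨
    exchange ∘ ((id ⊗₁ exchange) ∘ ((id ⊗₁ exchange) ∘ (exchange ∘ ((id ⊗₁ α⇒) ∘ exchange))))
      ≈⟨ ∘-respʳ (∘-respʳ (trans (pushˡ exchange-⊗₂) (∘-respʳ assoc))) ⟨
    exchange ∘ ((id ⊗₁ exchange) ∘ ((α⇒ ∘ exchange) ∘ exchange))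
      ≈⟨ ∘-respʳ (∘-respʳ (cancelʳ exchange-involutive)) ⟩
    exchange ∘ ((id ⊗₁ exchange) ∘ α⇒) ∎

  exchange-α⊗ : ∀ {X Y Z W} →
    (id ⊗₁ α⇒) ∘ (α⇒ ∘ (exchange {X} {Y} {Z} ⊗₁ id {W})) ≈ exchange ∘ ((id ⊗₁ α⇒) ∘ α⇒)
  exchange-α⊗ = epi (⊗-iso α-isoʳ identityˡ) (begin
    ((id ⊗₁ α⇒) ∘ (α⇒ ∘ (exchange ⊗₁ id))) ∘ (α⇒ ⊗₁ id)
      ≈⟨ pullʳ (pullʳ (trans (sym ⊗-id-∘) (trans (⊗-respˡ exchange-α) ⊗-id-∘))) ⟩
    (id ⊗₁ α⇒) ∘ (α⇒ ∘ ((α⇒ ⊗₁ id) ∘ ((σ ⊗₁ id) ⊗₁ id)))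
      ≈⟨ trans (∘-respʳ (sym assoc)) (extendʳ pentagon) ⟩
    α⇒ ∘ (α⇒ ∘ ((σ ⊗₁ id) ⊗₁ id))
      ≈⟨ ∘-respʳ α-naturalᵈ ⟩
    α⇒ ∘ ((σ ⊗₁ id) ∘ α⇒)
      ≈⟨ extendʳ exchange-α ⟨
    exchange ∘ (α⇒ ∘ α⇒)
      ≈⟨ ∘-respʳ pentagon ⟨
    exchange ∘ ((id ⊗₁ α⇒) ∘ (α⇒ ∘ (α⇒ ⊗₁ id)))
      ≈⟨ trans assoc (∘-respʳ assoc) ⟨
    (exchange ∘ ((id ⊗₁ α⇒) ∘ α⇒)) ∘ (α⇒ ⊗₁ id) ∎)

  α-interchange : ∀ {A A′ B B′} →
    α⇒ ∘ interchange {A} {A′} {B} {B′} ≈ (id ⊗₁ exchange) ∘ α⇒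
  α-interchange = cancelˡ α-isoʳ

  interchange-natural : ∀ {A A′ B B′ D D′ E E′}
    {f : A ⇒ D} {f′ : A′ ⇒ D′} {g : B ⇒ E} {g′ : B′ ⇒ E′} →
    interchange ∘ ((f ⊗₁ f′) ⊗₁ (g ⊗₁ g′)) ≈ ((f ⊗₁ g) ⊗₁ (f′ ⊗₁ g′)) ∘ interchange
  interchange-natural =
    glue (sym (flip-square α-isoʳ α-isoˡ (sym α-natural)))
      (glue (glue-⊗ idsq exchange-natural) α-natural)

  pentagon′ : ∀ {A B C D E} {f : E ⇒ ((A ⊗₀ B) ⊗₀ C) ⊗₀ D} →
    (id ⊗₁ α⇒) ∘ (α⇒ ∘ ((α⇒ ⊗₁ id) ∘ f)) ≈ α⇒ ∘ (α⇒ ∘ f)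
  pentagon′ = trans (∘-respʳ (sym assoc)) (extendʳ pentagon)

  interchange-assoc : ∀ {A A′ B B′ C C′} →
    (α⇒ ⊗₁ α⇒) ∘ (interchange {A ⊗₀ B} {A′ ⊗₀ B′} {C} {C′} ∘ (interchange ⊗₁ id))
      ≈ interchange ∘ ((id ⊗₁ interchange) ∘ α⇒)
  interchange-assoc {A} {A′} {B} {B′} {C} {C′} =
    mono (∘-iso α-isoˡ (⊗-iso identityˡ α-isoˡ)) (trans left (sym right))
    where
    inner : B ⊗₀ (A′ ⊗₀ (B′ ⊗₀ (C ⊗₀ C′))) ⇒ B ⊗₀ (C ⊗₀ (A′ ⊗₀ (B′ ⊗₀ C′)))
    inner = id ⊗₁ (exchange ∘ (id ⊗₁ exchange))

    normal : A ⊗₀ (A′ ⊗₀ ((B ⊗₀ B′) ⊗₀ (C ⊗₀ C′)))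
             ⇒ A ⊗₀ (B ⊗₀ (C ⊗₀ (A′ ⊗₀ (B′ ⊗₀ C′))))
    normal = id ⊗₁ (inner ∘ (exchange ∘ (id ⊗₁ α⇒)))

    right : ((id ⊗₁ α⇒) ∘ α⇒) ∘ (interchange ∘ ((id ⊗₁ interchange) ∘ α⇒))
              ≈ normal ∘ (α⇒ ∘ α⇒)
    right = begin
      ((id ⊗₁ α⇒) ∘ α⇒) ∘ (interchange ∘ ((id ⊗₁ interchange) ∘ α⇒))
        ≈⟨ pullʳ (extendʳ α-interchange) ⟩
      (id ⊗₁ α⇒) ∘ ((id ⊗₁ exchange) ∘ (α⇒ ∘ ((id ⊗₁ interchange) ∘ α⇒)))
        ≈⟨ pullˡ (sym id-⊗-∘) ⟩
      (id ⊗₁ (α⇒ ∘ exchange)) ∘ (α⇒ ∘ ((id ⊗₁ interchange) ∘ α⇒))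
        ≈⟨ ∘-respʳ (extendʳ α-naturalᵘ) ⟩
      (id ⊗₁ (α⇒ ∘ exchange)) ∘ ((id ⊗₁ (id ⊗₁ interchange)) ∘ (α⇒ ∘ α⇒))
        ≈⟨ pullˡ (sym id-⊗-∘) ⟩
      (id ⊗₁ ((α⇒ ∘ exchange) ∘ (id ⊗₁ interchange))) ∘ (α⇒ ∘ α⇒)
        ≈⟨ ∘-respˡ (⊗-respʳ bracket) ⟩
      normal ∘ (α⇒ ∘ α⇒) ∎
      where
      bracket : (α⇒ ∘ exchange) ∘ (id ⊗₁ interchange) ≈ inner ∘ (exchange ∘ (id ⊗₁ α⇒))
      bracket = begin
        (α⇒ ∘ exchange) ∘ (id ⊗₁ interchange)
          ≈⟨ ∘-respˡ exchange-⊗₂ ⟩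
        ((id ⊗₁ exchange) ∘ (exchange ∘ (id ⊗₁ α⇒))) ∘ (id ⊗₁ interchange)
          ≈⟨ pullʳ (pullʳ (sym id-⊗-∘)) ⟩
        (id ⊗₁ exchange) ∘ (exchange ∘ (id ⊗₁ (α⇒ ∘ interchange)))
          ≈⟨ ∘-respʳ (∘-respʳ (trans (⊗-respʳ α-interchange) id-⊗-∘)) ⟩
        (id ⊗₁ exchange) ∘ (exchange ∘ ((id ⊗₁ (id ⊗₁ exchange)) ∘ (id ⊗₁ α⇒)))
          ≈⟨ ∘-respʳ (extendʳ exchange-natural) ⟩
        (id ⊗₁ exchange) ∘ ((id ⊗₁ (id ⊗₁ exchange)) ∘ (exchange ∘ (id ⊗₁ α⇒)))
          ≈⟨ pullˡ (sym id-⊗-∘) ⟩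
        inner ∘ (exchange ∘ (id ⊗₁ α⇒)) ∎

    outer : ((id ⊗₁ α⇒) ∘ α⇒) ∘ ((α⇒ ⊗₁ α⇒) ∘ interchange)
              ≈ (id ⊗₁ inner) ∘ (α⇒ ∘ ((id ⊗₁ α⇒) ∘ α⇒))
    outer = begin
      ((id ⊗₁ α⇒) ∘ α⇒) ∘ ((α⇒ ⊗₁ α⇒) ∘ interchange)
        ≈⟨ pullʳ (∘-respʳ (pushˡ (trans (⊗-resp-≈ (sym identityʳ) (sym identityˡ)) ⊗-∘))) ⟩
      (id ⊗₁ α⇒) ∘ (α⇒ ∘ ((α⇒ ⊗₁ id) ∘ ((id ⊗₁ α⇒) ∘ interchange)))
        ≈⟨ pentagon′ ⟩
      α⇒ ∘ (α⇒ ∘ ((id ⊗₁ α⇒) ∘ interchange))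
        ≈⟨ ∘-respʳ (extendʳ α-naturalᵘ) ⟩
      α⇒ ∘ ((id ⊗₁ (id ⊗₁ α⇒)) ∘ (α⇒ ∘ interchange))
        ≈⟨ ∘-respʳ (∘-respʳ α-interchange) ⟩
      α⇒ ∘ ((id ⊗₁ (id ⊗₁ α⇒)) ∘ ((id ⊗₁ exchange) ∘ α⇒))
        ≈⟨ ∘-respʳ (pullˡ (trans (sym id-⊗-∘) (⊗-respʳ (trans exchange-⊗₁ (sym assoc))))) ⟩
      α⇒ ∘ ((id ⊗₁ ((exchange ∘ (id ⊗₁ exchange)) ∘ α⇒)) ∘ α⇒)
        ≈⟨ ∘-respʳ (pushˡ id-⊗-∘) ⟩
      α⇒ ∘ ((id ⊗₁ (exchange ∘ (id ⊗₁ exchange))) ∘ ((id ⊗₁ α⇒) ∘ α⇒))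
        ≈⟨ extendʳ α-naturalᵘ ⟩
      (id ⊗₁ inner) ∘ (α⇒ ∘ ((id ⊗₁ α⇒) ∘ α⇒)) ∎

    left : ((id ⊗₁ α⇒) ∘ α⇒) ∘ ((α⇒ ⊗₁ α⇒) ∘ (interchange ∘ (interchange ⊗₁ id)))
             ≈ normal ∘ (α⇒ ∘ α⇒)
    left = begin
      ((id ⊗₁ α⇒) ∘ α⇒) ∘ ((α⇒ ⊗₁ α⇒) ∘ (interchange ∘ (interchange ⊗₁ id)))
        ≈⟨ ∘-respʳ assoc ⟨
      ((id ⊗₁ α⇒) ∘ α⇒) ∘ (((α⇒ ⊗₁ α⇒) ∘ interchange) ∘ (interchange ⊗₁ id))
        ≈⟨ pullˡ outer ⟩
      ((id ⊗₁ inner) ∘ (α⇒ ∘ ((id ⊗₁ α⇒) ∘ α⇒))) ∘ (interchange ⊗₁ id)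
        ≈⟨ pullʳ (trans (pullʳ assoc) (extendʳ α-naturalᵘ)) ⟩
      (id ⊗₁ inner) ∘ ((id ⊗₁ (id ⊗₁ α⇒)) ∘ (α⇒ ∘ (α⇒ ∘ (interchange ⊗₁ id))))
        ≈⟨ ∘-respʳ (∘-respʳ pentagon′-interchange) ⟩
      (id ⊗₁ inner) ∘ ((id ⊗₁ (id ⊗₁ α⇒)) ∘ ((id ⊗₁ α⇒) ∘ ((id ⊗₁ (exchange ⊗₁ id)) ∘ (α⇒ ∘ (α⇒ ⊗₁ id)))))
        ≈⟨ ∘-respʳ (trans (∘-respʳ (pullˡ (sym id-⊗-∘))) (pullˡ (sym id-⊗-∘))) ⟩
      (id ⊗₁ inner) ∘ ((id ⊗₁ ((id ⊗₁ α⇒) ∘ (α⇒ ∘ (exchange ⊗₁ id)))) ∘ (α⇒ ∘ (α⇒ ⊗₁ id)))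
        ≈⟨ ∘-respʳ (∘-respˡ (⊗-respʳ (trans exchange-α⊗ (sym assoc)))) ⟩
      (id ⊗₁ inner) ∘ ((id ⊗₁ ((exchange ∘ (id ⊗₁ α⇒)) ∘ α⇒)) ∘ (α⇒ ∘ (α⇒ ⊗₁ id)))
        ≈⟨ ∘-respʳ (pushˡ id-⊗-∘) ⟩
      (id ⊗₁ inner) ∘ ((id ⊗₁ (exchange ∘ (id ⊗₁ α⇒))) ∘ ((id ⊗₁ α⇒) ∘ (α⇒ ∘ (α⇒ ⊗₁ id))))
        ≈⟨ pullˡ (sym id-⊗-∘) ⟩
      normal ∘ ((id ⊗₁ α⇒) ∘ (α⇒ ∘ (α⇒ ⊗₁ id)))
        ≈⟨ ∘-respʳ pentagon ⟩
      normal ∘ (α⇒ ∘ α⇒) ∎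
      where
      pentagon′-interchange :
        α⇒ ∘ (α⇒ ∘ (interchange ⊗₁ id))
          ≈ (id ⊗₁ α⇒) ∘ ((id ⊗₁ (exchange ⊗₁ id)) ∘ (α⇒ ∘ (α⇒ ⊗₁ id)))
      pentagon′-interchange = begin
        α⇒ ∘ (α⇒ ∘ (interchange ⊗₁ id))
          ≈⟨ pentagon′ ⟨
        (id ⊗₁ α⇒) ∘ (α⇒ ∘ ((α⇒ ⊗₁ id) ∘ (interchange ⊗₁ id)))
          ≈⟨ ∘-respʳ (∘-respʳ (trans (sym ⊗-id-∘) (trans (⊗-respˡ α-interchange) ⊗-id-∘))) ⟩
        (id ⊗₁ α⇒) ∘ (α⇒ ∘ (((id ⊗₁ exchange) ⊗₁ id) ∘ (α⇒ ⊗₁ id)))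
          ≈⟨ ∘-respʳ (extendʳ α-natural) ⟩
        (id ⊗₁ α⇒) ∘ ((id ⊗₁ (exchange ⊗₁ id)) ∘ (α⇒ ∘ (α⇒ ⊗₁ id))) ∎

  copy-unit : copy {unit} ≈ λ⇐
  copy-unit = mono λ-isoˡ
    (trans (discard-unique _) (sym (discard-unique _)))

  id-deterministic : ∀ {A} → Deterministic (id {A})
  id-deterministic = trans identityʳ (sym (trans (∘-respˡ ⊗-id) identityˡ))

  ∘-deterministic : ∀ {A B C} {g : B ⇒ C} {f : A ⇒ B} →
                    Deterministic g → Deterministic f → Deterministic (g ∘ f)
  ∘-deterministic p q = trans (pullˡ p) (trans (pullʳ q) (pullˡ (sym ⊗-∘)))

  ⊗-deterministic : ∀ {A B C D} {f : A ⇒ B} {g : C ⇒ D} →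
                    Deterministic f → Deterministic g → Deterministic (f ⊗₁ g)
  ⊗-deterministic {f = f} {g} p q = begin
    copy ∘ (f ⊗₁ g)                                        ≈⟨ pushˡ copy-⊗ ⟩
    interchange ∘ ((copy ⊗₁ copy) ∘ (f ⊗₁ g))              ≈⟨ ∘-respʳ (glue-⊗ p q) ⟩
    interchange ∘ (((f ⊗₁ f) ⊗₁ (g ⊗₁ g)) ∘ (copy ⊗₁ copy)) ≈⟨ extendʳ interchange-natural ⟩
    ((f ⊗₁ g) ⊗₁ (f ⊗₁ g)) ∘ (interchange ∘ (copy ⊗₁ copy)) ≈⟨ ∘-respʳ copy-⊗ ⟨
    ((f ⊗₁ g) ⊗₁ (f ⊗₁ g)) ∘ copy                          ∎

  inverse-deterministic : ∀ {A B} {f : A ⇒ B} {g : B ⇒ A} →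
    f ∘ g ≈ id → g ∘ f ≈ id → Deterministic f → Deterministic g
  inverse-deterministic p q d = flip-square p (⊗-iso q q) d

  α-deterministic : ∀ {A B C} → Deterministic (α⇒ {A} {B} {C})
  α-deterministic = sym (begin
    (α⇒ ⊗₁ α⇒) ∘ copy
      ≈⟨ ∘-respʳ (trans copy-⊗ (∘-respʳ (trans (⊗-respˡ copy-⊗)
           (trans (⊗-respʳ (sym identityˡ)) ⊗-∘)))) ⟩
    (α⇒ ⊗₁ α⇒) ∘ (interchange ∘ ((interchange ⊗₁ id) ∘ ((copy ⊗₁ copy) ⊗₁ copy)))
      ≈⟨ trans (sym (trans assoc (∘-respʳ assoc))) (trans (∘-respˡ interchange-assoc)
           (trans assoc (∘-respʳ assoc))) ⟩
    interchange ∘ ((id ⊗₁ interchange) ∘ (α⇒ ∘ ((copy ⊗₁ copy) ⊗₁ copy)))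
      ≈⟨ ∘-respʳ (∘-respʳ α-natural) ⟩
    interchange ∘ ((id ⊗₁ interchange) ∘ ((copy ⊗₁ (copy ⊗₁ copy)) ∘ α⇒))
      ≈⟨ ∘-respʳ (pullˡ (trans (sym ⊗-∘) (⊗-resp-≈ identityˡ (sym copy-⊗)))) ⟩
    interchange ∘ ((copy ⊗₁ copy) ∘ α⇒)
      ≈⟨ pullˡ (sym copy-⊗) ⟩
    copy ∘ α⇒ ∎)

  λ-deterministic : ∀ {A} → Deterministic (λ⇒ {A})
  λ-deterministic {A} = sym (begin
    (λ⇒ ⊗₁ λ⇒) ∘ copy
      ≈⟨ ∘-respʳ (trans copy-⊗ (∘-respʳ (⊗-resp-≈ copy-unit (sym identityʳ)))) ⟩
    (λ⇒ ⊗₁ λ⇒) ∘ (interchange ∘ (λ⇐ ⊗₁ (copy ∘ id)))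
      ≈⟨ ∘-respʳ (∘-respʳ (trans (⊗-respˡ (sym identityˡ)) ⊗-∘)) ⟩
    (λ⇒ ⊗₁ λ⇒) ∘ (interchange ∘ ((id ⊗₁ copy) ∘ (λ⇐ ⊗₁ id)))
      ≈⟨ sym assoc ⟩
    ((λ⇒ ⊗₁ λ⇒) ∘ interchange) ∘ ((id ⊗₁ copy) ∘ (λ⇐ ⊗₁ id))
      ≈⟨ ∘-respˡ λ-interchange ⟩
    (λ⇒ ∘ (λ⇒ ⊗₁ id)) ∘ ((id ⊗₁ copy) ∘ (λ⇐ ⊗₁ id))
      ≈⟨ pullʳ (trans (extendʳ (trans (sym ⊗-∘) (trans (⊗-resp-≈ (sym idsq) idsq) ⊗-∘)))
           (∘-respʳ (⊗-iso λ-isoʳ identityˡ))) ⟩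
    λ⇒ ∘ ((id ⊗₁ copy) ∘ id)
      ≈⟨ ∘-respʳ identityʳ ⟩
    λ⇒ ∘ (id ⊗₁ copy)
      ≈⟨ λ-natural ⟩
    copy ∘ λ⇒ ∎)
    where
    λ-α⇐ : ∀ {X Y} → (λ⇒ {X} ⊗₁ id {Y}) ∘ α⇐ ≈ λ⇒
    λ-α⇐ = trans (∘-respˡ (sym λ-⊗)) (cancelʳ α-isoʳ)

    λ-exchange : ∀ {X Y} → (id ⊗₁ λ⇒) ∘ exchange {unit} {X} {Y} ≈ λ⇒
    λ-exchange = begin
      (id ⊗₁ λ⇒) ∘ (α⇒ ∘ ((σ ⊗₁ id) ∘ α⇐))  ≈⟨ pullˡ triangle ⟩
      (ρ⇒ ⊗₁ id) ∘ ((σ ⊗₁ id) ∘ α⇐)         ≈⟨ pullˡ (trans (sym ⊗-id-∘) (⊗-respˡ ρ-σ)) ⟩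
      (λ⇒ ⊗₁ id) ∘ α⇐                       ≈⟨ λ-α⇐ ⟩
      λ⇒                                    ∎

    λ-interchange : ∀ {X Y} → (λ⇒ ⊗₁ λ⇒) ∘ interchange {unit} {unit} {X} {Y} ≈ λ⇒ ∘ (λ⇒ ⊗₁ id)
    λ-interchange = begin
      (λ⇒ ⊗₁ λ⇒) ∘ interchange
        ≈⟨ pushˡ (trans (⊗-resp-≈ (sym identityˡ) (sym identityʳ)) ⊗-∘) ⟩
      (id ⊗₁ λ⇒) ∘ ((λ⇒ ⊗₁ id) ∘ (α⇐ ∘ ((id ⊗₁ exchange) ∘ α⇒)))
        ≈⟨ ∘-respʳ (pullˡ λ-α⇐) ⟩
      (id ⊗₁ λ⇒) ∘ (λ⇒ ∘ ((id ⊗₁ exchange) ∘ α⇒))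
        ≈⟨ ∘-respʳ (extendʳ λ-natural) ⟩
      (id ⊗₁ λ⇒) ∘ (exchange ∘ (λ⇒ ∘ α⇒))
        ≈⟨ pullˡ λ-exchange ⟩
      λ⇒ ∘ (λ⇒ ∘ α⇒)
        ≈⟨ ∘-respʳ λ-⊗ ⟩
      λ⇒ ∘ (λ⇒ ⊗₁ id) ∎

module _ {o ℓ e o′ ℓ′ e′}
         (C : MarkovCategory o ℓ e) (D : MarkovCategory o′ ℓ′ e′) where
  private
    module C = MarkovCategory C
    module D = MarkovCategory D

  record MarkovFunctor : Set (o ⊔ ℓ ⊔ e ⊔ o′ ⊔ ℓ′ ⊔ e′) where
    field
      F₀ : C.Obj → D.Obj
      F₁ : ∀ {A B} → A C.⇒ B → F₀ A D.⇒ F₀ B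
      F-resp-≈ : ∀ {A B} {f g : A C.⇒ B} → f C.≈ g → F₁ f D.≈ F₁ g
      F-id     : ∀ {A} → F₁ (C.id {A}) D.≈ D.id
      F-∘      : ∀ {A B E} {f : A C.⇒ B} {g : B C.⇒ E} → F₁ (g C.∘ f) D.≈ F₁ g D.∘ F₁ f

      ε⇒ : D.unit D.⇒ F₀ C.unit
      ε⇐ : F₀ C.unit D.⇒ D.unit
      φ⇒ : ∀ A B → F₀ A D.⊗₀ F₀ B D.⇒ F₀ (A C.⊗₀ B)
      φ⇐ : ∀ A B → F₀ (A C.⊗₀ B) D.⇒ F₀ A D.⊗₀ F₀ B
      ε-isoˡ : ε⇐ D.∘ ε⇒ D.≈ D.id
      ε-isoʳ : ε⇒ D.∘ ε⇐ D.≈ D.id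
      φ-isoˡ : ∀ A B → φ⇐ A B D.∘ φ⇒ A B D.≈ D.id
      φ-isoʳ : ∀ A B → φ⇒ A B D.∘ φ⇐ A B D.≈ D.id
      φ-natural : ∀ {A B A′ B′} (f : A C.⇒ A′) (g : B C.⇒ B′) →
                  F₁ (f C.⊗₁ g) D.∘ φ⇒ A B D.≈ φ⇒ A′ B′ D.∘ (F₁ f D.⊗₁ F₁ g)
      φ-assoc   : ∀ A B E →
                  F₁ (C.α⇒ {A} {B} {E}) D.∘ (φ⇒ (A C.⊗₀ B) E D.∘ (φ⇒ A B D.⊗₁ D.id))
                    D.≈ φ⇒ A (B C.⊗₀ E) D.∘ ((D.id D.⊗₁ φ⇒ B E) D.∘ D.α⇒)
      φ-unitˡ   : ∀ A → F₁ (C.λ⇒ {A}) D.∘ (φ⇒ C.unit A D.∘ (ε⇒ D.⊗₁ D.id)) D.≈ D.λ⇒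
      φ-unitʳ   : ∀ A → F₁ (C.ρ⇒ {A}) D.∘ (φ⇒ A C.unit D.∘ (D.id D.⊗₁ ε⇒)) D.≈ D.ρ⇒
      φ-σ       : ∀ A B → F₁ (C.σ {A} {B}) D.∘ φ⇒ A B D.≈ φ⇒ B A D.∘ D.σ

      F-copy : ∀ A → F₁ (C.copy {A}) D.≈ φ⇒ A A D.∘ D.copy
      ε-deterministic : D.Deterministic ε⇒
      φ-deterministic : ∀ A B → D.Deterministic (φ⇒ A B)

module _ {o ℓ e o′ ℓ′ e′}
         {C : MarkovCategory o ℓ e} {D : MarkovCategory o′ ℓ′ e′} where
  private
    module C = MarkovCategory C
    module D = MarkovCategory D

  record Transformation (F G : MarkovFunctor C D) : Set (o ⊔ ℓ ⊔ ℓ′ ⊔ e′) where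
    private
      module F = MarkovFunctor F
      module G = MarkovFunctor G
    field
      η : ∀ A → F.F₀ A D.⇒ G.F₀ A
      natural       : ∀ {A B} (f : A C.⇒ B) → η B D.∘ F.F₁ f D.≈ G.F₁ f D.∘ η A
      monoidal      : ∀ A B → η (A C.⊗₀ B) D.∘ F.φ⇒ A B D.≈ G.φ⇒ A B D.∘ (η A D.⊗₁ η B)
      monoidal-unit : η C.unit D.∘ F.ε⇒ D.≈ G.ε⇒
      deterministic : ∀ A → D.Deterministic (η A)

  EpicTransformation : {F G : MarkovFunctor C D} → Transformation F G → Set (o ⊔ o′ ⊔ ℓ′ ⊔ e′)
  EpicTransformation τ = ∀ A → D.Epic (Transformation.η τ A)

  F-deterministic : (F : MarkovFunctor C D) → let open MarkovFunctor F in
                    ∀ {A B} {f : A C.⇒ B} → C.Deterministic f → D.Deterministic (F₁ f)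
  F-deterministic F {A} {B} {f} d = mono (φ-isoˡ B B) (begin
    φ⇒ B B D.∘ (D.copy D.∘ F₁ f)               ≈⟨ pullˡ (sym (F-copy B)) ⟩
    F₁ C.copy D.∘ F₁ f                         ≈⟨ F-∘ ⟨
    F₁ (C.copy C.∘ f)                          ≈⟨ F-resp-≈ d ⟩
    F₁ ((f C.⊗₁ f) C.∘ C.copy)                 ≈⟨ F-∘ ⟩
    F₁ (f C.⊗₁ f) D.∘ F₁ C.copy                ≈⟨ D.∘-resp-≈ refl (F-copy A) ⟩
    F₁ (f C.⊗₁ f) D.∘ (φ⇒ A A D.∘ D.copy)      ≈⟨ extendʳ (φ-natural f f) ⟩
    φ⇒ B B D.∘ ((F₁ f D.⊗₁ F₁ f) D.∘ D.copy)   ∎)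
    where
    open MarkovFunctor F
    open Reasoning D

module _ {o ℓ e o′ ℓ′ e′ o″ ℓ″ e″} {C : MarkovCategory o ℓ e}
         {D : MarkovCategory o′ ℓ′ e′} {E : MarkovCategory o″ ℓ″ e″} where

  infixr 9 _∘F_

  _∘F_ : MarkovFunctor D E → MarkovFunctor C D → MarkovFunctor C E
  G ∘F F = record
    { F₀ = λ A → G.F₀ (F.F₀ A)
    ; F₁ = λ f → G.F₁ (F.F₁ f)
    ; F-resp-≈ = λ p → G.F-resp-≈ (F.F-resp-≈ p)
    ; F-id = trans (G.F-resp-≈ F.F-id) G.F-id
    ; F-∘ = trans (G.F-resp-≈ F.F-∘) G.F-∘
    ; ε⇒ = G.F₁ F.ε⇒ ∘ G.ε⇒
    ; ε⇐ = G.ε⇐ ∘ G.F₁ F.ε⇐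
    ; φ⇒ = φ
    ; φ⇐ = λ A B → G.φ⇐ (F.F₀ A) (F.F₀ B) ∘ G.F₁ (F.φ⇐ A B)
    ; ε-isoˡ = ∘-iso G.ε-isoˡ (G-iso F.ε-isoˡ)
    ; ε-isoʳ = ∘-iso (G-iso F.ε-isoʳ) G.ε-isoʳ
    ; φ-isoˡ = λ A B → ∘-iso (G.φ-isoˡ _ _) (G-iso (F.φ-isoˡ A B))
    ; φ-isoʳ = λ A B → ∘-iso (G-iso (F.φ-isoʳ A B)) (G.φ-isoʳ _ _)
    ; φ-natural = λ f g →
        trans (pullˡ (G-square (F.φ-natural f g)))
          (trans (pullʳ (G.φ-natural (F.F₁ f) (F.F₁ g))) (sym assoc))
    ; φ-assoc = φ-assoc
    ; φ-unitˡ = λ A → begin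
        G.F₁ (F.F₁ C.λ⇒) ∘ (φ C.unit A ∘ ((G.F₁ F.ε⇒ ∘ G.ε⇒) ⊗₁ id))
          ≈⟨ ∘-respʳ (pullʳ (∘-respʳ (trans (⊗-respʳ (sym (trans (∘-respˡ G.F-id) identityˡ))) ⊗-∘))) ⟩
        G.F₁ (F.F₁ C.λ⇒) ∘ (G.F₁ (F.φ⇒ C.unit A) ∘ (G.φ⇒ _ _ ∘ ((G.F₁ F.ε⇒ ⊗₁ G.F₁ D.id) ∘ (G.ε⇒ ⊗₁ id))))
          ≈⟨ ∘-respʳ (∘-respʳ (extendʳ (sym (G.φ-natural F.ε⇒ D.id)))) ⟩
        G.F₁ (F.F₁ C.λ⇒) ∘ (G.F₁ (F.φ⇒ C.unit A) ∘ (G.F₁ (F.ε⇒ D.⊗₁ D.id) ∘ (G.φ⇒ _ _ ∘ (G.ε⇒ ⊗₁ id))))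
          ≈⟨ trans (∘-respʳ (pullˡ (sym G.F-∘))) (pullˡ (sym G.F-∘)) ⟩
        G.F₁ (F.F₁ C.λ⇒ D.∘ (F.φ⇒ C.unit A D.∘ (F.ε⇒ D.⊗₁ D.id))) ∘ (G.φ⇒ _ _ ∘ (G.ε⇒ ⊗₁ id))
          ≈⟨ ∘-respˡ (G.F-resp-≈ (F.φ-unitˡ A)) ⟩
        G.F₁ D.λ⇒ ∘ (G.φ⇒ _ _ ∘ (G.ε⇒ ⊗₁ id))
          ≈⟨ G.φ-unitˡ (F.F₀ A) ⟩
        λ⇒ ∎
    ; φ-unitʳ = λ A → begin
        G.F₁ (F.F₁ C.ρ⇒) ∘ (φ A C.unit ∘ (id ⊗₁ (G.F₁ F.ε⇒ ∘ G.ε⇒)))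
          ≈⟨ ∘-respʳ (pullʳ (∘-respʳ (trans (⊗-respˡ (sym (trans (∘-respˡ G.F-id) identityˡ))) ⊗-∘))) ⟩
        G.F₁ (F.F₁ C.ρ⇒) ∘ (G.F₁ (F.φ⇒ A C.unit) ∘ (G.φ⇒ _ _ ∘ ((G.F₁ D.id ⊗₁ G.F₁ F.ε⇒) ∘ (id ⊗₁ G.ε⇒))))
          ≈⟨ ∘-respʳ (∘-respʳ (extendʳ (sym (G.φ-natural D.id F.ε⇒)))) ⟩
        G.F₁ (F.F₁ C.ρ⇒) ∘ (G.F₁ (F.φ⇒ A C.unit) ∘ (G.F₁ (D.id D.⊗₁ F.ε⇒) ∘ (G.φ⇒ _ _ ∘ (id ⊗₁ G.ε⇒))))
          ≈⟨ trans (∘-respʳ (pullˡ (sym G.F-∘))) (pullˡ (sym G.F-∘)) ⟩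
        G.F₁ (F.F₁ C.ρ⇒ D.∘ (F.φ⇒ A C.unit D.∘ (D.id D.⊗₁ F.ε⇒))) ∘ (G.φ⇒ _ _ ∘ (id ⊗₁ G.ε⇒))
          ≈⟨ ∘-respˡ (G.F-resp-≈ (F.φ-unitʳ A)) ⟩
        G.F₁ D.ρ⇒ ∘ (G.φ⇒ _ _ ∘ (id ⊗₁ G.ε⇒))
          ≈⟨ G.φ-unitʳ (F.F₀ A) ⟩
        ρ⇒ ∎
    ; φ-σ = λ A B →
        trans (pullˡ (G-square (F.φ-σ A B)))
          (trans (pullʳ (G.φ-σ _ _)) (sym assoc))
    ; F-copy = λ A →
        trans (G.F-resp-≈ (F.F-copy A)) (trans G.F-∘ (trans (∘-respʳ (G.F-copy _)) (sym assoc)))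
    ; ε-deterministic = ∘-deterministic (F-deterministic G F.ε-deterministic) G.ε-deterministic
    ; φ-deterministic = λ A B →
        ∘-deterministic (F-deterministic G (F.φ-deterministic A B)) (G.φ-deterministic _ _)
    }
    where
    module C = MarkovCategory C
    module D = MarkovCategory D
    module F = MarkovFunctor F
    module G = MarkovFunctor G
    open MarkovCategory E
    open Reasoning E
    open Coherence E using (∘-deterministic)

    φ : ∀ A B → G.F₀ (F.F₀ A) ⊗₀ G.F₀ (F.F₀ B) ⇒ G.F₀ (F.F₀ (A C.⊗₀ B))
    φ A B = G.F₁ (F.φ⇒ A B) ∘ G.φ⇒ (F.F₀ A) (F.F₀ B)

    G-iso : ∀ {X Y} {f : X D.⇒ Y} {g : Y D.⇒ X} → f D.∘ g D.≈ D.id → G.F₁ f ∘ G.F₁ g ≈ id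
    G-iso p = trans (sym G.F-∘) (trans (G.F-resp-≈ p) G.F-id)

    G-square : ∀ {X Y Z W} {f : X D.⇒ Y} {g : Y D.⇒ W} {h : X D.⇒ Z} {k : Z D.⇒ W} →
               g D.∘ f D.≈ k D.∘ h → G.F₁ g ∘ G.F₁ f ≈ G.F₁ k ∘ G.F₁ h
    G-square p = trans (sym G.F-∘) (trans (G.F-resp-≈ p) G.F-∘)

    φ-assoc : ∀ A B X →
      G.F₁ (F.F₁ (C.α⇒ {A} {B} {X})) ∘ (φ (A C.⊗₀ B) X ∘ (φ A B ⊗₁ id))
        ≈ φ A (B C.⊗₀ X) ∘ ((id ⊗₁ φ B X) ∘ α⇒)
    φ-assoc A B X = begin
      G.F₁ (F.F₁ C.α⇒) ∘ (φ (A C.⊗₀ B) X ∘ (φ A B ⊗₁ id))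
        ≈⟨ ∘-respʳ (pullʳ (∘-respʳ (trans (⊗-respʳ (sym (trans (∘-respˡ G.F-id) identityˡ))) ⊗-∘))) ⟩
      G.F₁ (F.F₁ C.α⇒) ∘ (G.F₁ (F.φ⇒ _ X) ∘ (G.φ⇒ _ _ ∘ ((G.F₁ (F.φ⇒ A B) ⊗₁ G.F₁ D.id) ∘ (G.φ⇒ _ _ ⊗₁ id))))
        ≈⟨ ∘-respʳ (∘-respʳ (extendʳ (sym (G.φ-natural (F.φ⇒ A B) D.id)))) ⟩
      G.F₁ (F.F₁ C.α⇒) ∘ (G.F₁ (F.φ⇒ _ X) ∘ (G.F₁ (F.φ⇒ A B D.⊗₁ D.id) ∘ (G.φ⇒ _ _ ∘ (G.φ⇒ _ _ ⊗₁ id))))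
        ≈⟨ trans (∘-respʳ (pullˡ (sym G.F-∘))) (pullˡ (sym G.F-∘)) ⟩
      G.F₁ (F.F₁ C.α⇒ D.∘ (F.φ⇒ _ X D.∘ (F.φ⇒ A B D.⊗₁ D.id))) ∘ (G.φ⇒ _ _ ∘ (G.φ⇒ _ _ ⊗₁ id))
        ≈⟨ ∘-respˡ (G.F-resp-≈ (F.φ-assoc A B X)) ⟩
      G.F₁ (F.φ⇒ A _ D.∘ ((D.id D.⊗₁ F.φ⇒ B X) D.∘ D.α⇒)) ∘ (G.φ⇒ _ _ ∘ (G.φ⇒ _ _ ⊗₁ id))
        ≈⟨ trans (pushˡ G.F-∘) (∘-respʳ (pushˡ G.F-∘)) ⟩
      G.F₁ (F.φ⇒ A _) ∘ (G.F₁ (D.id D.⊗₁ F.φ⇒ B X) ∘ (G.F₁ D.α⇒ ∘ (G.φ⇒ _ _ ∘ (G.φ⇒ _ _ ⊗₁ id))))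
        ≈⟨ ∘-respʳ (∘-respʳ (G.φ-assoc _ _ _)) ⟩
      G.F₁ (F.φ⇒ A _) ∘ (G.F₁ (D.id D.⊗₁ F.φ⇒ B X) ∘ (G.φ⇒ _ _ ∘ ((id ⊗₁ G.φ⇒ _ _) ∘ α⇒)))
        ≈⟨ ∘-respʳ (extendʳ (G.φ-natural D.id (F.φ⇒ B X))) ⟩
      G.F₁ (F.φ⇒ A _) ∘ (G.φ⇒ _ _ ∘ ((G.F₁ D.id ⊗₁ G.F₁ (F.φ⇒ B X)) ∘ ((id ⊗₁ G.φ⇒ _ _) ∘ α⇒)))
        ≈⟨ ∘-respʳ (∘-respʳ (pullˡ (trans (sym ⊗-∘) (⊗-respˡ (trans (∘-respˡ G.F-id) identityˡ))))) ⟩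
      G.F₁ (F.φ⇒ A _) ∘ (G.φ⇒ _ _ ∘ ((id ⊗₁ φ B X) ∘ α⇒))
        ≈⟨ assoc ⟨
      φ A (B C.⊗₀ X) ∘ ((id ⊗₁ φ B X) ∘ α⇒) ∎

record Signature : Set₁ where
  field
    Type    : Set
    Query   : Set
    dom cod : Query → List Type

-- String diagrams over a signature are presented as terms modulo the laws of a
-- Markov category.  The monoidal structure on objects is concatenation of
-- lists and is strict: its associator and right unitor are the identity, which
-- appears as `cast` because the two sides are only propositionally equal.
module Diagrams (Q : Signature) where
  open Signature Q

  infixr 9 _∘_
  infixr 10 _⊗_
  infix 4 _≈_

  data Diagram : List Type → List Type → Set where
    gen     : (q : Query) → Diagram (dom q) (cod q)
    id      : ∀ {A} → Diagram A A
    _∘_     : ∀ {A B C} → Diagram B C → Diagram A B → Diagram A C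
    _⊗_     : ∀ {A B C D} → Diagram A B → Diagram C D → Diagram (A ++ C) (B ++ D)
    σ       : ∀ A B → Diagram (A ++ B) (B ++ A)
    copy    : ∀ A → Diagram A (A ++ A)
    discard : ∀ A → Diagram A []

  cast : ∀ {A B} → A ≡ B → Diagram A B
  cast ≡.refl = id

  α⇒ : ∀ A B C → Diagram ((A ++ B) ++ C) (A ++ (B ++ C))
  α⇒ A B C = cast (++-assoc A B C)

  α⇐ : ∀ A B C → Diagram (A ++ (B ++ C)) ((A ++ B) ++ C)
  α⇐ A B C = cast (≡.sym (++-assoc A B C))

  ρ⇒ : ∀ A → Diagram (A ++ []) A
  ρ⇒ A = cast (++-identityʳ A)

  ρ⇐ : ∀ A → Diagram A (A ++ [])
  ρ⇐ A = cast (≡.sym (++-identityʳ A))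

  exchange : ∀ A B C → Diagram (A ++ (B ++ C)) (B ++ (A ++ C))
  exchange A B C = α⇒ B A C ∘ ((σ A B ⊗ id {C}) ∘ α⇐ A B C)

  interchange : ∀ A A′ B B′ → Diagram ((A ++ A′) ++ (B ++ B′)) ((A ++ B) ++ (A′ ++ B′))
  interchange A A′ B B′ =
    α⇐ A B (A′ ++ B′) ∘ ((id {A} ⊗ exchange A′ B B′) ∘ α⇒ A A′ (B ++ B′))

  data _≈_ : ∀ {A B} → Diagram A B → Diagram A B → Set where
    refl  : ∀ {A B} {f : Diagram A B} → f ≈ f
    sym   : ∀ {A B} {f g : Diagram A B} → f ≈ g → g ≈ f
    trans : ∀ {A B} {f g h : Diagram A B} → f ≈ g → g ≈ h → f ≈ h
    ∘-resp-≈ : ∀ {A B C} {f h : Diagram B C} {g k : Diagram A B} →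
               f ≈ h → g ≈ k → f ∘ g ≈ h ∘ k
    ⊗-resp-≈ : ∀ {A B C D} {f h : Diagram A B} {g k : Diagram C D} →
               f ≈ h → g ≈ k → f ⊗ g ≈ h ⊗ k
    identityˡ : ∀ {A B} {f : Diagram A B} → id ∘ f ≈ f
    identityʳ : ∀ {A B} {f : Diagram A B} → f ∘ id ≈ f
    assoc     : ∀ {A B C D} {f : Diagram A B} {g : Diagram B C} {h : Diagram C D} →
                (h ∘ g) ∘ f ≈ h ∘ (g ∘ f)
    ⊗-id      : ∀ {A B} → id {A} ⊗ id {B} ≈ id
    ⊗-∘       : ∀ {A B C A′ B′ C′} {f : Diagram A B} {g : Diagram B C}
                  {f′ : Diagram A′ B′} {g′ : Diagram B′ C′} →
                (g ∘ f) ⊗ (g′ ∘ f′) ≈ (g ⊗ g′) ∘ (f ⊗ f′)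
    ⊗-assoc   : ∀ {A B C A′ B′ C′} {f : Diagram A A′} {g : Diagram B B′} {h : Diagram C C′} →
                α⇒ A′ B′ C′ ∘ ((f ⊗ g) ⊗ h) ≈ (f ⊗ (g ⊗ h)) ∘ α⇒ A B C
    ⊗-unitˡ   : ∀ {A B} {f : Diagram A B} → id {[]} ⊗ f ≈ f
    ⊗-unitʳ   : ∀ {A B} {f : Diagram A B} → ρ⇒ B ∘ (f ⊗ id {[]}) ≈ f ∘ ρ⇒ A
    σ-natural    : ∀ {A B A′ B′} {f : Diagram A A′} {g : Diagram B B′} →
                   σ A′ B′ ∘ (f ⊗ g) ≈ (g ⊗ f) ∘ σ A B
    σ-involutive : ∀ A B → σ B A ∘ σ A B ≈ id
    hexagon      : ∀ A B C →
                   α⇒ B C A ∘ (σ A (B ++ C) ∘ α⇒ A B C)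
                     ≈ (id {B} ⊗ σ A C) ∘ (α⇒ B A C ∘ (σ A B ⊗ id {C}))
    discard-unique   : ∀ {A} (f : Diagram A []) → f ≈ discard A
    copy-assoc       : ∀ A → α⇒ A A A ∘ ((copy A ⊗ id {A}) ∘ copy A) ≈ (id {A} ⊗ copy A) ∘ copy A
    copy-unitˡ       : ∀ A → (discard A ⊗ id {A}) ∘ copy A ≈ id
    copy-commutative : ∀ A → σ A A ∘ copy A ≈ copy A
    copy-⊗           : ∀ A B → copy (A ++ B) ≈ interchange A A B B ∘ (copy A ⊗ copy B)

  cast-∘ : ∀ {A B C} (p : A ≡ B) (q : B ≡ C) → cast q ∘ cast p ≈ cast (≡.trans p q)
  cast-∘ ≡.refl q = identityʳ

  cast-unique : ∀ {A B} (p q : A ≡ B) → cast p ≈ cast q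
  cast-unique p q with uip p q
  ... | ≡.refl = refl

  cast-loop : ∀ {A} (p : A ≡ A) → cast p ≈ id
  cast-loop p = cast-unique p ≡.refl

  cast-isoˡ : ∀ {A B} (p : A ≡ B) → cast (≡.sym p) ∘ cast p ≈ id
  cast-isoˡ p = trans (cast-∘ p (≡.sym p)) (cast-loop _)

  cast-isoʳ : ∀ {A B} (p : A ≡ B) → cast p ∘ cast (≡.sym p) ≈ id
  cast-isoʳ p = trans (cast-∘ (≡.sym p) p) (cast-loop _)

  id⊗cast : ∀ A {B C} (p : B ≡ C) → id {A} ⊗ cast p ≈ cast (≡.cong (A ++_) p)
  id⊗cast A ≡.refl = ⊗-id

  cast⊗id : ∀ {A B} (p : A ≡ B) C → cast p ⊗ id {C} ≈ cast (≡.cong (_++ C) p)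
  cast⊗id ≡.refl C = ⊗-id

  permute : ∀ {A B} → A ↭ B → Diagram A B
  permute _↭_.refl         = id
  permute (_↭_.prep x p)   = id {x ∷ []} ⊗ permute p
  permute (_↭_.swap x y p) = σ (x ∷ []) (y ∷ []) ⊗ permute p
  permute (_↭_.trans p q)  = permute q ∘ permute p

  permute-isoʳ : ∀ {A B} (p : A ↭ B) → permute p ∘ permute (↭-sym p) ≈ id
  permute-isoʳ _↭_.refl         = identityˡ
  permute-isoʳ (_↭_.prep x p)   =
    trans (sym ⊗-∘) (trans (⊗-resp-≈ identityˡ (permute-isoʳ p)) ⊗-id)
  permute-isoʳ (_↭_.swap x y p) =
    trans (sym ⊗-∘) (trans (⊗-resp-≈ (σ-involutive _ _) (permute-isoʳ p)) ⊗-id)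
  permute-isoʳ (_↭_.trans p q)  =
    trans assoc (trans (∘-resp-≈ refl (trans (sym assoc)
      (trans (∘-resp-≈ (permute-isoʳ p) refl) identityˡ))) (permute-isoʳ q))

  triangle : ∀ A B → (id {A} ⊗ id {B}) ∘ α⇒ A [] B ≈ ρ⇒ A ⊗ id {B}
  triangle A B =
    trans (∘-resp-≈ ⊗-id refl) (trans identityˡ (trans (cast-unique _ _) (sym (cast⊗id _ B))))

  pentagon : ∀ A B C D →
    (id {A} ⊗ α⇒ B C D) ∘ (α⇒ A (B ++ C) D ∘ (α⇒ A B C ⊗ id {D}))
      ≈ α⇒ A B (C ++ D) ∘ α⇒ (A ++ B) C D
  pentagon A B C D =
    trans (∘-resp-≈ (id⊗cast A _) (trans (∘-resp-≈ refl (cast⊗id _ D)) (cast-∘ _ _)))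
      (trans (cast-∘ _ _) (trans (cast-unique _ _) (sym (cast-∘ _ _))))

  Free : MarkovCategory 0ℓ 0ℓ 0ℓ
  Free = record
    { Obj = List Type
    ; _⇒_ = Diagram
    ; _≈_ = _≈_
    ; id = id
    ; _∘_ = _∘_
    ; equiv = record { refl = refl ; sym = sym ; trans = trans }
    ; ∘-resp-≈ = ∘-resp-≈
    ; identityˡ = identityˡ
    ; identityʳ = identityʳ
    ; assoc = assoc
    ; unit = []
    ; _⊗₀_ = _++_
    ; _⊗₁_ = _⊗_
    ; ⊗-resp-≈ = ⊗-resp-≈
    ; ⊗-id = λ {A} {B} → ⊗-id {A} {B}
    ; ⊗-∘ = ⊗-∘
    ; α⇒ = λ {A} {B} {C} → α⇒ A B C
    ; α⇐ = λ {A} {B} {C} → α⇐ A B C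
    ; λ⇒ = id
    ; λ⇐ = id
    ; ρ⇒ = λ {A} → ρ⇒ A
    ; ρ⇐ = λ {A} → ρ⇐ A
    ; α-isoˡ = λ {A} {B} {C} → cast-isoˡ (++-assoc A B C)
    ; α-isoʳ = λ {A} {B} {C} → cast-isoʳ (++-assoc A B C)
    ; λ-isoˡ = identityˡ
    ; λ-isoʳ = identityˡ
    ; ρ-isoˡ = λ {A} → cast-isoˡ (++-identityʳ A)
    ; ρ-isoʳ = λ {A} → cast-isoʳ (++-identityʳ A)
    ; α-natural = ⊗-assoc
    ; λ-natural = trans identityˡ (trans ⊗-unitˡ (sym identityʳ))
    ; ρ-natural = ⊗-unitʳ
    ; triangle = λ {A} {B} → triangle A B
    ; pentagon = λ {A} {B} {C} {D} → pentagon A B C D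
    ; σ = λ {A} {B} → σ A B
    ; σ-natural = σ-natural
    ; σ-involutive = λ {A} {B} → σ-involutive A B
    ; hexagon = λ {A} {B} {C} → hexagon A B C
    ; copy = λ {A} → copy A
    ; discard = λ {A} → discard A
    ; discard-unique = discard-unique
    ; copy-assoc = λ {A} → copy-assoc A
    ; copy-unitˡ = λ {A} → trans identityˡ (copy-unitˡ A)
    ; copy-commutative = λ {A} → copy-commutative A
    ; copy-⊗ = λ {A} {B} → copy-⊗ A B
    }

open Diagrams using (Free)

module Tensor {o ℓ e} (C : MarkovCategory o ℓ e) {T : Set}
              (obj : T → MarkovCategory.Obj C) where
  open MarkovCategory C

  ⨂ : List T → Obj
  ⨂ []      = unit
  ⨂ (x ∷ A) = obj x ⊗₀ ⨂ A

  permute : ∀ {A B} → A ↭ B → ⨂ A ⇒ ⨂ B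
  permute _↭_.refl         = id
  permute (_↭_.prep x p)   = id ⊗₁ permute p
  permute (_↭_.swap x y p) = (id ⊗₁ (id ⊗₁ permute p)) ∘ exchange
  permute (_↭_.trans p q)  = permute q ∘ permute p

  project : ∀ {A x} → x ∈ₗ A → ⨂ A ⇒ obj x
  project (here ≡.refl) = ρ⇒ ∘ (id ⊗₁ discard)
  project (there i)     = λ⇒ ∘ (discard ⊗₁ project i)

  -- Copies and discards the wires A so as to supply the wires B.
  select : ∀ {A} B → B ⊆ₗ A → ⨂ A ⇒ ⨂ B
  select []      B⊆A = discard
  select (x ∷ B) B⊆A = (project (B⊆A (here ≡.refl)) ⊗₁ select B (B⊆A ∘′ there)) ∘ copy

  ⨂-++⇒ : ∀ A B → ⨂ A ⊗₀ ⨂ B ⇒ ⨂ (A ++ B)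
  ⨂-++⇒ []      B = λ⇒
  ⨂-++⇒ (x ∷ A) B = (id ⊗₁ ⨂-++⇒ A B) ∘ α⇒

  ⨂-++⇐ : ∀ A B → ⨂ (A ++ B) ⇒ ⨂ A ⊗₀ ⨂ B
  ⨂-++⇐ []      B = λ⇐
  ⨂-++⇐ (x ∷ A) B = α⇐ ∘ (id ⊗₁ ⨂-++⇐ A B)


module Interpretation {o ℓ e} (Q : Signature) (C : MarkovCategory o ℓ e)
    (obj : Signature.Type Q → MarkovCategory.Obj C)
    (channel : (q : Signature.Query Q) → MarkovCategory._⇒_ C
                 (Tensor.⨂ C obj (Signature.dom Q q)) (Tensor.⨂ C obj (Signature.cod Q q))) where
  private
    module D = Diagrams Q
  open D using (Diagram; cast)
  open Signature Q
  open MarkovCategory C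
  open Tensor C obj public
  open Reasoning C
  open Coherence C

  ⟦_⟧ : ∀ {A B} → Diagram A B → ⨂ A ⇒ ⨂ B
  ⟦ D.gen q ⟧                        = channel q
  ⟦ D.id ⟧                           = id
  ⟦ g D.∘ f ⟧                        = ⟦ g ⟧ ∘ ⟦ f ⟧
  ⟦ D._⊗_ {A} {B} {A′} {B′} f g ⟧    = ⨂-++⇒ B B′ ∘ ((⟦ f ⟧ ⊗₁ ⟦ g ⟧) ∘ ⨂-++⇐ A A′)
  ⟦ D.σ A B ⟧                        = ⨂-++⇒ B A ∘ (σ ∘ ⨂-++⇐ A B)
  ⟦ D.copy A ⟧                       = ⨂-++⇒ A A ∘ copy
  ⟦ D.discard A ⟧                    = discard

  private
    φ : ∀ A B → ⨂ A ⊗₀ ⨂ B ⇒ ⨂ (A ++ B)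
    φ = ⨂-++⇒

    φ⇐ : ∀ A B → ⨂ (A ++ B) ⇒ ⨂ A ⊗₀ ⨂ B
    φ⇐ = ⨂-++⇐

    φ-isoˡ : ∀ A B → φ⇐ A B ∘ φ A B ≈ id
    φ-isoˡ []      B = λ-isoˡ
    φ-isoˡ (x ∷ A) B = ∘-iso α-isoˡ (⊗-iso identityˡ (φ-isoˡ A B))

    φ-isoʳ : ∀ A B → φ A B ∘ φ⇐ A B ≈ id
    φ-isoʳ []      B = λ-isoʳ
    φ-isoʳ (x ∷ A) B = ∘-iso (⊗-iso identityˡ (φ-isoʳ A B)) α-isoʳ

    φ-det : ∀ A B → Deterministic (φ A B)
    φ-det []      B = λ-deterministic
    φ-det (x ∷ A) B =
      ∘-deterministic (⊗-deterministic id-deterministic (φ-det A B)) α-deterministic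

    ⟦cast-∷⟧ : ∀ x {A B} (p : A ≡ B) → ⟦ cast (≡.cong (x ∷_) p) ⟧ ≈ id ⊗₁ ⟦ cast p ⟧
    ⟦cast-∷⟧ x ≡.refl = sym ⊗-id

    φ-assoc : ∀ A B E →
      ⟦ D.α⇒ A B E ⟧ ∘ (φ (A ++ B) E ∘ (φ A B ⊗₁ id)) ≈ φ A (B ++ E) ∘ ((id ⊗₁ φ B E) ∘ α⇒)
    φ-assoc [] B E = begin
      id ∘ (φ B E ∘ (λ⇒ ⊗₁ id))          ≈⟨ identityˡ ⟩
      φ B E ∘ (λ⇒ ⊗₁ id)                 ≈⟨ ∘-respʳ λ-⊗ ⟨
      φ B E ∘ (λ⇒ ∘ α⇒)                  ≈⟨ extendʳ λ-natural ⟨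
      λ⇒ ∘ ((id ⊗₁ φ B E) ∘ α⇒)          ∎
    φ-assoc (x ∷ A) B E = begin
      ⟦ cast (≡.cong (x ∷_) (++-assoc A B E)) ⟧ ∘
        (((id ⊗₁ φ (A ++ B) E) ∘ α⇒) ∘ (((id ⊗₁ φ A B) ∘ α⇒) ⊗₁ id))
        ≈⟨ ∘-resp-≈ (⟦cast-∷⟧ x (++-assoc A B E)) (pullʳ (∘-respʳ ⊗-id-∘)) ⟩
      (id ⊗₁ ⟦ D.α⇒ A B E ⟧) ∘
        ((id ⊗₁ φ (A ++ B) E) ∘ (α⇒ ∘ (((id ⊗₁ φ A B) ⊗₁ id) ∘ (α⇒ ⊗₁ id))))
        ≈⟨ ∘-respʳ (∘-respʳ (extendʳ α-natural)) ⟩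
      (id ⊗₁ ⟦ D.α⇒ A B E ⟧) ∘
        ((id ⊗₁ φ (A ++ B) E) ∘ ((id ⊗₁ (φ A B ⊗₁ id)) ∘ (α⇒ ∘ (α⇒ ⊗₁ id))))
        ≈⟨ trans (∘-respʳ (pullˡ (sym id-⊗-∘))) (pullˡ (sym id-⊗-∘)) ⟩
      (id ⊗₁ (⟦ D.α⇒ A B E ⟧ ∘ (φ (A ++ B) E ∘ (φ A B ⊗₁ id)))) ∘ (α⇒ ∘ (α⇒ ⊗₁ id))
        ≈⟨ ∘-respˡ (⊗-respʳ (φ-assoc A B E)) ⟩
      (id ⊗₁ (φ A (B ++ E) ∘ ((id ⊗₁ φ B E) ∘ α⇒))) ∘ (α⇒ ∘ (α⇒ ⊗₁ id))
        ≈⟨ trans (pushˡ id-⊗-∘) (∘-respʳ (pushˡ id-⊗-∘)) ⟩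
      (id ⊗₁ φ A (B ++ E)) ∘ ((id ⊗₁ (id ⊗₁ φ B E)) ∘ ((id ⊗₁ α⇒) ∘ (α⇒ ∘ (α⇒ ⊗₁ id))))
        ≈⟨ ∘-respʳ (∘-respʳ pentagon) ⟩
      (id ⊗₁ φ A (B ++ E)) ∘ ((id ⊗₁ (id ⊗₁ φ B E)) ∘ (α⇒ ∘ α⇒))
        ≈⟨ ∘-respʳ (extendʳ α-naturalᵘ) ⟨
      (id ⊗₁ φ A (B ++ E)) ∘ (α⇒ ∘ ((id ⊗₁ φ B E) ∘ α⇒))
        ≈⟨ assoc ⟨
      ((id ⊗₁ φ A (B ++ E)) ∘ α⇒) ∘ ((id ⊗₁ φ B E) ∘ α⇒) ∎

    φ-unitʳ : ∀ A → ⟦ D.ρ⇒ A ⟧ ∘ φ A [] ≈ ρ⇒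
    φ-unitʳ []      = trans identityˡ λ-unit≈ρ-unit
    φ-unitʳ (x ∷ A) = begin
      ⟦ cast (≡.cong (x ∷_) (++-identityʳ A)) ⟧ ∘ ((id ⊗₁ φ A []) ∘ α⇒)
        ≈⟨ ∘-respˡ (⟦cast-∷⟧ x (++-identityʳ A)) ⟩
      (id ⊗₁ ⟦ D.ρ⇒ A ⟧) ∘ ((id ⊗₁ φ A []) ∘ α⇒)
        ≈⟨ pullˡ (trans (sym id-⊗-∘) (⊗-respʳ (φ-unitʳ A))) ⟩
      (id ⊗₁ ρ⇒) ∘ α⇒
        ≈⟨ ρ-⊗ ⟨
      ρ⇒ ∎

    φ-natural : ∀ {A B A′ B′} (f : Diagram A A′) (g : Diagram B B′) →
                ⟦ f D.⊗ g ⟧ ∘ φ A B ≈ φ A′ B′ ∘ (⟦ f ⟧ ⊗₁ ⟦ g ⟧)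
    φ-natural {A} {B} f g = pullʳ (cancelʳ (φ-isoˡ A B))

    φ-σ : ∀ A B → ⟦ D.σ A B ⟧ ∘ φ A B ≈ φ B A ∘ σ
    φ-σ A B = pullʳ (cancelʳ (φ-isoˡ A B))

    ⟦cast⟧-isoˡ : ∀ {A B} (p : A ≡ B) → ⟦ cast (≡.sym p) ⟧ ∘ ⟦ cast p ⟧ ≈ id
    ⟦cast⟧-isoˡ ≡.refl = identityˡ

    -- A bracketing of a list into consecutive pieces, whose tensor is X.
    infixr 10 _⊠_
    data Presentation : Obj → List Type → Set o where
      I   : ∀ {A} → Presentation (⨂ A) A
      _⊠_ : ∀ {X Y A B} → Presentation X A → Presentation Y B → Presentation (X ⊗₀ Y) (A ++ B)

    to : ∀ {X A} → Presentation X A → X ⇒ ⨂ A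
    to I                   = id
    to (_⊠_ {A = A} {B} Φ Ψ) = φ A B ∘ (to Φ ⊗₁ to Ψ)

    from : ∀ {X A} → Presentation X A → ⨂ A ⇒ X
    from I                   = id
    from (_⊠_ {A = A} {B} Φ Ψ) = (from Φ ⊗₁ from Ψ) ∘ φ⇐ A B

    to-from : ∀ {X A} (Φ : Presentation X A) → to Φ ∘ from Φ ≈ id
    to-from I                   = identityˡ
    to-from (_⊠_ {A = A} {B} Φ Ψ) = ∘-iso (φ-isoʳ A B) (⊗-iso (to-from Φ) (to-from Ψ))

    to-det : ∀ {X A} (Φ : Presentation X A) → Deterministic (to Φ)
    to-det I                   = id-deterministic
    to-det (_⊠_ {A = A} {B} Φ Ψ) =
      ∘-deterministic (φ-det A B) (⊗-deterministic (to-det Φ) (to-det Ψ))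

    record Square {A B X Y} (Φ : Presentation X A) (Ψ : Presentation Y B)
                  (f : Diagram A B) (f′ : X ⇒ Y) : Set e where
      no-eta-equality
      constructor square
      field commutes : ⟦ f ⟧ ∘ to Φ ≈ to Ψ ∘ f′
    open Square

    □-∘ : ∀ {A B E X Y Z} {Φ : Presentation X A} {Ψ : Presentation Y B} {Χ : Presentation Z E}
            {f : Diagram A B} {g : Diagram B E} {f′ : X ⇒ Y} {g′ : Y ⇒ Z} →
          Square Ψ Χ g g′ → Square Φ Ψ f f′ → Square Φ Χ (g D.∘ f) (g′ ∘ f′)
    □-∘ p q = square (glue (commutes p) (commutes q))

    □-id : ∀ {A X} (Φ : Presentation X A) → Square Φ Φ D.id id
    □-id Φ = square idsq

    □-I : ∀ {A B} (f : Diagram A B) → Square I I f ⟦ f ⟧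
    □-I f = square (sym idsq)

    □-⊗ : ∀ {A B A′ B′ X Y X′ Y′} {f : Diagram A A′} {g : Diagram B B′}
            {Φ : Presentation X A} {Ψ : Presentation Y B}
            {Φ′ : Presentation X′ A′} {Ψ′ : Presentation Y′ B′} {f′ : X ⇒ X′} {g′ : Y ⇒ Y′} →
          Square Φ Φ′ f f′ → Square Ψ Ψ′ g g′ → Square (Φ ⊠ Ψ) (Φ′ ⊠ Ψ′) (f D.⊗ g) (f′ ⊗₁ g′)
    □-⊗ {f = f} {g} p q = square
      (trans (extendʳ (φ-natural f g))
        (trans (∘-respʳ (glue-⊗ (commutes p) (commutes q))) (sym assoc)))

    □-α : ∀ {A B E X Y Z} (Φ : Presentation X A) (Ψ : Presentation Y B) (Χ : Presentation Z E) →
          Square ((Φ ⊠ Ψ) ⊠ Χ) (Φ ⊠ (Ψ ⊠ Χ)) (D.α⇒ A B E) α⇒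
    □-α {A} {B} {E} Φ Ψ Χ = square (begin
      ⟦ D.α⇒ A B E ⟧ ∘ (φ (A ++ B) E ∘ ((φ A B ∘ (to Φ ⊗₁ to Ψ)) ⊗₁ to Χ))
        ≈⟨ ∘-respʳ (∘-respʳ (trans (⊗-respʳ (sym identityˡ)) ⊗-∘)) ⟩
      ⟦ D.α⇒ A B E ⟧ ∘ (φ (A ++ B) E ∘ ((φ A B ⊗₁ id) ∘ ((to Φ ⊗₁ to Ψ) ⊗₁ to Χ)))
        ≈⟨ trans (∘-respʳ (sym assoc)) (pullˡ (φ-assoc A B E)) ⟩
      (φ A (B ++ E) ∘ ((id ⊗₁ φ B E) ∘ α⇒)) ∘ ((to Φ ⊗₁ to Ψ) ⊗₁ to Χ)
        ≈⟨ pullʳ (pullʳ α-natural) ⟩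
      φ A (B ++ E) ∘ ((id ⊗₁ φ B E) ∘ ((to Φ ⊗₁ (to Ψ ⊗₁ to Χ)) ∘ α⇒))
        ≈⟨ ∘-respʳ (pullˡ (trans (sym ⊗-∘) (⊗-respˡ identityˡ))) ⟩
      φ A (B ++ E) ∘ ((to Φ ⊗₁ to (Ψ ⊠ Χ)) ∘ α⇒)
        ≈⟨ assoc ⟨
      to (Φ ⊠ (Ψ ⊠ Χ)) ∘ α⇒ ∎)

    □-α⇐ : ∀ {A B E X Y Z} (Φ : Presentation X A) (Ψ : Presentation Y B) (Χ : Presentation Z E) →
           Square (Φ ⊠ (Ψ ⊠ Χ)) ((Φ ⊠ Ψ) ⊠ Χ) (D.α⇐ A B E) α⇐
    □-α⇐ {A} {B} {E} Φ Ψ Χ = square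
      (sym (flip-square α-isoʳ (⟦cast⟧-isoˡ (++-assoc A B E))
        (sym (commutes (□-α Φ Ψ Χ)))))

    □-ρ : ∀ {A X} (Φ : Presentation X A) → Square (Φ ⊠ I {[]}) Φ (D.ρ⇒ A) ρ⇒
    □-ρ {A} Φ = square (trans (pullˡ (φ-unitʳ A)) ρ-natural)

    □-σ : ∀ {A B X Y} (Φ : Presentation X A) (Ψ : Presentation Y B) →
          Square (Φ ⊠ Ψ) (Ψ ⊠ Φ) (D.σ A B) σ
    □-σ {A} {B} Φ Ψ = square (trans (extendʳ (φ-σ A B)) (trans (∘-respʳ σ-natural) (sym assoc)))

    □-copy : ∀ {A X} (Φ : Presentation X A) → Square Φ (Φ ⊠ Φ) (D.copy A) copy
    □-copy Φ = square (trans (pullʳ (to-det Φ)) (sym assoc))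

    □-exchange : ∀ {A B E X Y Z} (Φ : Presentation X A) (Ψ : Presentation Y B) (Χ : Presentation Z E) →
                 Square (Φ ⊠ (Ψ ⊠ Χ)) (Ψ ⊠ (Φ ⊠ Χ)) (D.exchange A B E) exchange
    □-exchange Φ Ψ Χ =
      □-∘ (□-α Ψ Φ Χ) (□-∘ (□-⊗ (□-σ Φ Ψ) (□-id Χ)) (□-α⇐ Φ Ψ Χ))

    □-interchange : ∀ {A A′ B B′ X X′ Y Y′} (Φ : Presentation X A) (Φ′ : Presentation X′ A′)
                      (Ψ : Presentation Y B) (Ψ′ : Presentation Y′ B′) →
                    Square ((Φ ⊠ Φ′) ⊠ (Ψ ⊠ Ψ′)) ((Φ ⊠ Ψ) ⊠ (Φ′ ⊠ Ψ′))
                           (D.interchange A A′ B B′) interchange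
    □-interchange Φ Φ′ Ψ Ψ′ =
      □-∘ (□-α⇐ Φ Ψ (Φ′ ⊠ Ψ′))
        (□-∘ (□-⊗ (□-id Φ) (□-exchange Φ′ Ψ Ψ′)) (□-α Φ Φ′ (Ψ ⊠ Ψ′)))

    compare : ∀ {A B X Y} {f g : Diagram A B} (Φ : Presentation X A) (Ψ : Presentation Y B)
                {f′ g′ : X ⇒ Y} →
              Square Φ Ψ f f′ → f′ ≈ g′ → Square Φ Ψ g g′ → ⟦ f ⟧ ≈ ⟦ g ⟧
    compare Φ Ψ p q r =
      epi (to-from Φ) (trans (commutes p) (trans (∘-respʳ q) (sym (commutes r))))

  ⟦⟧-resp-≈ : ∀ {A B} {f g : Diagram A B} → f D.≈ g → ⟦ f ⟧ ≈ ⟦ g ⟧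
  ⟦⟧-resp-≈ D.refl           = refl
  ⟦⟧-resp-≈ (D.sym p)        = sym (⟦⟧-resp-≈ p)
  ⟦⟧-resp-≈ (D.trans p q)    = trans (⟦⟧-resp-≈ p) (⟦⟧-resp-≈ q)
  ⟦⟧-resp-≈ (D.∘-resp-≈ p q) = ∘-resp-≈ (⟦⟧-resp-≈ p) (⟦⟧-resp-≈ q)
  ⟦⟧-resp-≈ (D.⊗-resp-≈ p q) = ∘-respʳ (∘-respˡ (⊗-resp-≈ (⟦⟧-resp-≈ p) (⟦⟧-resp-≈ q)))
  ⟦⟧-resp-≈ D.identityˡ      = identityˡ
  ⟦⟧-resp-≈ D.identityʳ      = identityʳ
  ⟦⟧-resp-≈ D.assoc          = assoc
  ⟦⟧-resp-≈ (D.⊗-id {A} {B}) = trans (∘-respʳ (trans (∘-respˡ ⊗-id) identityˡ)) (φ-isoʳ A B)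
  ⟦⟧-resp-≈ (D.⊗-∘ {f = f} {g} {f′} {g′}) =
    compare (I ⊠ I) (I ⊠ I)
      (□-⊗ (□-∘ (□-I g) (□-I f)) (□-∘ (□-I g′) (□-I f′)))
      ⊗-∘
      (□-∘ (□-⊗ (□-I g) (□-I g′)) (□-⊗ (□-I f) (□-I f′)))
  ⟦⟧-resp-≈ (D.⊗-assoc {f = f} {g} {h}) =
    compare ((I ⊠ I) ⊠ I) (I ⊠ (I ⊠ I))
      (□-∘ (□-α I I I) (□-⊗ (□-⊗ (□-I f) (□-I g)) (□-I h)))
      α-natural
      (□-∘ (□-⊗ (□-I f) (□-⊗ (□-I g) (□-I h))) (□-α I I I))
  ⟦⟧-resp-≈ (D.⊗-unitˡ {A} {B} {f}) =
    epi (φ-isoʳ [] A) (trans (φ-natural (D.id {[]}) f) λ-natural)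
  ⟦⟧-resp-≈ (D.⊗-unitʳ {f = f}) =
    compare (I ⊠ I) I (□-∘ (□-ρ I) (□-⊗ (□-I f) (□-id I))) ρ-natural (□-∘ (□-I f) (□-ρ I))
  ⟦⟧-resp-≈ (D.σ-natural {f = f} {g}) =
    compare (I ⊠ I) (I ⊠ I)
      (□-∘ (□-σ I I) (□-⊗ (□-I f) (□-I g))) σ-natural (□-∘ (□-⊗ (□-I g) (□-I f)) (□-σ I I))
  ⟦⟧-resp-≈ (D.σ-involutive A B) =
    compare (I {A} ⊠ I {B}) (I {A} ⊠ I {B})
      (□-∘ (□-σ I I) (□-σ I I)) σ-involutive (□-id (I ⊠ I))
  ⟦⟧-resp-≈ (D.hexagon A B E) =
    compare ((I {A} ⊠ I {B}) ⊠ I {E}) (I {B} ⊠ (I {E} ⊠ I {A}))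
      (□-∘ (□-α I I I) (□-∘ (□-σ I (I ⊠ I)) (□-α I I I)))
      hexagon
      (□-∘ (□-⊗ (□-id I) (□-σ I I)) (□-∘ (□-α I I I) (□-⊗ (□-σ I I) (□-id I))))
  ⟦⟧-resp-≈ (D.discard-unique f) = discard-unique ⟦ f ⟧
  ⟦⟧-resp-≈ (D.copy-assoc A) =
    compare (I {A}) (I {A} ⊠ (I {A} ⊠ I {A}))
      (□-∘ (□-α I I I) (□-∘ (□-⊗ (□-copy I) (□-id I)) (□-copy I)))
      copy-assoc
      (□-∘ (□-⊗ (□-id I) (□-copy I)) (□-copy I))
  ⟦⟧-resp-≈ (D.copy-unitˡ A) =
    trans (pullʳ (trans assoc (∘-respʳ (cancelˡ (φ-isoˡ A A))))) copy-unitˡ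
  ⟦⟧-resp-≈ (D.copy-commutative A) =
    compare (I {A}) (I {A} ⊠ I {A}) (□-∘ (□-σ I I) (□-copy I)) copy-commutative (□-copy I)
  ⟦⟧-resp-≈ (D.copy-⊗ A B) =
    compare (I {A} ⊠ I {B}) ((I {A} ⊠ I {B}) ⊠ (I {A} ⊠ I {B}))
      (□-copy (I ⊠ I))
      copy-⊗
      (□-∘ (□-interchange I I I I) (□-⊗ (□-copy I) (□-copy I)))

  functor : MarkovFunctor (Free Q) C
  functor = record
    { F₀ = ⨂
    ; F₁ = ⟦_⟧
    ; F-resp-≈ = ⟦⟧-resp-≈
    ; F-id = refl
    ; F-∘ = refl
    ; ε⇒ = id
    ; ε⇐ = id
    ; φ⇒ = ⨂-++⇒
    ; φ⇐ = ⨂-++⇐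
    ; ε-isoˡ = identityˡ
    ; ε-isoʳ = identityˡ
    ; φ-isoˡ = φ-isoˡ
    ; φ-isoʳ = φ-isoʳ
    ; φ-natural = φ-natural
    ; φ-assoc = φ-assoc
    ; φ-unitˡ = λ A → trans identityˡ (trans (∘-respʳ ⊗-id) identityʳ)
    ; φ-unitʳ = λ A → trans (∘-respʳ (trans (∘-respʳ ⊗-id) identityʳ)) (φ-unitʳ A)
    ; φ-σ = φ-σ
    ; F-copy = λ A → refl
    ; ε-deterministic = id-deterministic
    ; φ-deterministic = φ-det
    }

elements : ∀ {n} → Subset n → List (Fin n)
elements p = filter (_∈? p) (allFin _)

∈-elements⁺ : ∀ {n} {p : Subset n} {x} → x ∈ p → x ∈ₗ elements p
∈-elements⁺ {p = p} {x} x∈p = ∈-filter⁺ (_∈? p) (∈-allFin x) x∈p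

∈-elements⁻ : ∀ {n} {p : Subset n} {x} → x ∈ₗ elements p → x ∈ p
∈-elements⁻ {n} {p} i = proj₂ (∈-filter⁻ (_∈? p) {xs = allFin n} i)

record OpenDAG : Set where
  field
    size    : ℕ
    parents : Fin size → Subset size
    inputs  : Subset size

  Vertex : Set
  Vertex = Fin size

  Edge : Vertex → Vertex → Set
  Edge x y = x ∈ parents y

  field
    acyclic           : ∀ {x} → ¬ TransClosure Edge x x
    inputs-parentless : ∀ {x} → x ∈ inputs → Empty (parents x)

  nonInputs : Subset size
  nonInputs = ∁ inputs

  open DecMembership {A = Vertex} Fin._≟_ using () renaming (_∈?_ to _∈ₗ?_)

  Edge-wellFounded : WellFounded Edge
  Edge-wellFounded = wellFounded⁻ Edge (spo-wellFounded isSPO)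
    where
    isSPO : IsStrictPartialOrder _≡_ (TransClosure Edge)
    isSPO = record
      { isEquivalence = isEquivalence
      ; irrefl        = λ { ≡.refl → acyclic }
      ; trans         = _⁺++⁺_
      ; <-resp-≈      = (λ { ≡.refl e → e }) , (λ { ≡.refl e → e })
      }

  -- Starting from given values for the variables Γ, the variables Δ can be
  -- computed by running mechanisms one at a time, each at most once and after
  -- its parents.
  data Schedule (Γ : List Vertex) : List Vertex → Set where
    start : Schedule Γ Γ
    run   : ∀ {Δ} → Schedule Γ Δ → ∀ x → x ∉ inputs → x ∉ₗ Δ → elements (parents x) ⊆ₗ Δ →
            Schedule Γ (x ∷ Δ)

  Ancestor : List Vertex → Vertex → Set
  Ancestor O x = ∃[ o ] o ∈ₗ O × Star Edge x o

  -- If Γ lists the inputs, the variables added to Γ are exactly the non-input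
  -- ancestors of O: `relevant` is one inclusion, and the other follows from
  -- `complete` because a variable is only added after its parents.
  record Evaluation (Γ O : List Vertex) : Set where
    field
      computed  : List Vertex
      schedule  : Schedule Γ computed
      complete  : O ⊆ₗ computed
      relevant  : ∀ {x} → x ∈ₗ computed → x ∈ₗ Γ ⊎ Ancestor O x

  module _ (Γ O : List Vertex) (inputs⊆Γ : ∀ {x} → x ∈ inputs → x ∈ₗ Γ) where
    private
      record State : Set where
        field
          computed : List Vertex
          schedule : Schedule Γ computed
          relevant : ∀ {x} → x ∈ₗ computed → x ∈ₗ Γ ⊎ Ancestor O x
      open State

      Γ⊆ : ∀ {Δ} → Schedule Γ Δ → Γ ⊆ₗ Δ
      Γ⊆ start           i = i
      Γ⊆ (run s x _ _ _) i = there (Γ⊆ s i)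

      Reaching : State → List Vertex → Set
      Reaching s A = Σ[ s′ ∈ State ] computed s ⊆ₗ computed s′ × A ⊆ₗ computed s′

      visit    : ∀ x → Acc Edge x → Ancestor O x → ∀ s → Reaching s (x ∷ [])
      visitAll : ∀ {x} → (∀ {y} → Edge y x → Acc Edge y) → Ancestor O x →
                 ∀ A → (∀ {y} → y ∈ₗ A → Edge y x) → ∀ s → Reaching s A

      visit x (acc rs) anc s with visitAll rs anc (elements (parents x)) ∈-elements⁻ s
      ... | s′ , s⊆s′ , pa⊆ with x ∈ₗ? computed s′
      ...   | yes i = s′ , s⊆s′ , λ { (here ≡.refl) → i }
      ...   | no ¬i = s″ , there ∘′ s⊆s′ , λ { (here e) → here e }
        where
        x∉inputs : x ∉ inputs
        x∉inputs x∈ = ¬i (Γ⊆ (schedule s′) (inputs⊆Γ x∈))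

        s″ : State
        s″ = record
          { computed = x ∷ computed s′
          ; schedule = run (schedule s′) x x∉inputs ¬i pa⊆
          ; relevant = λ { (here ≡.refl) → inj₂ anc ; (there i) → relevant s′ i }
          }

      visitAll rs anc []      A⊆ s = s , (λ i → i) , λ ()
      visitAll rs anc@(o , o∈O , path) (y ∷ A) A⊆ s
        with visit y (rs (A⊆ (here ≡.refl))) (o , o∈O , A⊆ (here ≡.refl) ◅ path) s
      ... | s′ , s⊆s′ , y∈ with visitAll rs anc A (A⊆ ∘′ there) s′
      ...   | s″ , s′⊆s″ , A∈ =
        s″ , s′⊆s″ ∘′ s⊆s′ , λ { (here e) → s′⊆s″ (y∈ (here e)) ; (there i) → A∈ i }

      visitOutputs : ∀ A → A ⊆ₗ O → ∀ s → Reaching s A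
      visitOutputs []      A⊆ s = s , (λ i → i) , λ ()
      visitOutputs (y ∷ A) A⊆ s
        with visit y (Edge-wellFounded y) (y , A⊆ (here ≡.refl) , ε) s
      ... | s′ , s⊆s′ , y∈ with visitOutputs A (A⊆ ∘′ there) s′
      ...   | s″ , s′⊆s″ , A∈ =
        s″ , s′⊆s″ ∘′ s⊆s′ , λ { (here e) → s′⊆s″ (y∈ (here e)) ; (there i) → A∈ i }

      initial : State
      initial = record { computed = Γ ; schedule = start ; relevant = inj₁ }

    evaluate : Evaluation Γ O
    evaluate with visitOutputs O (λ i → i) initial
    ... | s , _ , O⊆ = record
      { computed = computed s ; schedule = schedule s ; complete = O⊆ ; relevant = relevant s }

record CausalModel {o ℓ e} (C : MarkovCategory o ℓ e) : Set (o ⊔ ℓ) where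
  open MarkovCategory C
  field
    dag : OpenDAG
  open OpenDAG dag public
  field
    obj : Vertex → Obj
  open Tensor C obj public
  field
    mechanism : ∀ x → x ∉ inputs → ⨂ (elements (parents x)) ⇒ obj x
    outputs   : Subset size

  ⟦_⟧ˢ : ∀ {Γ Δ} → Schedule Γ Δ → ⨂ Γ ⇒ ⨂ Δ
  ⟦ start ⟧ˢ              = id
  ⟦ run s x x∉in _ pa⊆ ⟧ˢ = ((mechanism x x∉in ∘ select _ pa⊆) ⊗₁ id) ∘ (copy ∘ ⟦ s ⟧ˢ)

  -- Γ lists the inputs.  Every variable is kept as a wire after its mechanism has
  -- run, and the wires not in O are discarded at the end; by the comonoid laws
  -- this is the string diagram in which each variable is copied once per use.
  composite : ∀ Γ → (∀ {x} → x ∈ inputs → x ∈ₗ Γ) → ∀ O → ⨂ Γ ⇒ ⨂ O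
  composite Γ inputs⊆Γ O = select O complete ∘ ⟦ schedule ⟧ˢ
    where
    open Evaluation (evaluate Γ O inputs⊆Γ)

module _ {o ℓ e} {C : MarkovCategory o ℓ e} where
  open MarkovCategory C

  Do : (M : CausalModel C) → Subset (CausalModel.size M) → CausalModel C
  Do M S = record
    { dag = record
      { size              = size
      ; parents           = parents′
      ; inputs            = inputs ∪ S
      ; acyclic           = λ p → acyclic (weaken p)
      ; inputs-parentless = λ x∈ (y , e) →
          [ (λ x∈in → inputs-parentless x∈in (y , weaken₁ e)) , no-parents e ]′
            (x∈p∪q⁻ inputs S x∈)
      }
    ; obj       = obj
    ; mechanism = mechanism′
    ; outputs   = outputs
    }
    where
    open CausalModel M

    parents′ : Vertex → Subset size
    parents′ x = if does (x ∈? S) then ⊥ else parents x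

    weaken₁ : ∀ {x y} → x ∈ parents′ y → x ∈ parents y
    weaken₁ {y = y} e with y ∈? S
    ... | yes _ = contradiction e ∉⊥
    ... | no  _ = e

    no-parents : ∀ {x y} → x ∈ parents′ y → ¬ y ∈ S
    no-parents {y = y} e y∈S with y ∈? S
    ... | yes _   = ∉⊥ e
    ... | no  y∉S = y∉S y∈S

    weaken : ∀ {x y} → TransClosure (λ x y → x ∈ parents′ y) x y → TransClosure Edge x y
    weaken [ e ]   = [ weaken₁ e ]
    weaken (e ∷ p) = weaken₁ e ∷ weaken p

    mechanism′ : ∀ x → x ∉ inputs ∪ S → ⨂ (elements (parents′ x)) ⇒ obj x
    mechanism′ x x∉ with x ∈? S
    ... | yes x∈S = contradiction (x∈p∪q⁺ (inj₂ x∈S)) x∉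
    ... | no  _   = mechanism x (λ x∈in → x∉ (x∈p∪q⁺ (inj₁ x∈in)))

  doChannel : (M : CausalModel C) → let open CausalModel M in
              (S O : Subset size) → ⨂ (elements inputs ++ elements S) ⇒ ⨂ (elements O)
  doChannel M S O =
    CausalModel.composite (Do M S) (elements inputs ++ elements S) covered (elements O)
    where
    open CausalModel M
    covered : ∀ {x} → x ∈ inputs ∪ S → x ∈ₗ elements inputs ++ elements S
    covered x∈ =
      [ (λ i → ∈-++⁺ˡ (∈-elements⁺ i)) , (λ i → ∈-++⁺ʳ (elements inputs) (∈-elements⁺ i)) ]′
        (x∈p∪q⁻ inputs S x∈)

  record DoQuery (M : CausalModel C) : Set where
    open CausalModel M
    field
      intervened  : Subset size
      observed    : Subset size
      -- Irrelevant, so that a query is determined by its two sets.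
      .intervened⊆ : intervened ⊆ nonInputs
      .observed⊆   : observed ⊆ outputs

  DoSignature : CausalModel C → Signature
  DoSignature M = record
    { Type  = Vertex
    ; Query = DoQuery M
    ; dom   = λ q → elements inputs ++ elements (intervened q)
    ; cod   = λ q → elements (observed q)
    }
    where
    open CausalModel M
    open DoQuery

  doModel : (M : CausalModel C) → MarkovFunctor (Free (DoSignature M)) C
  doModel M = Interpretation.functor (DoSignature M) C (CausalModel.obj M)
                (λ q → doChannel M (intervened q) (observed q))
    where open DoQuery

record MonoidalIsomorphism {o ℓ e o′ ℓ′ e′} {C : MarkovCategory o ℓ e} {D : MarkovCategory o′ ℓ′ e′}
         (F G : MarkovFunctor C D) : Set (o ⊔ ℓ ⊔ ℓ′ ⊔ e′) where
  open MarkovCategory D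
  private
    module F = MarkovFunctor F
    module G = MarkovFunctor G
  field
    forward : Transformation F G
  open Transformation forward public
  field
    η⇐     : ∀ A → G.F₀ A ⇒ F.F₀ A
    η-isoˡ : ∀ A → η⇐ A ∘ η A ≈ id
    η-isoʳ : ∀ A → η A ∘ η⇐ A ≈ id

module _ {o ℓ e o′ ℓ′ e′} {C : MarkovCategory o ℓ e} {D : MarkovCategory o′ ℓ′ e′} where
  open MarkovCategory D
  open Reasoning D
  open Coherence D
  open MonoidalIsomorphism
  private
    module C = MarkovCategory C

  iso-refl : ∀ {F : MarkovFunctor C D} → MonoidalIsomorphism F F
  iso-refl = record
    { forward = record
      { η             = λ A → id
      ; natural       = λ f → idsq
      ; monoidal      = λ A B → trans idsq (∘-respʳ (sym ⊗-id))
      ; monoidal-unit = identityˡ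
      ; deterministic = λ A → id-deterministic
      }
    ; η⇐     = λ A → id
    ; η-isoˡ = λ A → identityˡ
    ; η-isoʳ = λ A → identityˡ
    }

  iso-sym : ∀ {F G : MarkovFunctor C D} → MonoidalIsomorphism F G → MonoidalIsomorphism G F
  iso-sym i = record
    { forward = record
      { η             = η⇐ i
      ; natural       = λ f → sym (flip-square (η-isoʳ i _) (η-isoˡ i _) (sym (natural i f)))
      ; monoidal      = λ A B →
          sym (flip-square (⊗-iso (η-isoʳ i A) (η-isoʳ i B)) (η-isoˡ i (A C.⊗₀ B)) (sym (monoidal i A B)))
      ; monoidal-unit = trans (∘-respʳ (sym (monoidal-unit i))) (cancelˡ (η-isoˡ i C.unit))
      ; deterministic = λ A → inverse-deterministic (η-isoʳ i A) (η-isoˡ i A) (deterministic i A)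
      }
    ; η⇐     = η i
    ; η-isoˡ = η-isoʳ i
    ; η-isoʳ = η-isoˡ i
    }

  iso-trans : ∀ {F G H : MarkovFunctor C D} →
              MonoidalIsomorphism F G → MonoidalIsomorphism G H → MonoidalIsomorphism F H
  iso-trans i j = record
    { forward = record
      { η             = λ A → η j A ∘ η i A
      ; natural       = λ f → trans (pullʳ (natural i f)) (trans (pullˡ (natural j f)) assoc)
      ; monoidal      = λ A B →
          trans (pullʳ (monoidal i A B))
            (trans (extendʳ (monoidal j A B)) (∘-respʳ (sym ⊗-∘)))
      ; monoidal-unit = trans (pullʳ (monoidal-unit i)) (monoidal-unit j)
      ; deterministic = λ A → ∘-deterministic (deterministic j A) (deterministic i A)
      }
    ; η⇐     = λ A → η⇐ i A ∘ η⇐ j A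
    ; η-isoˡ = λ A → ∘-iso (η-isoˡ i A) (η-isoˡ j A)
    ; η-isoʳ = λ A → ∘-iso (η-isoʳ j A) (η-isoʳ i A)
    }

module _ {QL QH : Signature} (π : MarkovFunctor (Free QH) (Free QL)) where
  open MarkovFunctor π
  open Diagrams QL using (Diagram; id; _∘_; _⊗_; permute; _≈_)
  private
    module QL = Signature QL
    module QH = Signature QH
    module DH = Diagrams QH

  onType : QH.Type → List QL.Type
  onType x = F₀ (x ∷ [])

  onTypes : List QH.Type → List QL.Type
  onTypes = concatMap onType

  φ* : ∀ A → Diagram (onTypes A) (F₀ A)
  φ* []      = ε⇒
  φ* (x ∷ A) = φ⇒ (x ∷ []) A ∘ (id {onType x} ⊗ φ* A)

  -- Equality with a generator is up to the structure isomorphisms of π and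
  -- reordering of the lists of types.
  SendsToQuery : QH.Query → QL.Query → Set
  SendsToQuery q q′ =
    Σ[ p ∈ QL.dom q′ ↭ onTypes (QH.dom q) ]
    Σ[ r ∈ QL.cod q′ ↭ onTypes (QH.cod q) ]
      F₁ (DH.gen q) ∘ (φ* (QH.dom q) ∘ permute p)
        ≈ φ* (QH.cod q) ∘ (permute r ∘ Diagrams.gen q′)

module _ {o ℓ e} {C : MarkovCategory o ℓ e} {QL QH : Signature}
         (L : MarkovFunctor (Free QL) C) (H : MarkovFunctor (Free QH) C) where
  open MarkovCategory C
  private
    module L = MarkovFunctor L
    module QL = Diagrams QL

  record DownwardAbstraction : Set (o ⊔ ℓ ⊔ e) where
    field
      π       : MarkovFunctor (Free QH) (Free QL)
      queries : ∀ q → ∃[ q′ ] SendsToQuery π q q′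
      τ       : Transformation (L ∘F π) H
      τ-epic  : EpicTransformation τ

  -- Functors are compared up to the order of the lists of types: π and π′ are
  -- identified along an isomorphism which reorders the list of each type.
  record SameDownward (D D′ : DownwardAbstraction) : Set e where
    private
      module D  = DownwardAbstraction D
      module D′ = DownwardAbstraction D′
    field
      iso       : MonoidalIsomorphism D.π D′.π
    open MonoidalIsomorphism iso using (η)
    field
      reorders  : ∀ x → Σ[ p ∈ onType D.π x ↭ onType D′.π x ] η (x ∷ []) QL.≈ QL.permute p
      τ-agree   : ∀ A → Transformation.η D′.τ A ∘ L.F₁ (η A) ≈ Transformation.η D.τ A

  open SameDownward
  open Reasoning C
  private
    module FL = Reasoning (Free QL)

  sameDownward-equivalence : IsEquivalence SameDownward
  sameDownward-equivalence = record
    { refl = record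
      { iso      = iso-refl
      ; reorders = λ x → _↭_.refl , QL.refl
      ; τ-agree  = λ A → trans (∘-respʳ L.F-id) identityʳ
      }
    ; sym = λ s → let open MonoidalIsomorphism (iso s) in record
      { iso      = iso-sym (iso s)
      ; reorders = λ x → let p , η≈p = reorders s x in
          ↭-sym p , FL.mono (η-isoˡ (x ∷ []))
            (QL.trans (η-isoʳ (x ∷ []))
              (QL.trans (QL.sym (QL.permute-isoʳ p)) (QL.∘-resp-≈ (QL.sym η≈p) QL.refl)))
      ; τ-agree  = λ A →
          trans (∘-respˡ (sym (τ-agree s A)))
            (cancelʳ (trans (sym L.F-∘) (trans (L.F-resp-≈ (η-isoʳ A)) L.F-id)))
      }
    ; trans = λ s t → record
      { iso      = iso-trans (iso s) (iso t)
      ; reorders = λ x → let p , η≈p = reorders s x ; q , η≈q = reorders t x in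
          _↭_.trans p q , QL.∘-resp-≈ η≈q η≈p
      ; τ-agree  = λ A →
          trans (∘-respʳ L.F-∘) (trans (pullˡ (τ-agree t A)) (τ-agree s A))
      }
    }

module _ {o ℓ e} {C : MarkovCategory o ℓ e} (L H : CausalModel C) where
  open MarkovCategory C
  private
    module L = CausalModel L
    module H = CausalModel H

  module Images (π : H.Vertex → Subset L.size) where
    π* : Subset H.size → Subset L.size
    π* S = ⋃ (map π (elements S))

    πs : List H.Vertex → List L.Vertex
    πs = concatMap (elements ∘′ π)

    tensor : (∀ x → L.⨂ (elements (π x)) ⇒ H.obj x) → ∀ A → L.⨂ (πs A) ⇒ H.⨂ A
    tensor τ []      = id
    tensor τ (x ∷ A) = (τ x ⊗₁ tensor τ A) ∘ L.⨂-++⇐ (elements (π x)) (πs A)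

  record VariableAlignment : Set (o ⊔ ℓ ⊔ e) where
    field
      π : H.Vertex → Subset L.size
    open Images π public using (π*; πs; tensor)
    field
      disjoint        : ∀ {x y} → x ≢ y → Empty (π x ∩ π y)
      π-inputs        : π* H.inputs ≡ L.inputs
      π-outputs       : π* H.outputs ⊆ L.outputs
      τ               : ∀ x → L.⨂ (elements (π x)) ⇒ H.obj x
      τ-epic          : ∀ x → Epic (τ x)
      τ-deterministic : ∀ x → Deterministic (τ x)

    τ⊗ : ∀ A → L.⨂ (πs A) ⇒ H.⨂ A
    τ⊗ = tensor τ

    field
      τ⊗-epic : ∀ A → Epic (τ⊗ A)

  record ConstructiveAbstraction : Set (o ⊔ ℓ ⊔ e) where
    field
      alignment : VariableAlignment
    open VariableAlignment alignment public
    field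
      -- p and r pass between the listing of π(S) by its elements and the
      -- concatenation of the listings of the π(X).
      consistent : ∀ S → S ⊆ H.nonInputs →
        Σ[ p ∈ πs (elements H.inputs ++ elements S) ↭ elements L.inputs ++ elements (π* S) ]
        Σ[ r ∈ elements (π* H.outputs) ↭ πs (elements H.outputs) ]
          τ⊗ (elements H.outputs) ∘
            (L.permute r ∘ (doChannel L (π* S) (π* H.outputs) ∘ L.permute p))
            ≈ doChannel H S H.outputs ∘ τ⊗ (elements H.inputs ++ elements S)

  private
    Component : H.Vertex → Set ℓ
    Component x = Σ[ P ∈ Subset L.size ] (L.⨂ (elements P) ⇒ H.obj x)

    SameComponent : ∀ {x} → Component x → Component x → Set e
    SameComponent {x} (P , f) (P′ , f′) =
      Σ[ eq ∈ P ≡ P′ ] ≡.subst (λ P → L.⨂ (elements P) ⇒ H.obj x) eq f ≈ f′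

    component : ConstructiveAbstraction → ∀ x → Component x
    component A x = π x , τ x
      where open ConstructiveAbstraction A

    sym-component : ∀ {x} {c c′ : Component x} → SameComponent c c′ → SameComponent c′ c
    sym-component (≡.refl , p) = ≡.refl , IsEquivalence.sym equiv p

    trans-component : ∀ {x} {c c′ c″ : Component x} →
                      SameComponent c c′ → SameComponent c′ c″ → SameComponent c c″
    trans-component (≡.refl , p) (≡.refl , q) = ≡.refl , IsEquivalence.trans equiv p q

  SameConstructive : ConstructiveAbstraction → ConstructiveAbstraction → Set e
  SameConstructive A A′ = ∀ x → SameComponent (component A x) (component A′ x)

  Constructives : Setoid (o ⊔ ℓ ⊔ e) e
  Constructives = record
    { Carrier       = ConstructiveAbstraction
    ; _≈_           = SameConstructive
    ; isEquivalence = record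
      { refl  = λ x → ≡.refl , IsEquivalence.refl equiv
      ; sym   = λ s x → sym-component (s x)
      ; trans = λ s t x → trans-component (s x) (t x)
      }
    }

  PreservesInputs : MarkovFunctor (Free (DoSignature H)) (Free (DoSignature L)) → Set
  PreservesInputs π = onTypes π (elements H.inputs) ↭ elements L.inputs

  record DoAbstraction : Set (o ⊔ ℓ ⊔ e) where
    field
      downward : DownwardAbstraction (doModel L) (doModel H)
    open DownwardAbstraction downward public
    field
      inputs   : PreservesInputs π

  DoAbstractions : Setoid (o ⊔ ℓ ⊔ e) e
  DoAbstractions = record
    { Carrier       = DoAbstraction
    ; _≈_           = λ D D′ → SameDownward (doModel L) (doModel H) (downward D) (downward D′)
    ; isEquivalence = record { refl = E.refl ; sym = E.sym ; trans = E.trans }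
    }
    where
    open DoAbstraction using (downward)
    module E = IsEquivalence (sameDownward-equivalence (doModel L) (doModel H))

  -- The single type x is the list x ∷ [], whose tensor is obj x ⊗₀ unit.
  RestrictsTo : DoAbstraction → ConstructiveAbstraction → Set e
  RestrictsTo D A = ∀ x →
    Σ[ p ∈ onType D.π x ↭ elements (A.π x) ]
      A.τ x ∘ L.permute p ≈ ρ⇒ ∘ Transformation.η D.τ (x ∷ [])
    where
    module D = DoAbstraction D
    module A = ConstructiveAbstraction A

-- A deterministic map into a tensor product is determined by its marginals.
-- Hence reorderings of a list without repetitions are unique as diagrams, and
-- all choices of permutations in the definitions are immaterial.
--
-- Restriction.  The query that intervenes on all non-inputs of H has every
-- variable of H in its domain.  Its image is a query of L, whose domain has no
-- repetitions, so the lists π(X) are disjoint and without repetitions.  For the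
-- query Do(S) : V_in ⊗ S → V_out, naturality of τ is the consistency equation.
--
-- Extension.  A monoidal transformation out of a free category is determined by
-- its components on single types and is natural once it is so on generators.
-- Consistency gives naturality on the queries observing all of V_out, and any
-- other query is a marginal of one of these: the channel of a causal model does
-- not depend on the order in which the mechanisms are run, and a variable that
-- is discarded need not be computed.

module Submission where

open import Defs
open import Level using (_⊔_)
import Data.Fin.Properties as Fin
open import Data.Empty using (⊥-elim; ⊥-elim-irr)
open import Data.Fin.Base using (Fin)
open import Data.Fin.Subset using (Subset; _∈_; _∉_; _⊆_; _∪_; _∩_; ⋃; Empty; ⊥; ⁅_⁆)
open import Data.Fin.Subset.Properties
  using (_∈?_; ∉⊥; ⊥⊆; ⊆-antisym; x∈p∪q⁺; x∈p∪q⁻; x∈p∩q⁺; x∈p∩q⁻; x∈⁅x⁆; x∈⁅y⁆⇒x≡y;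
         x∈∁p⇒x∉p; x∉p⇒x∈∁p)
open import Data.List.Base using (List; []; _∷_; _++_; concatMap; map)
import Data.List.Membership.DecPropositional as DecMembership
open import Data.List.Membership.Propositional using (find; lose)
  renaming (_∈_ to _∈ₗ_; _∉_ to _∉ₗ_)
open import Data.List.Membership.Propositional.Properties
  using (∈-++⁺ˡ; ∈-++⁺ʳ; ∈-++⁻; ∈-concatMap⁺; ∈-concatMap⁻)
open import Data.List.Membership.Propositional.Properties.WithK
  using (unique⇒irrelevant; unique∧set⇒bag)
open import Data.List.Properties using (++-assoc; ++-identityʳ; concatMap-++)
open import Data.List.Relation.Binary.BagAndSetEquality using (∼bag⇒↭)
open import Data.List.Relation.Binary.Disjoint.Propositional using (Disjoint)
open import Data.List.Relation.Binary.Permutation.Propositional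
  using (_↭_; ↭-sym; ↭-reflexive; ↭⇒↭ₛ)
open import Data.List.Relation.Binary.Permutation.Propositional.Properties
  using (++⁺; ++⁺ˡ; ++⁺ʳ; ∈-resp-↭; ↭-sym-involutive)
import Data.List.Relation.Binary.Permutation.Setoid.Properties as PermutationSetoid
open import Data.List.Relation.Binary.Subset.Propositional using () renaming (_⊆_ to _⊆ₗ_)
open import Data.List.Relation.Binary.Subset.Propositional.Properties using (∷⁺ʳ; concatMap⁺)
open import Data.List.Relation.Unary.All using ([]; _∷_)
open import Data.List.Relation.Unary.All.Properties using (All¬⇒¬Any; ¬Any⇒All¬)
open import Data.List.Relation.Unary.AllPairs using ([]; _∷_)
open import Data.List.Relation.Unary.Any using (here; there)
open import Data.List.Relation.Unary.Unique.Propositional using (Unique)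
import Data.List.Relation.Unary.Unique.Propositional.Properties as Unique
open import Data.Product.Base using (Σ-syntax; ∃-syntax; _×_; _,_; proj₁; proj₂)
open import Data.Sum.Base using (_⊎_; inj₁; inj₂)
open import Function.Base using () renaming (_∘_ to _∘′_)
open import Function.Bundles using (Bijection; mk⇔)
open import Relation.Binary.Construct.Closure.ReflexiveTransitive using (Star; ε; _◅_)
open import Relation.Binary.PropositionalEquality.Core as ≡ using (_≡_; _≢_)
open import Relation.Binary.PropositionalEquality.Properties using (setoid)
open import Relation.Nullary.Decidable.Core using (yes; no)
open import Relation.Nullary.Negation.Core using (¬_; contradiction)

-- A functor `π` acts on queries as well as on variables, and the bijection says that its action on
-- queries carries no further information. The reason is that `DoSignature` has exactly one query
-- for each admissible pair of sets, and both sets can be read off the listed domain and codomain up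
-- to order (`query-unique`). So the images of the types of a query force the image of the query.
-- This identifies two functors with the same restriction, and it fixes the low-level query to be
-- `image q` when consistency is extracted from naturality.
--
-- The definitions only assert that some reordering exists, so equations with different witnesses
-- have to be compared. With repetitions this is impossible: crossing two equal wires is not the
-- identity. Hence the `Unique` hypotheses. On a list without repetitions, a deterministic map whose
-- outputs are wires of the list is a `select`, and two such maps are compared by asking which wire
-- each output is.
--
-- For the converse, the functor is again an interpretation: the signature of `H` is interpreted in
-- the free category over that of `L`, each query going to its image between two permutations.

open Diagrams using (Free)

-- Marginals of deterministic maps

module MarkovProperties {o ℓ e} (C : MarkovCategory o ℓ e) where
  open MarkovCategory C
  open Reasoning C
  open Coherence C

  fst : ∀ {A B} → A ⊗₀ B ⇒ A
  fst = ρ⇒ ∘ (id ⊗₁ discard)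

  snd : ∀ {A B} → A ⊗₀ B ⇒ B
  snd = λ⇒ ∘ (discard ⊗₁ id)

  ⟨_,_⟩ : ∀ {X A B} → X ⇒ A → X ⇒ B → X ⇒ A ⊗₀ B
  ⟨ f , g ⟩ = (f ⊗₁ g) ∘ copy

  unit-unique : ∀ {X} (f g : X ⇒ unit) → f ≈ g
  unit-unique f g = trans (discard-unique f) (sym (discard-unique g))

  ⊗-split : ∀ {A B C D} {f : A ⇒ B} {g : C ⇒ D} → f ⊗₁ g ≈ (f ⊗₁ id) ∘ (id ⊗₁ g)
  ⊗-split = trans (⊗-resp-≈ (sym identityʳ) (sym identityˡ)) ⊗-∘

  ⊗-split′ : ∀ {A B C D} {f : A ⇒ B} {g : C ⇒ D} → f ⊗₁ g ≈ (id ⊗₁ g) ∘ (f ⊗₁ id)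
  ⊗-split′ = trans (⊗-resp-≈ (sym identityˡ) (sym identityʳ)) ⊗-∘

  copy-unitʳ : ∀ {A} → ρ⇒ ∘ ((id ⊗₁ discard) ∘ copy {A}) ≈ id
  copy-unitʳ = begin
    ρ⇒ ∘ ((id ⊗₁ discard) ∘ copy)        ≈⟨ ∘-respˡ λ-σ ⟨
    (λ⇒ ∘ σ) ∘ ((id ⊗₁ discard) ∘ copy)  ≈⟨ pullʳ (extendʳ σ-natural) ⟩
    λ⇒ ∘ ((discard ⊗₁ id) ∘ (σ ∘ copy))  ≈⟨ ∘-respʳ (∘-respʳ copy-commutative) ⟩
    λ⇒ ∘ ((discard ⊗₁ id) ∘ copy)        ≈⟨ copy-unitˡ ⟩
    id                                   ∎

  fst-⊗ : ∀ {A B C D} {f : A ⇒ B} {g : C ⇒ D} → fst ∘ (f ⊗₁ g) ≈ f ∘ fst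
  fst-⊗ {f = f} {g} = begin
    (ρ⇒ ∘ (id ⊗₁ discard)) ∘ (f ⊗₁ g)  ≈⟨ pullʳ (sym ⊗-∘) ⟩
    ρ⇒ ∘ ((id ∘ f) ⊗₁ (discard ∘ g))   ≈⟨ ∘-respʳ (⊗-resp-≈ idsq (trans (unit-unique _ _) (sym identityˡ))) ⟩
    ρ⇒ ∘ ((f ∘ id) ⊗₁ (id ∘ discard))  ≈⟨ ∘-respʳ ⊗-∘ ⟩
    ρ⇒ ∘ ((f ⊗₁ id) ∘ (id ⊗₁ discard)) ≈⟨ extendʳ ρ-natural ⟩
    f ∘ fst                            ∎

  snd-⊗ : ∀ {A B C D} {f : A ⇒ B} {g : C ⇒ D} → snd ∘ (f ⊗₁ g) ≈ g ∘ snd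
  snd-⊗ {f = f} {g} = begin
    (λ⇒ ∘ (discard ⊗₁ id)) ∘ (f ⊗₁ g)  ≈⟨ pullʳ (sym ⊗-∘) ⟩
    λ⇒ ∘ ((discard ∘ f) ⊗₁ (id ∘ g))   ≈⟨ ∘-respʳ (⊗-resp-≈ (trans (unit-unique _ _) (sym identityˡ)) idsq) ⟩
    λ⇒ ∘ ((id ∘ discard) ⊗₁ (g ∘ id))  ≈⟨ ∘-respʳ ⊗-∘ ⟩
    λ⇒ ∘ ((id ⊗₁ g) ∘ (discard ⊗₁ id)) ≈⟨ extendʳ λ-natural ⟩
    g ∘ snd                            ∎

  fst-pair : ∀ {X A B} {f : X ⇒ A} {g : X ⇒ B} → fst ∘ ⟨ f , g ⟩ ≈ f
  fst-pair = trans (extendʳ fst-⊗) (trans (∘-respʳ (trans assoc copy-unitʳ)) identityʳ)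

  snd-pair : ∀ {X A B} {f : X ⇒ A} {g : X ⇒ B} → snd ∘ ⟨ f , g ⟩ ≈ g
  snd-pair = trans (extendʳ snd-⊗) (trans (∘-respʳ (trans assoc copy-unitˡ)) identityʳ)

  fst-copy : ∀ {A} → fst ∘ copy {A} ≈ id
  fst-copy = trans assoc copy-unitʳ

  snd-copy : ∀ {A} → snd ∘ copy {A} ≈ id
  snd-copy = trans assoc copy-unitˡ

  -- After the discards, the two middle factors crossed by `interchange` are both the unit, where
  -- `σ` is the identity. What remains are the counit laws of the two factors.
  fst-snd-copy : ∀ {A B} → (fst ⊗₁ snd) ∘ copy {A ⊗₀ B} ≈ id
  fst-snd-copy = begin
    (fst ⊗₁ snd) ∘ copy
      ≈⟨ ∘-resp-≈ ⊗-∘ copy-⊗ ⟩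
    ((ρ⇒ ⊗₁ λ⇒) ∘ ((id ⊗₁ discard) ⊗₁ (discard ⊗₁ id))) ∘ (interchange ∘ (copy ⊗₁ copy))
      ≈⟨ pullʳ (extendʳ (sym interchange-natural)) ⟩
    (ρ⇒ ⊗₁ λ⇒) ∘ (interchange ∘ (((id ⊗₁ discard) ⊗₁ (discard ⊗₁ id)) ∘ (copy ⊗₁ copy)))
      ≈⟨ ∘-respʳ (trans (∘-respˡ interchange-unit) identityˡ) ⟩
    (ρ⇒ ⊗₁ λ⇒) ∘ (((id ⊗₁ discard) ⊗₁ (discard ⊗₁ id)) ∘ (copy ⊗₁ copy))
      ≈⟨ trans (∘-respʳ (sym ⊗-∘)) (sym ⊗-∘) ⟩
    (ρ⇒ ∘ ((id ⊗₁ discard) ∘ copy)) ⊗₁ (λ⇒ ∘ ((discard ⊗₁ id) ∘ copy))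
      ≈⟨ ⊗-resp-≈ copy-unitʳ copy-unitˡ ⟩
    id ⊗₁ id
      ≈⟨ ⊗-id ⟩
    id ∎
    where
    σ-unit : σ {unit} {unit} ≈ id
    σ-unit = mono λ-isoˡ (unit-unique _ _)

    exchange-unit : ∀ {B} → exchange {unit} {unit} {B} ≈ id
    exchange-unit =
      trans (∘-respʳ (trans (∘-respˡ (trans (⊗-respˡ σ-unit) ⊗-id)) identityˡ)) α-isoʳ

    interchange-unit : ∀ {A B} → interchange {A} {unit} {unit} {B} ≈ id
    interchange-unit =
      trans (∘-respʳ (trans (∘-respˡ (trans (⊗-respʳ exchange-unit) ⊗-id)) identityˡ)) α-isoˡ

  -- Determinism lets `f` pass through the `copy` in `fst-snd-copy`, leaving one copy of `f` for
  -- each marginal. The marginals of a general channel forget the correlation between its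
  -- components.
  deterministic-pair : ∀ {X A B} {f : X ⇒ A ⊗₀ B} → Deterministic f → f ≈ ⟨ fst ∘ f , snd ∘ f ⟩
  deterministic-pair {f = f} d = begin
    f                                    ≈⟨ trans (∘-respˡ fst-snd-copy) identityˡ ⟨
    ((fst ⊗₁ snd) ∘ copy) ∘ f            ≈⟨ pullʳ d ⟩
    (fst ⊗₁ snd) ∘ ((f ⊗₁ f) ∘ copy)     ≈⟨ pullˡ (sym ⊗-∘) ⟩
    ⟨ fst ∘ f , snd ∘ f ⟩                ∎

  deterministic-unique : ∀ {X A B} {f g : X ⇒ A ⊗₀ B} → Deterministic f → Deterministic g →
                         fst ∘ f ≈ fst ∘ g → snd ∘ f ≈ snd ∘ g → f ≈ g
  deterministic-unique d d′ p q =
    trans (deterministic-pair d) (trans (∘-respˡ (⊗-resp-≈ p q)) (sym (deterministic-pair d′)))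

  Deterministic-resp : ∀ {A B} {f g : A ⇒ B} → f ≈ g → Deterministic f → Deterministic g
  Deterministic-resp p d =
    trans (∘-respʳ (sym p)) (trans d (∘-respˡ (⊗-resp-≈ p p)))

  discard-deterministic : ∀ {A} → Deterministic (discard {A})
  discard-deterministic = mono λ-isoˡ (unit-unique _ _)

  fst-α : ∀ {A B C} → fst ∘ α⇒ {A} {B} {C} ≈ fst ∘ fst
  fst-α = begin
    (ρ⇒ ∘ (id ⊗₁ discard)) ∘ α⇒
      -- Discarding `B ⊗₀ C` is rewritten as a map through `unit ⊗₀ unit`, so that `triangle`
      -- applies.
      ≈⟨ pullʳ (∘-respˡ (trans (⊗-respʳ (unit-unique _ (λ⇒ ∘ (discard ⊗₁ discard)))) id-⊗-∘)) ⟩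
    ρ⇒ ∘ (((id ⊗₁ λ⇒) ∘ (id ⊗₁ (discard ⊗₁ discard))) ∘ α⇒)
      ≈⟨ ∘-respʳ (trans (pullʳ (sym α-natural)) (pullˡ triangle)) ⟩
    ρ⇒ ∘ ((ρ⇒ ⊗₁ id) ∘ ((id ⊗₁ discard) ⊗₁ discard))
      ≈⟨ ∘-respʳ (trans (sym ⊗-∘) (trans (⊗-respʳ identityˡ) ⊗-split′)) ⟩
    ρ⇒ ∘ ((id ⊗₁ discard) ∘ (fst ⊗₁ id))
      ≈⟨ trans (sym assoc) fst-⊗ ⟩
    fst ∘ fst ∎

  snd-α : ∀ {A B C} → snd ∘ α⇒ {A} {B} {C} ≈ snd ⊗₁ id
  snd-α = begin
    (λ⇒ ∘ (discard ⊗₁ id)) ∘ α⇒        ≈⟨ pullʳ (sym α-naturalᵈ) ⟩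
    λ⇒ ∘ (α⇒ ∘ ((discard ⊗₁ id) ⊗₁ id)) ≈⟨ pullˡ λ-⊗ ⟩
    (λ⇒ ⊗₁ id) ∘ ((discard ⊗₁ id) ⊗₁ id) ≈⟨ ⊗-id-∘ ⟨
    snd ⊗₁ id                           ∎

  id⊗snd-α : ∀ {A B C} → (id ⊗₁ snd) ∘ α⇒ {A} {B} {C} ≈ fst ⊗₁ id
  id⊗snd-α = begin
    (id ⊗₁ snd) ∘ α⇒                              ≈⟨ pushˡ id-⊗-∘ ⟩
    (id ⊗₁ λ⇒) ∘ ((id ⊗₁ (discard ⊗₁ id)) ∘ α⇒)   ≈⟨ ∘-respʳ α-natural ⟨
    (id ⊗₁ λ⇒) ∘ (α⇒ ∘ ((id ⊗₁ discard) ⊗₁ id))   ≈⟨ pullˡ triangle ⟩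
    (ρ⇒ ⊗₁ id) ∘ ((id ⊗₁ discard) ⊗₁ id)          ≈⟨ ⊗-id-∘ ⟨
    fst ⊗₁ id                                     ∎

  σ-pair : ∀ {A B} → σ {A} {B} ≈ ⟨ snd , fst ⟩
  σ-pair = begin
    σ                            ≈⟨ identityʳ ⟨
    σ ∘ id                       ≈⟨ ∘-respʳ fst-snd-copy ⟨
    σ ∘ ((fst ⊗₁ snd) ∘ copy)    ≈⟨ extendʳ σ-natural ⟩
    (snd ⊗₁ fst) ∘ (σ ∘ copy)    ≈⟨ ∘-respʳ copy-commutative ⟩
    (snd ⊗₁ fst) ∘ copy          ∎

  fst-σ : ∀ {A B} → fst ∘ σ {A} {B} ≈ snd
  fst-σ = trans (∘-respʳ σ-pair) fst-pair

  snd-σ : ∀ {A B} → snd ∘ σ {A} {B} ≈ fst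
  snd-σ = trans (∘-respʳ σ-pair) snd-pair

  fst-exchange : ∀ {A B C} → fst ∘ exchange {A} {B} {C} ≈ fst ∘ snd
  fst-exchange = epi α-isoʳ (begin
    (fst ∘ exchange) ∘ α⇒           ≈⟨ pullʳ exchange-α ⟩
    fst ∘ (α⇒ ∘ (σ ⊗₁ id))          ≈⟨ pullˡ fst-α ⟩
    (fst ∘ fst) ∘ (σ ⊗₁ id)         ≈⟨ pullʳ fst-⊗ ⟩
    fst ∘ (σ ∘ fst)                 ≈⟨ pullˡ fst-σ ⟩
    snd ∘ fst                       ≈⟨ fst-⊗ ⟨
    fst ∘ (snd ⊗₁ id)               ≈⟨ pullʳ snd-α ⟨
    (fst ∘ snd) ∘ α⇒                ∎)

  snd-exchange : ∀ {A B C} → snd ∘ exchange {A} {B} {C} ≈ id ⊗₁ snd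
  snd-exchange = epi α-isoʳ (begin
    (snd ∘ exchange) ∘ α⇒           ≈⟨ pullʳ exchange-α ⟩
    snd ∘ (α⇒ ∘ (σ ⊗₁ id))          ≈⟨ pullˡ snd-α ⟩
    (snd ⊗₁ id) ∘ (σ ⊗₁ id)         ≈⟨ ⊗-id-∘ ⟨
    (snd ∘ σ) ⊗₁ id                 ≈⟨ ⊗-respˡ snd-σ ⟩
    fst ⊗₁ id                       ≈⟨ id⊗snd-α ⟨
    (id ⊗₁ snd) ∘ α⇒                ∎)

  exchange-copy : ∀ {A} → exchange ∘ ((id ⊗₁ copy) ∘ copy {A}) ≈ (id ⊗₁ copy) ∘ copy
  exchange-copy = begin
    exchange ∘ ((id ⊗₁ copy) ∘ copy)        ≈⟨ ∘-respʳ copy-assoc ⟨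
    exchange ∘ (α⇒ ∘ ((copy ⊗₁ id) ∘ copy)) ≈⟨ extendʳ exchange-α ⟩
    α⇒ ∘ ((σ ⊗₁ id) ∘ ((copy ⊗₁ id) ∘ copy))
      ≈⟨ ∘-respʳ (pullˡ (trans (sym ⊗-id-∘) (⊗-respˡ copy-commutative))) ⟩
    α⇒ ∘ ((copy ⊗₁ id) ∘ copy)              ≈⟨ copy-assoc ⟩
    (id ⊗₁ copy) ∘ copy                     ∎

  -- Both sides make four copies. By coassociativity they differ by crossing the two middle ones,
  -- which `exchange-copy` absorbs.
  copy-deterministic : ∀ {A} → Deterministic (copy {A})
  copy-deterministic = begin
    copy ∘ copy
      ≈⟨ pushˡ copy-⊗ ⟩
    interchange ∘ ((copy ⊗₁ copy) ∘ copy)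
      ≈⟨ mono α-isoˡ (trans (pullˡ α-interchange) (trans assoc (trans (∘-respʳ α-copies)
           (trans (pullˡ (sym id-⊗-∘)) (trans (∘-respˡ (⊗-respʳ exchange-copy)) (sym α-copies)))))) ⟩
    (copy ⊗₁ copy) ∘ copy ∎
    where
    α-copies : α⇒ ∘ ((copy ⊗₁ copy) ∘ copy) ≈ (id ⊗₁ ((id ⊗₁ copy) ∘ copy)) ∘ copy
    α-copies = begin
      α⇒ ∘ ((copy ⊗₁ copy) ∘ copy)                  ≈⟨ ∘-respʳ (pushˡ ⊗-split′) ⟩
      α⇒ ∘ ((id ⊗₁ copy) ∘ ((copy ⊗₁ id) ∘ copy))   ≈⟨ extendʳ α-naturalᵘ ⟩
      (id ⊗₁ (id ⊗₁ copy)) ∘ (α⇒ ∘ ((copy ⊗₁ id) ∘ copy)) ≈⟨ ∘-respʳ copy-assoc ⟩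
      (id ⊗₁ (id ⊗₁ copy)) ∘ ((id ⊗₁ copy) ∘ copy)  ≈⟨ pullˡ (sym id-⊗-∘) ⟩
      (id ⊗₁ ((id ⊗₁ copy) ∘ copy)) ∘ copy          ∎

  pair-deterministic : ∀ {X A B} {f : X ⇒ A} {g : X ⇒ B} →
                       Deterministic f → Deterministic g → Deterministic ⟨ f , g ⟩
  pair-deterministic p q = ∘-deterministic (⊗-deterministic p q) copy-deterministic

  ρ-deterministic : ∀ {A} → Deterministic (ρ⇒ {A})
  ρ-deterministic = sym (begin
    (ρ⇒ ⊗₁ ρ⇒) ∘ copy                              ≈⟨ ∘-respʳ copy-⊗ ⟩
    (ρ⇒ ⊗₁ ρ⇒) ∘ (interchange ∘ (copy ⊗₁ copy))    ≈⟨ pullˡ ρ-interchange ⟩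
    (ρ⇒ ∘ (id ⊗₁ λ⇒)) ∘ (copy ⊗₁ copy)
      ≈⟨ pullʳ (trans (sym ⊗-∘) (⊗-resp-≈ identityˡ (unit-unique _ _))) ⟩
    ρ⇒ ∘ (copy ⊗₁ id)                              ≈⟨ ρ-natural ⟩
    copy ∘ ρ⇒                                      ∎)
    where
    ρ-α⇐ : ∀ {X Y} → (ρ⇒ {X} ⊗₁ id {Y}) ∘ α⇐ ≈ id ⊗₁ λ⇒
    ρ-α⇐ = trans (∘-respˡ (sym triangle)) (cancelʳ α-isoʳ)

    λ-exchange : ∀ {X} → λ⇒ ∘ exchange {X} {unit} {unit} ≈ id ⊗₁ λ⇒
    λ-exchange = begin
      λ⇒ ∘ (α⇒ ∘ ((σ ⊗₁ id) ∘ α⇐))  ≈⟨ pullˡ λ-⊗ ⟩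
      (λ⇒ ⊗₁ id) ∘ ((σ ⊗₁ id) ∘ α⇐) ≈⟨ pullˡ (trans (sym ⊗-id-∘) (⊗-respˡ λ-σ)) ⟩
      (ρ⇒ ⊗₁ id) ∘ α⇐               ≈⟨ ρ-α⇐ ⟩
      id ⊗₁ λ⇒                      ∎

    ρ-interchange : ∀ {X Y} → (ρ⇒ ⊗₁ ρ⇒) ∘ interchange {X} {Y} {unit} {unit} ≈ ρ⇒ ∘ (id ⊗₁ λ⇒)
    ρ-interchange = begin
      (ρ⇒ ⊗₁ ρ⇒) ∘ (α⇐ ∘ ((id ⊗₁ exchange) ∘ α⇒))
        ≈⟨ pushˡ ⊗-split′ ⟩
      (id ⊗₁ ρ⇒) ∘ ((ρ⇒ ⊗₁ id) ∘ (α⇐ ∘ ((id ⊗₁ exchange) ∘ α⇒)))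
        ≈⟨ ∘-respʳ (pullˡ ρ-α⇐) ⟩
      (id ⊗₁ ρ⇒) ∘ ((id ⊗₁ λ⇒) ∘ ((id ⊗₁ exchange) ∘ α⇒))
        ≈⟨ ∘-respʳ (pullˡ (trans (sym id-⊗-∘) (⊗-respʳ λ-exchange))) ⟩
      (id ⊗₁ ρ⇒) ∘ ((id ⊗₁ (id ⊗₁ λ⇒)) ∘ α⇒)
        ≈⟨ ∘-respʳ α-naturalᵘ ⟨
      (id ⊗₁ ρ⇒) ∘ (α⇒ ∘ (id ⊗₁ λ⇒))
        ≈⟨ pullˡ (sym ρ-⊗) ⟩
      ρ⇒ ∘ (id ⊗₁ λ⇒) ∎

  fst-deterministic : ∀ {A B} → Deterministic (fst {A} {B})
  fst-deterministic =
    ∘-deterministic ρ-deterministic (⊗-deterministic id-deterministic discard-deterministic)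

  snd-deterministic : ∀ {A B} → Deterministic (snd {A} {B})
  snd-deterministic =
    ∘-deterministic λ-deterministic (⊗-deterministic discard-deterministic id-deterministic)

  σ-deterministic : ∀ {A B} → Deterministic (σ {A} {B})
  σ-deterministic =
    Deterministic-resp (sym σ-pair) (pair-deterministic snd-deterministic fst-deterministic)

  exchange-deterministic : ∀ {A B C} → Deterministic (exchange {A} {B} {C})
  exchange-deterministic =
    ∘-deterministic α-deterministic
      (∘-deterministic (⊗-deterministic σ-deterministic id-deterministic)
        (inverse-deterministic α-isoʳ α-isoˡ α-deterministic))

  -- Lets a mechanism that does not read the wire `A` be run without copying `A`.
  snd⊗id-copy : ∀ {A B} → (snd ⊗₁ id) ∘ copy {A ⊗₀ B} ≈ exchange ∘ (id ⊗₁ copy)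
  snd⊗id-copy = deterministic-unique
    (pair-deterministic snd-deterministic id-deterministic)
    (∘-deterministic exchange-deterministic (⊗-deterministic id-deterministic copy-deterministic))
    (trans fst-pair (sym (trans (pullˡ fst-exchange)
      (trans (pullʳ snd-⊗) (trans (pullˡ fst-copy) identityˡ)))))
    (trans snd-pair (sym (trans (pullˡ snd-exchange)
      (trans (sym id-⊗-∘) (trans (⊗-respʳ snd-copy) ⊗-id)))))

  -- Here `a` and `b` are two mechanisms that read the same wires `Z` and not each other's output.
  -- Either order equals the normal form in `both`, which makes three copies of `Z` at the start;
  -- the two normal forms agree up to `exchange` because copies are interchangeable.
  run-commute : ∀ {X Y Z} (a : Z ⇒ X) (b : Z ⇒ Y) →
    (((b ∘ snd) ⊗₁ id) ∘ copy) ∘ ((a ⊗₁ id) ∘ copy)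
      ≈ exchange ∘ ((((a ∘ snd) ⊗₁ id) ∘ copy) ∘ ((b ⊗₁ id) ∘ copy))
  run-commute a b = begin
    (((b ∘ snd) ⊗₁ id) ∘ copy) ∘ ((a ⊗₁ id) ∘ copy)
      ≈⟨ both a b ⟩
    exchange ∘ ((a ⊗₁ (b ⊗₁ id)) ∘ ((id ⊗₁ copy) ∘ copy))
      ≈⟨ ∘-respʳ (∘-respʳ exchange-copy) ⟨
    exchange ∘ ((a ⊗₁ (b ⊗₁ id)) ∘ (exchange ∘ ((id ⊗₁ copy) ∘ copy)))
      ≈⟨ ∘-respʳ (extendʳ exchange-natural) ⟨
    exchange ∘ (exchange ∘ ((b ⊗₁ (a ⊗₁ id)) ∘ ((id ⊗₁ copy) ∘ copy)))
      ≈⟨ ∘-respʳ (both b a) ⟨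
    exchange ∘ ((((a ∘ snd) ⊗₁ id) ∘ copy) ∘ ((b ⊗₁ id) ∘ copy)) ∎
    where
    both : ∀ {X Y Z} (a : Z ⇒ X) (b : Z ⇒ Y) →
      (((b ∘ snd) ⊗₁ id) ∘ copy) ∘ ((a ⊗₁ id) ∘ copy)
        ≈ exchange ∘ ((a ⊗₁ (b ⊗₁ id)) ∘ ((id ⊗₁ copy) ∘ copy))
    both a b = begin
      (((b ∘ snd) ⊗₁ id) ∘ copy) ∘ ((a ⊗₁ id) ∘ copy)
        ≈⟨ ∘-respˡ (trans (pushˡ ⊗-id-∘) (trans (∘-respʳ snd⊗id-copy)
             (extendʳ (trans (∘-respˡ (⊗-respʳ (sym ⊗-id))) (sym exchange-natural))))) ⟩
      (exchange ∘ ((id ⊗₁ (b ⊗₁ id)) ∘ (id ⊗₁ copy))) ∘ ((a ⊗₁ id) ∘ copy)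
        ≈⟨ pullʳ (pullʳ (extendʳ (trans (sym ⊗-∘) (trans (⊗-resp-≈ idsq (sym idsq)) ⊗-∘)))) ⟩
      exchange ∘ ((id ⊗₁ (b ⊗₁ id)) ∘ ((a ⊗₁ id) ∘ ((id ⊗₁ copy) ∘ copy)))
        ≈⟨ ∘-respʳ (pullˡ (sym ⊗-split′)) ⟩
      exchange ∘ ((a ⊗₁ (b ⊗₁ id)) ∘ ((id ⊗₁ copy) ∘ copy)) ∎

  fst-fst-α⇐ : ∀ {A B C} → fst ∘ (fst ∘ α⇐ {A} {B} {C}) ≈ fst
  fst-fst-α⇐ = trans (pullˡ (sym fst-α)) (cancelʳ α-isoʳ)

  snd-fst-α⇐ : ∀ {A B C} → snd ∘ (fst ∘ α⇐ {A} {B} {C}) ≈ fst ∘ snd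
  snd-fst-α⇐ = trans (pullˡ (trans (sym fst-⊗) (trans (∘-respʳ (sym snd-α)) (sym assoc))))
    (cancelʳ α-isoʳ)

  snd-α⇐ : ∀ {A B C} → snd ∘ α⇐ {A} {B} {C} ≈ snd ∘ snd
  snd-α⇐ = epi α-isoʳ (trans (cancelʳ α-isoˡ)
    (sym (trans (pullʳ snd-α) (trans snd-⊗ identityˡ))))

  epic-∘ : ∀ {X Y Z} {f : Y ⇒ Z} {g : X ⇒ Y} → Epic f → Epic g → Epic (f ∘ g)
  epic-∘ p q h k r = p h k (q _ _ (trans assoc (trans r (sym assoc))))

  split-epic : ∀ {X Y} {f : X ⇒ Y} {g : Y ⇒ X} → f ∘ g ≈ id → Epic f
  split-epic p h k = epi p

-- Selecting wires of a tensor product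

module TensorProperties {o ℓ e} (C : MarkovCategory o ℓ e) {T : Set}
                        (obj : T → MarkovCategory.Obj C) where
  open MarkovCategory C
  open Reasoning C
  open Coherence C
  open MarkovProperties C
  open Tensor C obj

  project-deterministic : ∀ {A x} (i : x ∈ₗ A) → Deterministic (project i)
  project-deterministic (here ≡.refl) = fst-deterministic
  project-deterministic (there i)     =
    ∘-deterministic λ-deterministic (⊗-deterministic discard-deterministic (project-deterministic i))

  project-there : ∀ {A x y} (i : x ∈ₗ A) → project (there {x = y} i) ≈ project i ∘ snd
  project-there i = trans (∘-respʳ ⊗-split′) (extendʳ λ-natural)

  select-deterministic : ∀ {A} B (B⊆A : B ⊆ₗ A) → Deterministic (select B B⊆A)
  select-deterministic []      B⊆A = discard-deterministic
  select-deterministic (x ∷ B) B⊆A =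
    pair-deterministic (project-deterministic (B⊆A (here ≡.refl))) (select-deterministic B _)

  ⨂-unique : ∀ A {X} {f g : X ⇒ ⨂ A} → Deterministic f → Deterministic g →
             (∀ {x} (i : x ∈ₗ A) → project i ∘ f ≈ project i ∘ g) → f ≈ g
  ⨂-unique []      p q r = unit-unique _ _
  ⨂-unique (x ∷ A) p q r = deterministic-unique p q (r (here ≡.refl))
    (⨂-unique A (∘-deterministic snd-deterministic p) (∘-deterministic snd-deterministic q)
      (λ i → trans (pullˡ (sym (project-there i)))
        (trans (r (there i)) (pushˡ (project-there i)))))

  project-select : ∀ {A} B (B⊆A : B ⊆ₗ A) {x} (i : x ∈ₗ B) →
                   project i ∘ select B B⊆A ≈ project (B⊆A i)
  project-select (x ∷ B) B⊆A (here ≡.refl) = fst-pair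
  project-select (x ∷ B) B⊆A (there i)     =
    trans (∘-respˡ (project-there i)) (trans (pullʳ snd-pair) (project-select B _ i))

  project-cong : ∀ {A} → Unique A → ∀ {x} (i j : x ∈ₗ A) → project i ≈ project j
  project-cong A! i j with unique⇒irrelevant A! i j
  ... | ≡.refl = refl

  -- The tool behind the equations between wirings below. As `A` has no repetitions, a position is
  -- determined by its variable, so it is enough that each output is some wire of `A`.
  select-unique : ∀ {A} → Unique A → ∀ B (B⊆A : B ⊆ₗ A) {f : ⨂ A ⇒ ⨂ B} → Deterministic f →
                  (∀ {x} (i : x ∈ₗ B) → Σ[ j ∈ x ∈ₗ A ] project i ∘ f ≈ project j) →
                  f ≈ select B B⊆A
  select-unique A! B B⊆A d p = ⨂-unique B d (select-deterministic B B⊆A) (λ i →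
    let j , eq = p i in
    trans eq (trans (project-cong A! j (B⊆A i)) (sym (project-select B B⊆A i))))

  select-id : ∀ {A} → Unique A → (A⊆A : A ⊆ₗ A) → select A A⊆A ≈ id
  select-id {A} A! A⊆A = sym (select-unique A! A A⊆A id-deterministic (λ i → i , identityʳ))

  -- The three inclusions are independent arguments, so that no equation between proofs of inclusion
  -- is ever needed.
  select-∘ : ∀ {A} → Unique A → ∀ B D (D⊆B : D ⊆ₗ B) (B⊆A : B ⊆ₗ A) (D⊆A : D ⊆ₗ A) →
             select D D⊆B ∘ select B B⊆A ≈ select D D⊆A
  select-∘ A! B D D⊆B B⊆A D⊆A = select-unique A! D D⊆A
    (∘-deterministic (select-deterministic D D⊆B) (select-deterministic B B⊆A))
    (λ i → B⊆A (D⊆B i) , trans (pullˡ (project-select D D⊆B i)) (project-select B B⊆A (D⊆B i)))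

  select-there : ∀ {A y} → Unique (y ∷ A) → ∀ B (B⊆A : B ⊆ₗ A) (B⊆yA : B ⊆ₗ y ∷ A) →
                 select B B⊆A ∘ snd ≈ select B B⊆yA
  select-there yA! B B⊆A B⊆yA = select-unique yA! B B⊆yA
    (∘-deterministic (select-deterministic B B⊆A) snd-deterministic)
    (λ i → there (B⊆A i) ,
      trans (pullˡ (project-select B B⊆A i)) (sym (project-there (B⊆A i))))

  id⊗select : ∀ {A y} → Unique (y ∷ A) → ∀ B (B⊆A : B ⊆ₗ A) (yB⊆yA : y ∷ B ⊆ₗ y ∷ A) →
              id ⊗₁ select B B⊆A ≈ select (y ∷ B) yB⊆yA
  id⊗select {y = y} yA! B B⊆A yB⊆yA = select-unique yA! (y ∷ B) yB⊆yA
    (⊗-deterministic id-deterministic (select-deterministic B B⊆A)) λ where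
      (here ≡.refl) → here ≡.refl , trans fst-⊗ identityˡ
      (there i)     → there (B⊆A i) , trans (∘-respˡ (project-there i)) (trans (pullʳ snd-⊗)
        (trans (pullˡ (project-select B B⊆A i)) (sym (project-there (B⊆A i)))))

  exchange-select : ∀ {A x y} → Unique (x ∷ y ∷ A) → (p : y ∷ x ∷ A ⊆ₗ x ∷ y ∷ A) →
                    exchange ≈ select (y ∷ x ∷ A) p
  exchange-select {A} {x} {y} xyA! p = select-unique xyA! (y ∷ x ∷ A) p exchange-deterministic λ where
    (here ≡.refl)         → there (here ≡.refl) ,
      trans fst-exchange (sym (project-there {A = y ∷ A} (here ≡.refl)))
    (there (here ≡.refl)) → here ≡.refl ,
      trans (∘-respˡ (project-there {A = x ∷ A} (here ≡.refl)))
        (trans (pullʳ snd-exchange) (trans fst-⊗ identityˡ))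
    (there (there i))     → there (there i) ,
      trans (∘-respˡ (trans (project-there {A = x ∷ A} (there i)) (∘-respˡ (project-there i))))
        (trans (pullʳ snd-exchange) (trans (pullʳ snd-⊗)
          (trans (pullˡ (sym (project-there i))) (sym (project-there {A = y ∷ A} (there i))))))

  project-++ˡ : ∀ A B {x} (i : x ∈ₗ A) → project i ∘ (fst ∘ ⨂-++⇐ A B) ≈ project (∈-++⁺ˡ i)
  project-++ˡ (y ∷ A) B (here ≡.refl) =
    trans (∘-respʳ (sym assoc)) (trans (pullˡ fst-fst-α⇐) (trans fst-⊗ identityˡ))
  project-++ˡ (y ∷ A) B (there i)     = begin
    project (there i) ∘ (fst ∘ (α⇐ ∘ (id ⊗₁ ⨂-++⇐ A B)))
      ≈⟨ trans (∘-respˡ (project-there i)) assoc ⟩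
    project i ∘ (snd ∘ (fst ∘ (α⇐ ∘ (id ⊗₁ ⨂-++⇐ A B))))
      ≈⟨ ∘-respʳ (trans (∘-respʳ (sym assoc)) (pullˡ snd-fst-α⇐)) ⟩
    project i ∘ ((fst ∘ snd) ∘ (id ⊗₁ ⨂-++⇐ A B))
      ≈⟨ ∘-respʳ (trans (pullʳ snd-⊗) (sym assoc)) ⟩
    project i ∘ ((fst ∘ ⨂-++⇐ A B) ∘ snd)
      ≈⟨ pullˡ (project-++ˡ A B i) ⟩
    project (∈-++⁺ˡ i) ∘ snd
      ≈⟨ project-there (∈-++⁺ˡ i) ⟨
    project (there (∈-++⁺ˡ i)) ∎

  project-++ʳ : ∀ A B {x} (i : x ∈ₗ B) → project i ∘ (snd ∘ ⨂-++⇐ A B) ≈ project (∈-++⁺ʳ A i)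
  project-++ʳ []      B i = trans (∘-respʳ snd-λ⇐) identityʳ
    where
    snd-λ⇐ : ∀ {X} → snd ∘ λ⇐ {X} ≈ id
    snd-λ⇐ = trans (∘-respˡ (trans (∘-respʳ (trans (⊗-respˡ (unit-unique _ _)) ⊗-id)) identityʳ)) λ-isoʳ
  project-++ʳ (y ∷ A) B i = begin
    project i ∘ (snd ∘ (α⇐ ∘ (id ⊗₁ ⨂-++⇐ A B)))
      ≈⟨ ∘-respʳ (trans (pullˡ snd-α⇐) (trans (pullʳ snd-⊗) (sym assoc))) ⟩
    project i ∘ ((snd ∘ ⨂-++⇐ A B) ∘ snd)
      ≈⟨ pullˡ (project-++ʳ A B i) ⟩
    project (∈-++⁺ʳ A i) ∘ snd
      ≈⟨ project-there (∈-++⁺ʳ A i) ⟨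
    project (there (∈-++⁺ʳ A i)) ∎

  select-++ˡ : ∀ A B → (A⊆ : A ⊆ₗ A ++ B) → Unique (A ++ B) → Deterministic (⨂-++⇐ A B) →
               fst ∘ ⨂-++⇐ A B ≈ select A A⊆
  select-++ˡ A B A⊆ u d = select-unique u A A⊆ (∘-deterministic fst-deterministic d)
    (λ i → ∈-++⁺ˡ i , project-++ˡ A B i)

  select-++ʳ : ∀ A B → (B⊆ : B ⊆ₗ A ++ B) → Unique (A ++ B) → Deterministic (⨂-++⇐ A B) →
               snd ∘ ⨂-++⇐ A B ≈ select B B⊆
  select-++ʳ A B B⊆ u d = select-unique u B B⊆ (∘-deterministic snd-deterministic d)
    (λ i → ∈-++⁺ʳ A i , project-++ʳ A B i)

-- Coherence for permutations

module DiagramProperties (Q : Signature) where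
  open Signature Q
  open Diagrams Q hiding (Free)
  open Reasoning (Free Q) hiding (refl; sym; trans)
  open Coherence (Free Q) using (id-deterministic; ∘-deterministic; ⊗-deterministic)
  open MarkovCategory (Free Q) using (Deterministic)
  open MarkovProperties (Free Q)

  -- Meant for `⊗-assoc` when the lists of the first factor have length at most one: `++-assoc` then
  -- computes to `refl` and both associators to `id`.
  strict : ∀ {A B} {f g : Diagram A B} → id ∘ f ≈ g ∘ id → f ≈ g
  strict p = trans (sym identityˡ) (trans p identityʳ)

  wire : ∀ {A x} → x ∈ₗ A → Diagram A (x ∷ [])
  wire {x ∷ A} (here ≡.refl) = id {x ∷ []} ⊗ discard A
  wire {y ∷ A} (there i)     = discard (y ∷ []) ⊗ wire i

  wire-there : ∀ {A x y} (i : x ∈ₗ A) → wire (there {x = y} i) ≈ wire i ∘ snd {y ∷ []} {A}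
  wire-there i = trans ⊗-split′ (trans (∘-resp-≈ ⊗-unitˡ refl) (∘-resp-≈ refl (sym identityˡ)))

  wire-unique : ∀ A {X} {f g : Diagram X A} → Deterministic f → Deterministic g →
                (∀ {x} (i : x ∈ₗ A) → wire i ∘ f ≈ wire i ∘ g) → f ≈ g
  wire-unique []      p q r = unit-unique _ _
  wire-unique (x ∷ A) p q r =
    deterministic-unique {A = x ∷ []} {B = A} p q
      (trans (∘-resp-≈ identityˡ refl) (trans (r (here ≡.refl)) (∘-resp-≈ (sym identityˡ) refl)))
      (wire-unique A
        (∘-deterministic (snd-deterministic {x ∷ []} {A}) p)
        (∘-deterministic (snd-deterministic {x ∷ []} {A}) q)
        (λ i → trans (pullˡ (sym (wire-there i))) (trans (r (there i)) (pushˡ (wire-there i)))))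

  permute-deterministic : ∀ {A B} (p : A ↭ B) → Deterministic (permute p)
  permute-deterministic {A} _↭_.refl = id-deterministic {A}
  permute-deterministic (_↭_.prep x p)   =
    ⊗-deterministic {f = id {x ∷ []}} (id-deterministic {x ∷ []}) (permute-deterministic p)
  permute-deterministic (_↭_.swap x y p) =
    ⊗-deterministic {f = σ (x ∷ []) (y ∷ [])} (σ-deterministic {x ∷ []} {y ∷ []}) (permute-deterministic p)
  permute-deterministic (_↭_.trans p q)  =
    ∘-deterministic (permute-deterministic q) (permute-deterministic p)

  -- Only the existence of a position is claimed. Without repetitions it is determined by the
  -- variable, so the action of a permutation on positions is never computed.
  wire-permute : ∀ {A B} (p : A ↭ B) {x} (i : x ∈ₗ B) →
                 Σ[ j ∈ x ∈ₗ A ] wire i ∘ permute p ≈ wire j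
  wire-permute _↭_.refl i = i , identityʳ
  wire-permute (_↭_.prep x p) (here ≡.refl) =
    here ≡.refl , trans (sym ⊗-∘) (⊗-resp-≈ identityˡ (unit-unique _ _))
  wire-permute (_↭_.prep x p) (there i) with wire-permute p i
  ... | j , eq = there j , trans (sym ⊗-∘) (⊗-resp-≈ identityʳ eq)
  wire-permute (_↭_.swap {A} {B} x y p) (here ≡.refl) = there (here ≡.refl) , (begin
    (id {y ∷ []} ⊗ discard (x ∷ B)) ∘ (σ (x ∷ []) (y ∷ []) ⊗ permute p)
      ≈⟨ ∘-resp-≈ (trans (⊗-resp-≈ refl (unit-unique _ (discard (x ∷ []) ⊗ discard B)))
           (sym (strict ⊗-assoc))) refl ⟩
    ((id {y ∷ []} ⊗ discard (x ∷ [])) ⊗ discard B) ∘ (σ (x ∷ []) (y ∷ []) ⊗ permute p)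
      ≈⟨ sym ⊗-∘ ⟩
    ((id {y ∷ []} ⊗ discard (x ∷ [])) ∘ σ (x ∷ []) (y ∷ [])) ⊗ (discard B ∘ permute p)
      ≈⟨ ⊗-resp-≈ (trans (∘-resp-≈ (sym identityˡ) refl)
           (trans (fst-σ {x ∷ []} {y ∷ []}) identityˡ)) (unit-unique _ _) ⟩
    (discard (x ∷ []) ⊗ id {y ∷ []}) ⊗ discard A
      ≈⟨ strict ⊗-assoc ⟩
    discard (x ∷ []) ⊗ (id {y ∷ []} ⊗ discard A) ∎)
  wire-permute (_↭_.swap {A} {B} x y p) (there (here ≡.refl)) = here ≡.refl , (begin
    (discard (y ∷ []) ⊗ (id {x ∷ []} ⊗ discard B)) ∘ (σ (x ∷ []) (y ∷ []) ⊗ permute p)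
      ≈⟨ ∘-resp-≈ (sym (strict ⊗-assoc)) refl ⟩
    ((discard (y ∷ []) ⊗ id {x ∷ []}) ⊗ discard B) ∘ (σ (x ∷ []) (y ∷ []) ⊗ permute p)
      ≈⟨ sym ⊗-∘ ⟩
    ((discard (y ∷ []) ⊗ id {x ∷ []}) ∘ σ (x ∷ []) (y ∷ [])) ⊗ (discard B ∘ permute p)
      ≈⟨ ⊗-resp-≈ (trans (∘-resp-≈ (sym identityˡ) refl)
           (trans (snd-σ {x ∷ []} {y ∷ []}) identityˡ)) (unit-unique _ _) ⟩
    (id {x ∷ []} ⊗ discard (y ∷ [])) ⊗ discard A
      ≈⟨ trans (strict ⊗-assoc) (⊗-resp-≈ refl (unit-unique _ (discard (y ∷ A)))) ⟩
    id {x ∷ []} ⊗ discard (y ∷ A) ∎)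
  wire-permute (_↭_.swap {A} {B} x y p) (there (there i)) with wire-permute p i
  ... | j , eq = there (there j) , (begin
    (discard (y ∷ []) ⊗ (discard (x ∷ []) ⊗ wire i)) ∘ (σ (x ∷ []) (y ∷ []) ⊗ permute p)
      ≈⟨ ∘-resp-≈ (sym (strict ⊗-assoc)) refl ⟩
    ((discard (y ∷ []) ⊗ discard (x ∷ [])) ⊗ wire i) ∘ (σ (x ∷ []) (y ∷ []) ⊗ permute p)
      ≈⟨ sym ⊗-∘ ⟩
    ((discard (y ∷ []) ⊗ discard (x ∷ [])) ∘ σ (x ∷ []) (y ∷ [])) ⊗ (wire i ∘ permute p)
      ≈⟨ ⊗-resp-≈ (unit-unique _ _) eq ⟩
    (discard (x ∷ []) ⊗ discard (y ∷ [])) ⊗ wire j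
      ≈⟨ strict ⊗-assoc ⟩
    discard (x ∷ []) ⊗ (discard (y ∷ []) ⊗ wire j) ∎)
  wire-permute (_↭_.trans p q) i with wire-permute q i
  ... | j , eq with wire-permute p j
  ...   | k , eq′ = k , trans (pullˡ eq) eq′

  permute-coherent : ∀ {A B} → Unique A → (p q : A ↭ B) → permute p ≈ permute q
  permute-coherent {A} {B} A! p q =
    wire-unique B (permute-deterministic p) (permute-deterministic q) same
    where
    same : ∀ {x} (i : x ∈ₗ B) → wire i ∘ permute p ≈ wire i ∘ permute q
    same i with wire-permute p i | wire-permute q i
    ... | j , eq | k , eq′ with unique⇒irrelevant A! j k
    ...   | ≡.refl = trans eq (sym eq′)

  permute-isoˡ : ∀ {A B} (p : A ↭ B) → permute (↭-sym p) ∘ permute p ≈ id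
  permute-isoˡ p =
    ≡.subst (λ q → permute (↭-sym p) ∘ permute q ≈ id) (↭-sym-involutive p) (permute-isoʳ (↭-sym p))

  permute-reflexive : ∀ {A B} (eq : A ≡ B) → permute (↭-reflexive eq) ≈ cast eq
  permute-reflexive ≡.refl = refl

  permute-++⁺ˡ : ∀ A {B B′} (p : B ↭ B′) → permute (++⁺ˡ A p) ≈ id {A} ⊗ permute p
  permute-++⁺ˡ []      p = sym ⊗-unitˡ
  permute-++⁺ˡ (x ∷ A) p =
    trans (⊗-resp-≈ refl (permute-++⁺ˡ A p)) (trans (sym (strict ⊗-assoc)) (⊗-resp-≈ ⊗-id refl))

  permute-++⁺ʳ : ∀ {A A′} B (p : A ↭ A′) → permute (++⁺ʳ B p) ≈ permute p ⊗ id {B}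
  permute-++⁺ʳ B _↭_.refl         = sym ⊗-id
  permute-++⁺ʳ B (_↭_.prep x p)   =
    trans (⊗-resp-≈ refl (permute-++⁺ʳ B p)) (sym (strict ⊗-assoc))
  permute-++⁺ʳ B (_↭_.swap x y p) =
    trans (⊗-resp-≈ refl (permute-++⁺ʳ B p)) (sym (strict ⊗-assoc))
  permute-++⁺ʳ B (_↭_.trans p q)  =
    trans (∘-resp-≈ (permute-++⁺ʳ B q) (permute-++⁺ʳ B p)) (sym ⊗-id-∘)

  permute-++⁺ : ∀ {A A′ B B′} (p : A ↭ A′) (q : B ↭ B′) → permute (++⁺ p q) ≈ permute p ⊗ permute q
  permute-++⁺ {A} {A′} {B} p q =
    trans (∘-resp-≈ (permute-++⁺ˡ A′ q) (permute-++⁺ʳ B p)) (sym ⊗-split′)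

-- Interpretation of permutations and projections

module InterpretationProperties {o ℓ e} (Q : Signature) (C : MarkovCategory o ℓ e)
    (obj : Signature.Type Q → MarkovCategory.Obj C)
    (channel : (q : Signature.Query Q) → MarkovCategory._⇒_ C
                 (Tensor.⨂ C obj (Signature.dom Q q)) (Tensor.⨂ C obj (Signature.cod Q q))) where
  private
    module D = Diagrams Q
    module DP = DiagramProperties Q
  open Signature Q
  open MarkovCategory C
  open Reasoning C
  open Coherence C
  open MarkovProperties C
  open TensorProperties C obj
  open Interpretation Q C obj channel
  open MarkovFunctor functor using (φ-isoˡ; φ-isoʳ; φ-natural; F-resp-≈)

  ⨂-∷⇒ : ∀ x A → ⨂-++⇒ (x ∷ []) A ≈ ρ⇒ ⊗₁ id
  ⨂-∷⇒ x A = triangle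

  ⟦id⊗⟧ : ∀ x {A B} (f : D.Diagram A B) → ⟦ D.id {x ∷ []} D.⊗ f ⟧ ≈ id ⊗₁ ⟦ f ⟧
  ⟦id⊗⟧ x {A} {B} f = epi (φ-isoʳ (x ∷ []) A) (begin
    ⟦ D.id {x ∷ []} D.⊗ f ⟧ ∘ ⨂-++⇒ (x ∷ []) A ≈⟨ φ-natural (D.id {x ∷ []}) f ⟩
    ⨂-++⇒ (x ∷ []) B ∘ (id ⊗₁ ⟦ f ⟧)           ≈⟨ ∘-respˡ (⨂-∷⇒ x B) ⟩
    (ρ⇒ ⊗₁ id) ∘ (id ⊗₁ ⟦ f ⟧)                 ≈⟨ trans (sym ⊗-split) ⊗-split′ ⟩
    (id ⊗₁ ⟦ f ⟧) ∘ (ρ⇒ ⊗₁ id)                 ≈⟨ ∘-respʳ (⨂-∷⇒ x A) ⟨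
    (id ⊗₁ ⟦ f ⟧) ∘ ⨂-++⇒ (x ∷ []) A           ∎)

  ⨂-∷∷⇒ : ∀ x y A → ⨂-++⇒ (x ∷ y ∷ []) A ∘ (⨂-++⇒ (x ∷ []) (y ∷ []) ⊗₁ id) ≈ (ρ⇒ ⊗₁ (ρ⇒ ⊗₁ id)) ∘ α⇒
  ⨂-∷∷⇒ x y A = begin
    ((id ⊗₁ ⨂-++⇒ (y ∷ []) A) ∘ α⇒) ∘ (⨂-++⇒ (x ∷ []) (y ∷ []) ⊗₁ id)
      ≈⟨ ∘-resp-≈ (∘-respˡ (⊗-respʳ (⨂-∷⇒ y A))) (⊗-respˡ (⨂-∷⇒ x (y ∷ []))) ⟩
    ((id ⊗₁ (ρ⇒ ⊗₁ id)) ∘ α⇒) ∘ ((ρ⇒ ⊗₁ id) ⊗₁ id)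
      ≈⟨ pullʳ α-naturalᵈ ⟩
    (id ⊗₁ (ρ⇒ ⊗₁ id)) ∘ ((ρ⇒ ⊗₁ id) ∘ α⇒)
      ≈⟨ pullˡ (sym ⊗-split′) ⟩
    (ρ⇒ ⊗₁ (ρ⇒ ⊗₁ id)) ∘ α⇒ ∎

  -- The content lies in the swap case. Diagrams cross two one-element lists, each interpreted with
  -- a trailing unit, whereas `Tensor.permute` uses `exchange`. Precomposing with the structure
  -- isomorphisms turns the trailing units into `ρ⇒`, and these slide past `exchange`.
  ⟦permute⟧ : ∀ {A B} (p : A ↭ B) → ⟦ D.permute p ⟧ ≈ permute p
  ⟦permute⟧ _↭_.refl         = refl
  ⟦permute⟧ (_↭_.prep x p)   = trans (⟦id⊗⟧ x (D.permute p)) (⊗-respʳ (⟦permute⟧ p))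
  ⟦permute⟧ (_↭_.swap {A} {B} x y p) =
    epi (∘-iso (φ-isoʳ (x ∷ y ∷ []) A) (⊗-iso (φ-isoʳ (x ∷ []) (y ∷ [])) identityˡ)) (begin
    ⟦ D.σ (x ∷ []) (y ∷ []) D.⊗ D.permute p ⟧ ∘ (⨂-++⇒ (x ∷ y ∷ []) A ∘ (⨂-++⇒ (x ∷ []) (y ∷ []) ⊗₁ id))
      ≈⟨ extendʳ (φ-natural (D.σ (x ∷ []) (y ∷ [])) (D.permute p)) ⟩
    ⨂-++⇒ (y ∷ x ∷ []) B ∘
      ((⟦ D.σ (x ∷ []) (y ∷ []) ⟧ ⊗₁ ⟦ D.permute p ⟧) ∘ (⨂-++⇒ (x ∷ []) (y ∷ []) ⊗₁ id))
      ≈⟨ ∘-respʳ (glue-⊗ (MarkovFunctor.φ-σ functor (x ∷ []) (y ∷ [])) (trans (∘-respˡ (⟦permute⟧ p)) (sym idsq))) ⟩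
    ⨂-++⇒ (y ∷ x ∷ []) B ∘ ((⨂-++⇒ (y ∷ []) (x ∷ []) ⊗₁ id) ∘ (σ ⊗₁ permute p))
      ≈⟨ pullˡ (⨂-∷∷⇒ y x B) ⟩
    ((ρ⇒ ⊗₁ (ρ⇒ ⊗₁ id)) ∘ α⇒) ∘ (σ ⊗₁ permute p)
      ≈⟨ pullʳ (trans (∘-respʳ ⊗-split′) (extendʳ α-naturalᵘ)) ⟩
    (ρ⇒ ⊗₁ (ρ⇒ ⊗₁ id)) ∘ ((id ⊗₁ (id ⊗₁ permute p)) ∘ (α⇒ ∘ (σ ⊗₁ id)))
      ≈⟨ extendʳ (glue-⊗ (sym idsq) (glue-⊗ (sym idsq) idsq)) ⟩
    (id ⊗₁ (id ⊗₁ permute p)) ∘ ((ρ⇒ ⊗₁ (ρ⇒ ⊗₁ id)) ∘ (α⇒ ∘ (σ ⊗₁ id)))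
      ≈⟨ ∘-respʳ (∘-respʳ exchange-α) ⟨
    (id ⊗₁ (id ⊗₁ permute p)) ∘ ((ρ⇒ ⊗₁ (ρ⇒ ⊗₁ id)) ∘ (exchange ∘ α⇒))
      ≈⟨ ∘-respʳ (extendʳ exchange-natural) ⟨
    (id ⊗₁ (id ⊗₁ permute p)) ∘ (exchange ∘ ((ρ⇒ ⊗₁ (ρ⇒ ⊗₁ id)) ∘ α⇒))
      ≈⟨ assoc ⟨
    ((id ⊗₁ (id ⊗₁ permute p)) ∘ exchange) ∘ ((ρ⇒ ⊗₁ (ρ⇒ ⊗₁ id)) ∘ α⇒)
      ≈⟨ ∘-respʳ (⨂-∷∷⇒ x y A) ⟨
    ((id ⊗₁ (id ⊗₁ permute p)) ∘ exchange) ∘ (⨂-++⇒ (x ∷ y ∷ []) A ∘ (⨂-++⇒ (x ∷ []) (y ∷ []) ⊗₁ id)) ∎)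
  ⟦permute⟧ (_↭_.trans p q)  = ∘-resp-≈ (⟦permute⟧ q) (⟦permute⟧ p)

  ⟦wire⟧ : ∀ {A x} (i : x ∈ₗ A) → ρ⇒ ∘ ⟦ DP.wire i ⟧ ≈ project i
  ⟦wire⟧ {x ∷ A} (here ≡.refl) = ∘-respʳ (⟦id⊗⟧ x (D.discard A))
  ⟦wire⟧ {y ∷ A} {x} (there i)     = epi (φ-isoʳ (y ∷ []) A) (begin
    (ρ⇒ ∘ ⟦ D.discard (y ∷ []) D.⊗ DP.wire i ⟧) ∘ ⨂-++⇒ (y ∷ []) A
      ≈⟨ pullʳ (φ-natural (D.discard (y ∷ [])) (DP.wire i)) ⟩
    ρ⇒ ∘ (λ⇒ ∘ (discard ⊗₁ ⟦ DP.wire i ⟧))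
      ≈⟨ ∘-respʳ (trans (∘-respʳ ⊗-split′) (extendʳ λ-natural)) ⟩
    ρ⇒ ∘ (⟦ DP.wire i ⟧ ∘ (λ⇒ ∘ (discard ⊗₁ id)))
      ≈⟨ pullˡ (⟦wire⟧ i) ⟩
    project i ∘ snd
      ≈⟨ ∘-respʳ (trans (sym identityˡ) (sym (snd-⊗ {f = ρ⇒}))) ⟩
    project i ∘ (snd ∘ (ρ⇒ ⊗₁ id))
      ≈⟨ pullˡ (sym (project-there i)) ⟩
    project (there i) ∘ (ρ⇒ ⊗₁ id)
      ≈⟨ ∘-respʳ (⨂-∷⇒ y A) ⟨
    project (there i) ∘ ⨂-++⇒ (y ∷ []) A ∎)

  -- Transferred from the free category along the interpretation, which avoids repeating the case
  -- analysis of `wire-permute`.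
  project-permute : ∀ {A B} (p : A ↭ B) {x} (i : x ∈ₗ B) →
                    Σ[ j ∈ x ∈ₗ A ] project i ∘ permute p ≈ project j
  project-permute p i with DP.wire-permute p i
  ... | j , eq = j , (begin
    project i ∘ permute p                      ≈⟨ ∘-resp-≈ (⟦wire⟧ i) (⟦permute⟧ p) ⟨
    (ρ⇒ ∘ ⟦ DP.wire i ⟧) ∘ ⟦ D.permute p ⟧     ≈⟨ pullʳ (F-resp-≈ eq) ⟩
    ρ⇒ ∘ ⟦ DP.wire j ⟧                         ≈⟨ ⟦wire⟧ j ⟩
    project j                                  ∎)

  permute-deterministic : ∀ {A B} (p : A ↭ B) → Deterministic (permute p)
  permute-deterministic p =
    Deterministic-resp (⟦permute⟧ p) (F-deterministic functor (DP.permute-deterministic p))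

  permute-select : ∀ {A} → Unique A → ∀ {B} (p : A ↭ B) (B⊆A : B ⊆ₗ A) → permute p ≈ select B B⊆A
  permute-select A! {B} p B⊆A =
    select-unique A! B B⊆A (permute-deterministic p) (project-permute p)

  permute-coherent : ∀ {A B} → Unique A → (p q : A ↭ B) → permute p ≈ permute q
  permute-coherent A! p q =
    trans (sym (⟦permute⟧ p)) (trans (F-resp-≈ (DP.permute-coherent A! p q)) (⟦permute⟧ q))

  permute-isoˡ : ∀ {A B} (p : A ↭ B) → permute (↭-sym p) ∘ permute p ≈ id
  permute-isoˡ p =
    trans (∘-resp-≈ (sym (⟦permute⟧ (↭-sym p))) (sym (⟦permute⟧ p))) (F-resp-≈ (DP.permute-isoˡ p))

  permute-isoʳ : ∀ {A B} (p : A ↭ B) → permute p ∘ permute (↭-sym p) ≈ id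
  permute-isoʳ p =
    trans (∘-resp-≈ (sym (⟦permute⟧ p)) (sym (⟦permute⟧ (↭-sym p)))) (F-resp-≈ (D.permute-isoʳ p))

  permute-++⁺ : ∀ {A A′ B B′} (p : A ↭ A′) (q : B ↭ B′) →
    permute (++⁺ p q) ∘ ⨂-++⇒ A B ≈ ⨂-++⇒ A′ B′ ∘ (permute p ⊗₁ permute q)
  permute-++⁺ p q = trans
    (∘-respˡ (trans (sym (⟦permute⟧ (++⁺ p q))) (F-resp-≈ (DP.permute-++⁺ p q))))
    (trans (φ-natural (D.permute p) (D.permute q)) (∘-respʳ (⊗-resp-≈ (⟦permute⟧ p) (⟦permute⟧ q))))

-- Schedules

drop-here : ∀ {T : Set} {A : List T} {x y} → y ∈ₗ x ∷ A → y ≢ x → y ∈ₗ A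
drop-here (here e)  y≢x = contradiction e y≢x
drop-here (there i) y≢x = i

module ScheduleProperties {o ℓ e} {C : MarkovCategory o ℓ e} (M : CausalModel C) where
  open MarkovCategory C
  open Reasoning C
  open Coherence C
  open MarkovProperties C
  open CausalModel M
  open TensorProperties C obj
  open DecMembership {A = Vertex} Fin._≟_ using () renaming (_∈?_ to _∈ₗ?_)

  schedule-⊆ : ∀ {Γ Δ} → Schedule Γ Δ → Γ ⊆ₗ Δ
  schedule-⊆ start           i = i
  schedule-⊆ (run s _ _ _ _) i = there (schedule-⊆ s i)

  schedule-unique : ∀ {Γ Δ} → Unique Γ → Schedule Γ Δ → Unique Δ
  schedule-unique Γ! start            = Γ!
  schedule-unique Γ! (run s x _ x∉ _) = ¬Any⇒All¬ _ x∉ ∷ schedule-unique Γ! s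

  schedule-closed : ∀ {Γ Δ} → Schedule Γ Δ → ∀ {y} → y ∈ₗ Δ →
                    y ∈ₗ Γ ⊎ elements (parents y) ⊆ₗ Δ
  schedule-closed start              i             = inj₁ i
  schedule-closed (run s x _ _ pa⊆)  (here ≡.refl) = inj₂ (there ∘′ pa⊆)
  schedule-closed (run s x _ _ pa⊆)  (there i) with schedule-closed s i
  ... | inj₁ j = inj₁ j
  ... | inj₂ p = inj₂ (there ∘′ p)

  -- A computed variable outside `Γ` has a path to `O`, hence to `O′`. Following the path backwards
  -- stays among the variables computed by `E′`, since these contain their parents, except for
  -- members of `Γ`; those are inputs and have no parents.
  evaluation-monotone : ∀ {Γ O O′} → Γ ⊆ₗ elements inputs → O ⊆ₗ O′ →
    (E : Evaluation Γ O) (E′ : Evaluation Γ O′) →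
    Evaluation.computed E ⊆ₗ Evaluation.computed E′
  evaluation-monotone {Γ} Γ⊆ O⊆ E E′ i with Evaluation.relevant E i
  ... | inj₁ j             = schedule-⊆ (Evaluation.schedule E′) j
  ... | inj₂ (_ , o∈ , path) = ancestors path (Evaluation.complete E′ (O⊆ o∈))
    where
    ancestors : ∀ {x y} → Star Edge x y → y ∈ₗ Evaluation.computed E′ → x ∈ₗ Evaluation.computed E′
    ancestors ε         j = j
    ancestors (e ◅ path) j with schedule-closed (Evaluation.schedule E′) (ancestors path j)
    ... | inj₁ k = ⊥-elim (inputs-parentless (∈-elements⁻ (Γ⊆ k)) (_ , e))
    ... | inj₂ p = p (∈-elements⁺ e)

  -- A schedule equivalent to `s` in which the run of `x` is postponed to the end. The order of the
  -- wires changes, so the two agree only up to a `select`.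
  record RunLast {Γ Δ} (s : Schedule Γ Δ) (x : Vertex) : Set e where
    field
      {rest}  : List Vertex
      before  : Schedule Γ rest
      x∉in    : x ∉ inputs
      x∉rest  : x ∉ₗ rest
      pa⊆rest : elements (parents x) ⊆ₗ rest
      Δ⊆      : Δ ⊆ₗ x ∷ rest
      rest⊆   : rest ⊆ₗ Δ
      same    : ⟦ s ⟧ˢ ≈ select Δ Δ⊆ ∘ ⟦ run before x x∉in x∉rest pa⊆rest ⟧ˢ

  select-pair : ∀ {Δ Δ′ X} (f : ⨂ Δ ⇒ X) (Δ⊆ : Δ ⊆ₗ Δ′) →
    ((f ⊗₁ id) ∘ copy) ∘ select Δ Δ⊆ ≈ (id ⊗₁ select Δ Δ⊆) ∘ (((f ∘ select Δ Δ⊆) ⊗₁ id) ∘ copy)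
  select-pair {Δ} f Δ⊆ = begin
    ((f ⊗₁ id) ∘ copy) ∘ select Δ Δ⊆
      ≈⟨ pullʳ (select-deterministic Δ Δ⊆) ⟩
    (f ⊗₁ id) ∘ ((select Δ Δ⊆ ⊗₁ select Δ Δ⊆) ∘ copy)
      ≈⟨ pullˡ (trans (sym ⊗-∘) (trans (⊗-respʳ identityˡ) ⊗-split′)) ⟩
    ((id ⊗₁ select Δ Δ⊆) ∘ ((f ∘ select Δ Δ⊆) ⊗₁ id)) ∘ copy
      ≈⟨ assoc ⟩
    (id ⊗₁ select Δ Δ⊆) ∘ (((f ∘ select Δ Δ⊆) ⊗₁ id) ∘ copy) ∎

  -- If `s` ends with some other `y`, then `x` is first moved to the end of the schedule before `y`.
  -- The two runs then commute: `x` is not a parent of `y` because it is childless, and `y` is not a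
  -- parent of `x` because the parents of `x` are available before `y` is run.
  run-last : ∀ {Γ} → Unique Γ → ∀ {Δ} (s : Schedule Γ Δ) {x} → x ∈ₗ Δ → x ∉ₗ Γ →
             (∀ {y} → y ∈ₗ Δ → y ∉ₗ Γ → ¬ Edge x y) → RunLast s x
  run-last Γ! start i x∉Γ childless = contradiction i x∉Γ
  run-last Γ! s@(run s₁ x x∉in x∉Δ₁ pa⊆) (here ≡.refl) x∉Γ childless = record
    { before = s₁ ; x∉in = x∉in ; x∉rest = x∉Δ₁ ; pa⊆rest = pa⊆
    ; Δ⊆ = λ i → i ; rest⊆ = there
    ; same = sym (trans (∘-respˡ (select-id (schedule-unique Γ! s) (λ i → i))) identityˡ)
    }
  run-last {Γ} Γ! s@(run {Δ₁} s₁ y y∉in y∉Δ₁ pa⊆) {x} (there i) x∉Γ childless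
    with run-last Γ! s₁ i x∉Γ (λ j → childless (there j))
  ... | record { rest = Δ₀ ; before = s₀ ; x∉in = x∉in ; x∉rest = x∉Δ₀ ; pa⊆rest = pax⊆
               ; Δ⊆ = Δ₁⊆ ; rest⊆ = Δ₀⊆ ; same = same } = record
    { before  = s₀′
    ; x∉in    = x∉in
    ; x∉rest  = x∉yΔ₀
    ; pa⊆rest = there ∘′ pax⊆
    ; Δ⊆      = Δ⊆
    ; rest⊆   = ∷⁺ʳ y Δ₀⊆
    ; same    = same′
    }
    where
    x≢y : x ≢ y
    x≢y ≡.refl = y∉Δ₁ i

    ¬x→y : ¬ Edge x y
    ¬x→y = childless (here ≡.refl) (λ j → y∉Δ₁ (schedule-⊆ s₁ j))

    pay⊆ : elements (parents y) ⊆ₗ Δ₀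
    pay⊆ j = drop-here (Δ₁⊆ (pa⊆ j)) λ { ≡.refl → ¬x→y (∈-elements⁻ j) }

    y∉Δ₀ : y ∉ₗ Δ₀
    y∉Δ₀ j = y∉Δ₁ (Δ₀⊆ j)

    x∉yΔ₀ : x ∉ₗ y ∷ Δ₀
    x∉yΔ₀ (here e)  = x≢y e
    x∉yΔ₀ (there j) = x∉Δ₀ j

    s₀′ : Schedule Γ (y ∷ Δ₀)
    s₀′ = run s₀ y y∉in y∉Δ₀ pay⊆

    xyΔ₀! : Unique (x ∷ y ∷ Δ₀)
    xyΔ₀! = schedule-unique Γ! (run s₀′ x x∉in x∉yΔ₀ (there ∘′ pax⊆))

    xΔ₀! : Unique (x ∷ Δ₀)
    xΔ₀! = schedule-unique Γ! (run s₀ x x∉in x∉Δ₀ pax⊆)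

    yΔ₀! : Unique (y ∷ Δ₀)
    yΔ₀! = schedule-unique Γ! s₀′

    yxΔ₀! : Unique (y ∷ x ∷ Δ₀)
    yxΔ₀! = ¬Any⇒All¬ _ y∉xΔ₀ ∷ xΔ₀!
      where
      y∉xΔ₀ : y ∉ₗ x ∷ Δ₀
      y∉xΔ₀ (here e)  = x≢y (≡.sym e)
      y∉xΔ₀ (there j) = y∉Δ₀ j

    swap⊆ : y ∷ x ∷ Δ₀ ⊆ₗ x ∷ y ∷ Δ₀
    swap⊆ = ∈-resp-↭ (_↭_.swap y x _↭_.refl)

    Δ⊆ : y ∷ Δ₁ ⊆ₗ x ∷ y ∷ Δ₀
    Δ⊆ = swap⊆ ∘′ ∷⁺ʳ y Δ₁⊆

    a : ⨂ Δ₀ ⇒ obj x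
    a = mechanism x x∉in ∘ select _ pax⊆

    b : ⨂ Δ₀ ⇒ obj y
    b = mechanism y y∉in ∘ select _ pay⊆

    sel : ⨂ (x ∷ Δ₀) ⇒ ⨂ Δ₁
    sel = select Δ₁ Δ₁⊆

    my : ⨂ Δ₁ ⇒ obj y
    my = mechanism y y∉in ∘ select _ pa⊆

    same′ : ⟦ s ⟧ˢ ≈ select (y ∷ Δ₁) Δ⊆ ∘ ⟦ run s₀′ x x∉in x∉yΔ₀ (there ∘′ pax⊆) ⟧ˢ
    same′ = begin
      (my ⊗₁ id) ∘ (copy ∘ ⟦ s₁ ⟧ˢ)
        ≈⟨ trans (sym assoc) (∘-respʳ same) ⟩
      ((my ⊗₁ id) ∘ copy) ∘ (sel ∘ ((a ⊗₁ id) ∘ (copy ∘ ⟦ s₀ ⟧ˢ)))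
        ≈⟨ extendʳ (select-pair my Δ₁⊆) ⟩
      (id ⊗₁ sel) ∘ ((((my ∘ sel) ⊗₁ id) ∘ copy) ∘ ((a ⊗₁ id) ∘ (copy ∘ ⟦ s₀ ⟧ˢ)))
        -- Since `y` does not read `x`, its mechanism factors through `snd`, the form that
        -- `run-commute` requires.
        ≈⟨ ∘-respʳ (∘-resp-≈ (∘-respˡ (⊗-respˡ my-sel)) (sym assoc)) ⟩
      (id ⊗₁ sel) ∘ ((((b ∘ snd) ⊗₁ id) ∘ copy) ∘ (((a ⊗₁ id) ∘ copy) ∘ ⟦ s₀ ⟧ˢ))
        ≈⟨ ∘-respʳ (trans (pullˡ (run-commute a b)) (trans assoc (∘-respʳ assoc))) ⟩
      (id ⊗₁ sel) ∘ (exchange ∘ ((((a ∘ snd) ⊗₁ id) ∘ copy) ∘ (((b ⊗₁ id) ∘ copy) ∘ ⟦ s₀ ⟧ˢ)))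
        ≈⟨ pullˡ rearrange ⟩
      select (y ∷ Δ₁) Δ⊆ ∘ ((((a ∘ snd) ⊗₁ id) ∘ copy) ∘ (((b ⊗₁ id) ∘ copy) ∘ ⟦ s₀ ⟧ˢ))
        ≈⟨ ∘-respʳ (trans (∘-resp-≈ (∘-respˡ (⊗-respˡ ma-sel)) assoc) assoc) ⟩
      select (y ∷ Δ₁) Δ⊆ ∘ ⟦ run s₀′ x x∉in x∉yΔ₀ (there ∘′ pax⊆) ⟧ˢ ∎
      where
      my-sel : my ∘ sel ≈ b ∘ snd
      my-sel = trans (pullʳ (select-∘ xΔ₀! Δ₁ _ pa⊆ Δ₁⊆ (there ∘′ pay⊆)))
        (sym (pullʳ (select-there xΔ₀! _ pay⊆ (there ∘′ pay⊆))))

      ma-sel : a ∘ snd ≈ mechanism x x∉in ∘ select _ (there ∘′ pax⊆)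
      ma-sel = pullʳ (select-there yΔ₀! _ pax⊆ (there ∘′ pax⊆))

      rearrange : (id ⊗₁ sel) ∘ exchange ≈ select (y ∷ Δ₁) Δ⊆
      rearrange = trans
        (∘-resp-≈ (id⊗select yxΔ₀! Δ₁ Δ₁⊆ (∷⁺ʳ _ Δ₁⊆)) (exchange-select xyΔ₀! swap⊆))
        (select-∘ xyΔ₀! (y ∷ x ∷ Δ₀) (y ∷ Δ₁) (∷⁺ʳ _ Δ₁⊆) swap⊆ Δ⊆)

  -- Induction on the larger schedule, whose last variable is either dropped or
  -- can be run last in the smaller one.
  schedule-marginal : ∀ {Γ} → Unique Γ → ∀ {Δ Δ′} (s : Schedule Γ Δ) (s′ : Schedule Γ Δ′) →
                      (Δ⊆ : Δ ⊆ₗ Δ′) → select Δ Δ⊆ ∘ ⟦ s′ ⟧ˢ ≈ ⟦ s ⟧ˢ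
  schedule-marginal Γ! start start Δ⊆ = trans (∘-respˡ (select-id Γ! Δ⊆)) identityˡ
  schedule-marginal Γ! (run s x _ x∉ _) start Δ⊆ =
    contradiction (schedule-⊆ s (Δ⊆ (here ≡.refl))) x∉
  schedule-marginal {Γ} Γ! {Δ} {Δ′} s s′@(run {Δ₁′} s₁′ x x∉in x∉Δ₁′ pa⊆) Δ⊆ with x ∈ₗ? Δ
  ... | no x∉Δ = begin
    select Δ Δ⊆ ∘ ⟦ s′ ⟧ˢ
      ≈⟨ ∘-respˡ (select-there (schedule-unique Γ! s′) Δ Δ⊆₁ Δ⊆) ⟨
    (select Δ Δ⊆₁ ∘ snd) ∘ ((_ ⊗₁ id) ∘ (copy ∘ ⟦ s₁′ ⟧ˢ))
      ≈⟨ pullʳ (trans (∘-respʳ (sym assoc)) (trans (pullˡ snd-pair) identityˡ)) ⟩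
    select Δ Δ⊆₁ ∘ ⟦ s₁′ ⟧ˢ
      ≈⟨ schedule-marginal Γ! s s₁′ Δ⊆₁ ⟩
    ⟦ s ⟧ˢ ∎
    where
    Δ⊆₁ : Δ ⊆ₗ Δ₁′
    Δ⊆₁ i = drop-here (Δ⊆ i) λ { ≡.refl → x∉Δ i }
  ... | yes x∈Δ = begin
    select Δ Δ⊆ ∘ ⟦ s′ ⟧ˢ
      ≈⟨ ∘-respˡ (select-∘ xΔ₁′! (x ∷ rest) Δ L.Δ⊆ (∷⁺ʳ _ rest⊆₁) Δ⊆) ⟨
    (select Δ L.Δ⊆ ∘ select (x ∷ rest) (∷⁺ʳ _ rest⊆₁)) ∘ ⟦ s′ ⟧ˢ
      ≈⟨ pullʳ (∘-resp-≈ (sym (id⊗select xΔ₁′! rest rest⊆₁ (∷⁺ʳ _ rest⊆₁))) (sym assoc)) ⟩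
    select Δ L.Δ⊆ ∘ ((id ⊗₁ select rest rest⊆₁) ∘ (((m′ ⊗₁ id) ∘ copy) ∘ ⟦ s₁′ ⟧ˢ))
      ≈⟨ ∘-respʳ (∘-respʳ (∘-respˡ (∘-respˡ (⊗-respˡ
           (pullʳ (select-∘ Δ₁′! rest _ L.pa⊆rest rest⊆₁ pa⊆)))))) ⟨
    select Δ L.Δ⊆ ∘ ((id ⊗₁ select rest rest⊆₁) ∘ ((((m ∘ select rest rest⊆₁) ⊗₁ id) ∘ copy) ∘ ⟦ s₁′ ⟧ˢ))
      ≈⟨ ∘-respʳ (extendʳ (select-pair m rest⊆₁)) ⟨
    select Δ L.Δ⊆ ∘ (((m ⊗₁ id) ∘ copy) ∘ (select rest rest⊆₁ ∘ ⟦ s₁′ ⟧ˢ))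
      ≈⟨ ∘-respʳ (∘-respʳ (schedule-marginal Γ! L.before s₁′ rest⊆₁)) ⟩
    select Δ L.Δ⊆ ∘ (((m ⊗₁ id) ∘ copy) ∘ ⟦ L.before ⟧ˢ)
      ≈⟨ ∘-respʳ assoc ⟩
    select Δ L.Δ⊆ ∘ ⟦ run L.before x L.x∉in L.x∉rest L.pa⊆rest ⟧ˢ
      ≈⟨ L.same ⟨
    ⟦ s ⟧ˢ ∎
    where
    -- The larger schedule runs `x` last, so every other variable it computes has its parents in
    -- `Δ₁′`, which omits `x`.
    childless : ∀ {y} → y ∈ₗ Δ → y ∉ₗ Γ → ¬ Edge x y
    childless i y∉Γ x→y with Δ⊆ i
    ... | here ≡.refl = x∉Δ₁′ (pa⊆ (∈-elements⁺ x→y))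
    ... | there j with schedule-closed s₁′ j
    ...   | inj₁ y∈Γ = y∉Γ y∈Γ
    ...   | inj₂ p   = x∉Δ₁′ (p (∈-elements⁺ x→y))

    module L = RunLast (run-last Γ! s x∈Δ (λ x∈Γ → x∉Δ₁′ (schedule-⊆ s₁′ x∈Γ)) childless)
    open L using (rest)

    rest⊆₁ : rest ⊆ₗ Δ₁′
    rest⊆₁ i = drop-here (Δ⊆ (L.rest⊆ i)) λ { ≡.refl → L.x∉rest i }

    Δ₁′! : Unique Δ₁′
    Δ₁′! = schedule-unique Γ! s₁′

    xΔ₁′! : Unique (x ∷ Δ₁′)
    xΔ₁′! = schedule-unique Γ! s′

    m : ⨂ rest ⇒ obj x
    m = mechanism x L.x∉in ∘ select _ L.pa⊆rest

    m′ : ⨂ Δ₁′ ⇒ obj x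
    m′ = mechanism x x∉in ∘ select _ pa⊆

  -- The evaluation for `O` computes part of what the evaluation for `O′` computes, possibly in
  -- another order, and `schedule-marginal` covers both differences.
  composite-marginal : ∀ {Γ} → Unique Γ → (inputs⊆ inputs⊆′ : ∀ {x} → x ∈ inputs → x ∈ₗ Γ) →
    Γ ⊆ₗ elements inputs → ∀ O O′ (O⊆ : O ⊆ₗ O′) →
    select O O⊆ ∘ composite Γ inputs⊆′ O′ ≈ composite Γ inputs⊆ O
  composite-marginal {Γ} Γ! inputs⊆ inputs⊆′ Γ⊆ O O′ O⊆ = begin
    select O O⊆ ∘ (select O′ E′.complete ∘ ⟦ E′.schedule ⟧ˢ)
      ≈⟨ pullˡ (select-∘ E′! O′ O O⊆ E′.complete (E⊆E′ ∘′ E.complete)) ⟩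
    select O (E⊆E′ ∘′ E.complete) ∘ ⟦ E′.schedule ⟧ˢ
      ≈⟨ pushˡ (sym (select-∘ E′! E.computed O E.complete E⊆E′ (E⊆E′ ∘′ E.complete))) ⟩
    select O E.complete ∘ (select E.computed E⊆E′ ∘ ⟦ E′.schedule ⟧ˢ)
      ≈⟨ ∘-respʳ (schedule-marginal Γ! E.schedule E′.schedule E⊆E′) ⟩
    select O E.complete ∘ ⟦ E.schedule ⟧ˢ ∎
    where
    module E  = Evaluation (evaluate Γ O inputs⊆)
    module E′ = Evaluation (evaluate Γ O′ inputs⊆′)

    E⊆E′ : E.computed ⊆ₗ E′.computed
    E⊆E′ = evaluation-monotone Γ⊆ O⊆ (evaluate Γ O inputs⊆) (evaluate Γ O′ inputs⊆′)

    E′! : Unique E′.computed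
    E′! = schedule-unique Γ! E′.schedule

-- Transformations out of a free Markov category

module TensorMap {o ℓ e} (C : MarkovCategory o ℓ e) {T : Set}
    {obj obj′ : T → MarkovCategory.Obj C}
    (t : ∀ x → MarkovCategory._⇒_ C (obj x) (obj′ x)) where
  open MarkovCategory C
  open Reasoning C
  open Coherence C
  private
    module S = Tensor C obj
    module R = Tensor C obj′

  ⨂-map : ∀ A → S.⨂ A ⇒ R.⨂ A
  ⨂-map []      = id
  ⨂-map (x ∷ A) = t x ⊗₁ ⨂-map A

  ⨂-map-++ : ∀ A B → ⨂-map (A ++ B) ∘ S.⨂-++⇒ A B ≈ R.⨂-++⇒ A B ∘ (⨂-map A ⊗₁ ⨂-map B)
  ⨂-map-++ []      B = sym λ-natural
  ⨂-map-++ (x ∷ A) B = begin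
    (t x ⊗₁ ⨂-map (A ++ B)) ∘ ((id ⊗₁ S.⨂-++⇒ A B) ∘ α⇒)
      ≈⟨ extendʳ (glue-⊗ (sym idsq) (⨂-map-++ A B)) ⟩
    (id ⊗₁ R.⨂-++⇒ A B) ∘ ((t x ⊗₁ (⨂-map A ⊗₁ ⨂-map B)) ∘ α⇒)
      ≈⟨ ∘-respʳ α-natural ⟨
    (id ⊗₁ R.⨂-++⇒ A B) ∘ (α⇒ ∘ ((t x ⊗₁ ⨂-map A) ⊗₁ ⨂-map B))
      ≈⟨ assoc ⟨
    R.⨂-++⇒ (x ∷ A) B ∘ (⨂-map (x ∷ A) ⊗₁ ⨂-map B) ∎

  ⨂-map-deterministic : (∀ x → Deterministic (t x)) → ∀ A → Deterministic (⨂-map A)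
  ⨂-map-deterministic d []      = id-deterministic
  ⨂-map-deterministic d (x ∷ A) = ⊗-deterministic (d x) (⨂-map-deterministic d A)

module _ {o ℓ e} {D : MarkovCategory o ℓ e} {Q : Signature} where
  open MarkovCategory D
  open Reasoning D
  open Coherence D
  open MarkovProperties D
  open Signature Q
  private
    module Q = Diagrams Q

  module Blocks (F : MarkovFunctor (Free Q) D) where
    open MarkovFunctor F
    open Tensor D (λ x → F₀ (x ∷ []))

    -- A strong monoidal functor out of the free category is determined on lists only up to this
    -- isomorphism, so components given on types are carried to lists along it.
    Φ : ∀ A → ⨂ A ⇒ F₀ A
    Φ []      = ε⇒
    Φ (x ∷ A) = φ⇒ (x ∷ []) A ∘ (id ⊗₁ Φ A)

    Φ⇐ : ∀ A → F₀ A ⇒ ⨂ A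
    Φ⇐ []      = ε⇐
    Φ⇐ (x ∷ A) = (id ⊗₁ Φ⇐ A) ∘ φ⇐ (x ∷ []) A

    Φ-isoˡ : ∀ A → Φ⇐ A ∘ Φ A ≈ id
    Φ-isoˡ []      = ε-isoˡ
    Φ-isoˡ (x ∷ A) = ∘-iso (⊗-iso identityˡ (Φ-isoˡ A)) (φ-isoˡ (x ∷ []) A)

    Φ-isoʳ : ∀ A → Φ A ∘ Φ⇐ A ≈ id
    Φ-isoʳ []      = ε-isoʳ
    Φ-isoʳ (x ∷ A) = ∘-iso (φ-isoʳ (x ∷ []) A) (⊗-iso identityˡ (Φ-isoʳ A))

    Φ-deterministic : ∀ A → Deterministic (Φ A)
    Φ-deterministic []      = ε-deterministic
    Φ-deterministic (x ∷ A) =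
      ∘-deterministic (φ-deterministic (x ∷ []) A) (⊗-deterministic id-deterministic (Φ-deterministic A))

    Φ-++ : ∀ A B → Φ (A ++ B) ∘ ⨂-++⇒ A B ≈ φ⇒ A B ∘ (Φ A ⊗₁ Φ B)
    Φ-++ []      B = begin
      Φ B ∘ λ⇒                              ≈⟨ λ-natural ⟨
      λ⇒ ∘ (id ⊗₁ Φ B)                      ≈⟨ ∘-respˡ (φ-unitˡ B) ⟨
      (F₁ Q.id ∘ (φ⇒ [] B ∘ (ε⇒ ⊗₁ id))) ∘ (id ⊗₁ Φ B)
        ≈⟨ ∘-respˡ (trans (∘-respˡ F-id) identityˡ) ⟩
      (φ⇒ [] B ∘ (ε⇒ ⊗₁ id)) ∘ (id ⊗₁ Φ B)  ≈⟨ pullʳ (sym ⊗-split) ⟩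
      φ⇒ [] B ∘ (ε⇒ ⊗₁ Φ B)                 ∎
    Φ-++ (x ∷ A) B = begin
      (φ⇒ (x ∷ []) (A ++ B) ∘ (id ⊗₁ Φ (A ++ B))) ∘ ((id ⊗₁ ⨂-++⇒ A B) ∘ α⇒)
        ≈⟨ pullʳ (pullˡ (trans (sym id-⊗-∘) (trans (⊗-respʳ (Φ-++ A B)) id-⊗-∘))) ⟩
      φ⇒ (x ∷ []) (A ++ B) ∘ (((id ⊗₁ φ⇒ A B) ∘ (id ⊗₁ (Φ A ⊗₁ Φ B))) ∘ α⇒)
        ≈⟨ ∘-respʳ (pullʳ (sym α-natural)) ⟩
      φ⇒ (x ∷ []) (A ++ B) ∘ ((id ⊗₁ φ⇒ A B) ∘ (α⇒ ∘ ((id ⊗₁ Φ A) ⊗₁ Φ B)))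
        ≈⟨ trans (∘-respʳ (sym assoc)) (pullˡ (sym (φ-assoc (x ∷ []) A B))) ⟩
      (F₁ Q.id ∘ (φ⇒ (x ∷ A) B ∘ (φ⇒ (x ∷ []) A ⊗₁ id))) ∘ ((id ⊗₁ Φ A) ⊗₁ Φ B)
        ≈⟨ ∘-respˡ (trans (∘-respˡ F-id) identityˡ) ⟩
      (φ⇒ (x ∷ A) B ∘ (φ⇒ (x ∷ []) A ⊗₁ id)) ∘ ((id ⊗₁ Φ A) ⊗₁ Φ B)
        ≈⟨ pullʳ (trans (sym ⊗-∘) (⊗-respʳ identityˡ)) ⟩
      φ⇒ (x ∷ A) B ∘ (Φ (x ∷ A) ⊗₁ Φ B) ∎

    Φ-single : ∀ x → Φ (x ∷ []) ≈ ρ⇒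
    Φ-single x = trans (sym (trans (∘-respˡ F-id) identityˡ)) (φ-unitʳ (x ∷ []))

  module _ (F G : MarkovFunctor (Free Q) D) where
    private
      module F = MarkovFunctor F
      module G = MarkovFunctor G
      module BF = Blocks F
      module BG = Blocks G

    -- A monoidal transformation stripped of naturality and determinism. Uniqueness, composition and
    -- whiskering use no more than this, so they are available before naturality is known.
    record MonoidalFamily : Set (ℓ ⊔ e) where
      field
        η             : ∀ A → F.F₀ A ⇒ G.F₀ A
        monoidal      : ∀ A B → η (A ++ B) ∘ F.φ⇒ A B ≈ G.φ⇒ A B ∘ (η A ⊗₁ η B)
        monoidal-unit : η [] ∘ F.ε⇒ ≈ G.ε⇒

    module _ (M : MonoidalFamily) where
      open MonoidalFamily M

      -- By induction on the diagram. Determinism serves the `copy` case, and `discard` is natural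
      -- because all maps into the unit agree.
      natural-from-generators :
        (∀ A → Deterministic (η A)) →
        (∀ q → η (cod q) ∘ F.F₁ (Q.gen q) ≈ G.F₁ (Q.gen q) ∘ η (dom q)) →
        ∀ {A B} (f : Q.Diagram A B) → η B ∘ F.F₁ f ≈ G.F₁ f ∘ η A
      natural-from-generators det nat = natural
        where
        natural : ∀ {A B} (f : Q.Diagram A B) → η B ∘ F.F₁ f ≈ G.F₁ f ∘ η A
        natural (Q.gen q) = nat q
        natural Q.id = trans (∘-respʳ F.F-id) (trans (sym idsq) (∘-respˡ (sym G.F-id)))
        natural (g Q.∘ f) = begin
          η _ ∘ F.F₁ (g Q.∘ f)      ≈⟨ ∘-respʳ F.F-∘ ⟩
          η _ ∘ (F.F₁ g ∘ F.F₁ f)   ≈⟨ pullˡ (natural g) ⟩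
          (G.F₁ g ∘ η _) ∘ F.F₁ f   ≈⟨ pullʳ (natural f) ⟩
          G.F₁ g ∘ (G.F₁ f ∘ η _)   ≈⟨ pullˡ (sym G.F-∘) ⟩
          G.F₁ (g Q.∘ f) ∘ η _      ∎
        natural (Q._⊗_ {A} {B} {A′} {B′} f g) = epi (F.φ-isoʳ A A′) (begin
          (η (B ++ B′) ∘ F.F₁ (f Q.⊗ g)) ∘ F.φ⇒ A A′    ≈⟨ pullʳ (F.φ-natural f g) ⟩
          η (B ++ B′) ∘ (F.φ⇒ B B′ ∘ (F.F₁ f ⊗₁ F.F₁ g)) ≈⟨ extendʳ (monoidal B B′) ⟩
          G.φ⇒ B B′ ∘ ((η B ⊗₁ η B′) ∘ (F.F₁ f ⊗₁ F.F₁ g)) ≈⟨ ∘-respʳ (glue-⊗ (natural f) (natural g)) ⟩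
          G.φ⇒ B B′ ∘ ((G.F₁ f ⊗₁ G.F₁ g) ∘ (η A ⊗₁ η A′)) ≈⟨ extendʳ (sym (G.φ-natural f g)) ⟩
          G.F₁ (f Q.⊗ g) ∘ (G.φ⇒ A A′ ∘ (η A ⊗₁ η A′)) ≈⟨ ∘-respʳ (monoidal A A′) ⟨
          G.F₁ (f Q.⊗ g) ∘ (η (A ++ A′) ∘ F.φ⇒ A A′)  ≈⟨ assoc ⟨
          (G.F₁ (f Q.⊗ g) ∘ η (A ++ A′)) ∘ F.φ⇒ A A′  ∎)
        natural (Q.σ A B) = epi (F.φ-isoʳ A B) (begin
          (η (B ++ A) ∘ F.F₁ (Q.σ A B)) ∘ F.φ⇒ A B   ≈⟨ pullʳ (F.φ-σ A B) ⟩
          η (B ++ A) ∘ (F.φ⇒ B A ∘ σ)                ≈⟨ extendʳ (monoidal B A) ⟩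
          G.φ⇒ B A ∘ ((η B ⊗₁ η A) ∘ σ)              ≈⟨ ∘-respʳ σ-natural ⟨
          G.φ⇒ B A ∘ (σ ∘ (η A ⊗₁ η B))              ≈⟨ extendʳ (sym (G.φ-σ A B)) ⟩
          G.F₁ (Q.σ A B) ∘ (G.φ⇒ A B ∘ (η A ⊗₁ η B)) ≈⟨ ∘-respʳ (monoidal A B) ⟨
          G.F₁ (Q.σ A B) ∘ (η (A ++ B) ∘ F.φ⇒ A B)   ≈⟨ assoc ⟨
          (G.F₁ (Q.σ A B) ∘ η (A ++ B)) ∘ F.φ⇒ A B   ∎)
        natural (Q.copy A) = begin
          η (A ++ A) ∘ F.F₁ (Q.copy A)      ≈⟨ ∘-respʳ (F.F-copy A) ⟩
          η (A ++ A) ∘ (F.φ⇒ A A ∘ copy)    ≈⟨ extendʳ (monoidal A A) ⟩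
          G.φ⇒ A A ∘ ((η A ⊗₁ η A) ∘ copy)  ≈⟨ ∘-respʳ (det A) ⟨
          G.φ⇒ A A ∘ (copy ∘ η A)           ≈⟨ pullˡ (sym (G.F-copy A)) ⟩
          G.F₁ (Q.copy A) ∘ η A             ∎
        natural (Q.discard A) = mono G.ε-isoʳ (unit-unique _ _)

      transformation :
        (∀ A → Deterministic (η A)) →
        (∀ q → η (cod q) ∘ F.F₁ (Q.gen q) ≈ G.F₁ (Q.gen q) ∘ η (dom q)) →
        Transformation F G
      transformation det nat = record
        { η = η ; natural = natural-from-generators det nat
        ; monoidal = monoidal ; monoidal-unit = monoidal-unit ; deterministic = det }

    module Extension (t : ∀ x → F.F₀ (x ∷ []) ⇒ G.F₀ (x ∷ [])) where
      open TensorMap D t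

      extend : ∀ A → F.F₀ A ⇒ G.F₀ A
      extend A = BG.Φ A ∘ (⨂-map A ∘ BF.Φ⇐ A)

      extend-Φ : ∀ A → extend A ∘ BF.Φ A ≈ BG.Φ A ∘ ⨂-map A
      extend-Φ A = pullʳ (cancelʳ (BF.Φ-isoˡ A))

      extend-single : ∀ x → extend (x ∷ []) ≈ t x
      extend-single x = epi ρ-isoʳ (begin
        extend (x ∷ []) ∘ ρ⇒             ≈⟨ ∘-respʳ (BF.Φ-single x) ⟨
        extend (x ∷ []) ∘ BF.Φ (x ∷ [])  ≈⟨ extend-Φ (x ∷ []) ⟩
        BG.Φ (x ∷ []) ∘ (t x ⊗₁ id)      ≈⟨ ∘-respˡ (BG.Φ-single x) ⟩
        ρ⇒ ∘ (t x ⊗₁ id)                 ≈⟨ ρ-natural ⟩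
        t x ∘ ρ⇒                         ∎)

      extend-deterministic : (∀ x → Deterministic (t x)) → ∀ A → Deterministic (extend A)
      extend-deterministic d A = ∘-deterministic (BG.Φ-deterministic A)
        (∘-deterministic (⨂-map-deterministic d A)
          (inverse-deterministic (BF.Φ-isoʳ A) (BF.Φ-isoˡ A) (BF.Φ-deterministic A)))

      family : MonoidalFamily
      family = record
        { η             = extend
        ; monoidal      = λ A B → epi (⊗-iso (BF.Φ-isoʳ A) (BF.Φ-isoʳ B)) (begin
            (extend (A ++ B) ∘ F.φ⇒ A B) ∘ (BF.Φ A ⊗₁ BF.Φ B)
              ≈⟨ pullʳ (sym (BF.Φ-++ A B)) ⟩
            extend (A ++ B) ∘ (BF.Φ (A ++ B) ∘ _)
              ≈⟨ extendʳ (extend-Φ (A ++ B)) ⟩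
            BG.Φ (A ++ B) ∘ (⨂-map (A ++ B) ∘ _)
              ≈⟨ ∘-respʳ (⨂-map-++ A B) ⟩
            BG.Φ (A ++ B) ∘ (_ ∘ (⨂-map A ⊗₁ ⨂-map B))
              ≈⟨ extendʳ (BG.Φ-++ A B) ⟩
            G.φ⇒ A B ∘ ((BG.Φ A ⊗₁ BG.Φ B) ∘ (⨂-map A ⊗₁ ⨂-map B))
              ≈⟨ ∘-respʳ (glue-⊗ (extend-Φ A) (extend-Φ B)) ⟨
            G.φ⇒ A B ∘ ((extend A ⊗₁ extend B) ∘ (BF.Φ A ⊗₁ BF.Φ B))
              ≈⟨ assoc ⟨
            (G.φ⇒ A B ∘ (extend A ⊗₁ extend B)) ∘ (BF.Φ A ⊗₁ BF.Φ B) ∎)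
        ; monoidal-unit = trans (extend-Φ []) identityʳ
        }

  family-unique : ∀ {F G : MarkovFunctor (Free Q) D} (M N : MonoidalFamily F G) →
    (∀ x → MonoidalFamily.η M (x ∷ []) ≈ MonoidalFamily.η N (x ∷ [])) →
    ∀ A → MonoidalFamily.η M A ≈ MonoidalFamily.η N A
  family-unique {F} {G} M N p = same
    where
    module F = MarkovFunctor F
    module M = MonoidalFamily M
    module N = MonoidalFamily N
    same : ∀ A → M.η A ≈ N.η A
    same []      = epi F.ε-isoʳ (trans M.monoidal-unit (sym N.monoidal-unit))
    same (x ∷ A) = epi (F.φ-isoʳ (x ∷ []) A)
      (trans (M.monoidal (x ∷ []) A)
        (trans (∘-respʳ (⊗-resp-≈ (p x) (same A))) (sym (N.monoidal (x ∷ []) A))))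

  id-family : ∀ {F : MarkovFunctor (Free Q) D} → MonoidalFamily F F
  id-family = record
    { η = λ A → id ; monoidal = λ A B → trans idsq (∘-respʳ (sym ⊗-id)) ; monoidal-unit = identityˡ }

  ∘-family : ∀ {F G H : MarkovFunctor (Free Q) D} →
             MonoidalFamily G H → MonoidalFamily F G → MonoidalFamily F H
  ∘-family N M = record
    { η             = λ A → N.η A ∘ M.η A
    ; monoidal      = λ A B → trans (pullʳ (M.monoidal A B))
        (trans (extendʳ (N.monoidal A B)) (∘-respʳ (sym ⊗-∘)))
    ; monoidal-unit = trans (pullʳ M.monoidal-unit) N.monoidal-unit
    }
    where
    module M = MonoidalFamily M
    module N = MonoidalFamily N

  transformation-family : ∀ {F G : MarkovFunctor (Free Q) D} → Transformation F G → MonoidalFamily F G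
  transformation-family τ = record
    { η = η ; monoidal = monoidal ; monoidal-unit = monoidal-unit }
    where
    open Transformation τ

-- Lists and subsets

module _ {T : Set} where
  unique-↭ : {A B : List T} → Unique A → Unique B → A ⊆ₗ B → B ⊆ₗ A → A ↭ B
  unique-↭ A! B! A⊆B B⊆A = ∼bag⇒↭ (unique∧set⇒bag A! B! (mk⇔ A⊆B B⊆A))

  Unique-resp-↭ : {A B : List T} → A ↭ B → Unique A → Unique B
  Unique-resp-↭ p = PermutationSetoid.Unique-resp-↭ (setoid T) (↭⇒↭ₛ p)

  Unique-++⁻ : ∀ A {B : List T} → Unique (A ++ B) → Unique A × Unique B × Disjoint A B
  Unique-++⁻ []      B!        = [] , B! , λ ()
  Unique-++⁻ (x ∷ A) (x∉ ∷ AB!) with Unique-++⁻ A AB!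
  ... | A! , B! , A#B =
    ¬Any⇒All¬ _ (λ i → All¬⇒¬Any x∉ (∈-++⁺ˡ i)) ∷ A! , B! , λ where
      (here ≡.refl , j) → All¬⇒¬Any x∉ (∈-++⁺ʳ A j)
      (there i , j)     → A#B (i , j)

module _ {S T : Set} (f : S → List T) where
  Unique-concatMap⁻ : ∀ {A} → Unique (concatMap f A) → ∀ {x} → x ∈ₗ A → Unique (f x)
  Unique-concatMap⁻ {x ∷ A} u (here ≡.refl) = proj₁ (Unique-++⁻ (f x) u)
  Unique-concatMap⁻ {y ∷ A} u (there i)     =
    Unique-concatMap⁻ {A} (proj₁ (proj₂ (Unique-++⁻ (f y) u))) i

  Disjoint-concatMap⁻ : ∀ {A} → Unique (concatMap f A) → ∀ {x y} → x ∈ₗ A → y ∈ₗ A → x ≢ y →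
                        Disjoint (f x) (f y)
  Disjoint-concatMap⁻ u (here ≡.refl) (here ≡.refl) x≢y _ = contradiction ≡.refl x≢y
  Disjoint-concatMap⁻ {x ∷ A} u (here ≡.refl) (there j) x≢y (v∈x , v∈y) =
    proj₂ (proj₂ (Unique-++⁻ (f x) u)) (v∈x , ∈-concatMap⁺ f (lose j v∈y))
  Disjoint-concatMap⁻ {y ∷ A} u (there i) (here ≡.refl) x≢y (v∈x , v∈y) =
    proj₂ (proj₂ (Unique-++⁻ (f y) u)) (v∈y , ∈-concatMap⁺ f (lose i v∈x))
  Disjoint-concatMap⁻ {z ∷ A} u (there i) (there j) x≢y =
    Disjoint-concatMap⁻ {A} (proj₁ (proj₂ (Unique-++⁻ (f z) u))) i j x≢y

  Unique-concatMap⁺ : (∀ x → Unique (f x)) → (∀ {x y} → x ≢ y → Disjoint (f x) (f y)) →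
                      ∀ {A} → Unique A → Unique (concatMap f A)
  Unique-concatMap⁺ f! f# {[]}    []        = []
  Unique-concatMap⁺ f! f# {x ∷ A} (x∉ ∷ A!) =
    Unique.++⁺ (f! x) (Unique-concatMap⁺ f! f# A!) disjoint
    where
    disjoint : Disjoint (f x) (concatMap f A)
    disjoint (v∈x , v∈A) with find (∈-concatMap⁻ f v∈A)
    ... | y , y∈A , v∈y = f# (λ { ≡.refl → All¬⇒¬Any x∉ y∈A }) (v∈x , v∈y)

concatMap-↭ : ∀ {S T : Set} {f g : S → List T} → (∀ x → f x ↭ g x) →
              ∀ A → concatMap f A ↭ concatMap g A
concatMap-↭ p []      = _↭_.refl
concatMap-↭ p (x ∷ A) = ++⁺ (p x) (concatMap-↭ p A)

elements-unique : ∀ {n} (p : Subset n) → Unique (elements p)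
elements-unique {n} p = Unique.filter⁺ (_∈? p) (Unique.allFin⁺ n)

elements-injective : ∀ {n} {p q : Subset n} → elements p ↭ elements q → p ≡ q
elements-injective r = ⊆-antisym
  (λ x∈ → ∈-elements⁻ (∈-resp-↭ r (∈-elements⁺ x∈)))
  (λ x∈ → ∈-elements⁻ (∈-resp-↭ (↭-sym r) (∈-elements⁺ x∈)))

-- Turns the list of types that a functor assigns to a variable into the subset that an alignment
-- requires.
support : ∀ {n} → List (Fin n) → Subset n
support A = ⋃ (map ⁅_⁆ A)

∈-support⁺ : ∀ {n} {A : List (Fin n)} {x} → x ∈ₗ A → x ∈ support A
∈-support⁺ (here ≡.refl) = x∈p∪q⁺ (inj₁ (x∈⁅x⁆ _))
∈-support⁺ (there i)     = x∈p∪q⁺ (inj₂ (∈-support⁺ i))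

∈-support⁻ : ∀ {n} (A : List (Fin n)) {x} → x ∈ support A → x ∈ₗ A
∈-support⁻ []      x∈ = ⊥-elim (∉⊥ x∈)
∈-support⁻ (y ∷ A) x∈ with x∈p∪q⁻ ⁅ y ⁆ _ x∈
... | inj₁ x∈y = here (x∈⁅y⁆⇒x≡y y x∈y)
... | inj₂ x∈A = there (∈-support⁻ A x∈A)

elements-support : ∀ {n} {A : List (Fin n)} → Unique A → A ↭ elements (support A)
elements-support {A = A} A! = unique-↭ A! (elements-unique _)
  (λ i → ∈-elements⁺ (∈-support⁺ i)) (λ i → ∈-support⁻ A (∈-elements⁻ i))

module _ {m n} (π : Fin m → Subset n) where
  ∈-⋃⁺ : ∀ A {v} → v ∈ₗ concatMap (elements ∘′ π) A → v ∈ ⋃ (map π A)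
  ∈-⋃⁺ (x ∷ A) i with ∈-++⁻ (elements (π x)) i
  ... | inj₁ j = x∈p∪q⁺ (inj₁ (∈-elements⁻ j))
  ... | inj₂ j = x∈p∪q⁺ (inj₂ (∈-⋃⁺ A j))

  ∈-⋃⁻ : ∀ A {v} → v ∈ ⋃ (map π A) → v ∈ₗ concatMap (elements ∘′ π) A
  ∈-⋃⁻ []      v∈ = ⊥-elim (∉⊥ v∈)
  ∈-⋃⁻ (x ∷ A) v∈ with x∈p∪q⁻ (π x) _ v∈
  ... | inj₁ v∈x = ∈-++⁺ˡ (∈-elements⁺ v∈x)
  ... | inj₂ v∈A = ∈-++⁺ʳ (elements (π x)) (∈-⋃⁻ A v∈A)

  elements-⋃ : (∀ {x y} → x ≢ y → Empty (π x ∩ π y)) → ∀ {A} → Unique A →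
               concatMap (elements ∘′ π) A ↭ elements (⋃ (map π A))
  elements-⋃ disjoint {A} A! = unique-↭
    (Unique-concatMap⁺ (elements ∘′ π) (λ x → elements-unique (π x))
      (λ x≢y (i , j) → disjoint x≢y (_ , x∈p∩q⁺ (∈-elements⁻ i , ∈-elements⁻ j))) A!)
    (elements-unique _) (λ i → ∈-elements⁺ (∈-⋃⁺ A i)) (λ i → ∈-⋃⁻ A (∈-elements⁻ i))

-- Queries carry their inclusions irrelevantly. Membership is decidable, and the irrelevant proof is
-- used only to refute the negative case.
⊆-recompute : ∀ {n} {p q : Subset n} → .(p ⊆ q) → p ⊆ q
⊆-recompute {q = q} p⊆q {x} x∈p with x ∈? q
... | yes x∈q = x∈q
... | no  x∉q = ⊥-elim-irr (x∉q (p⊆q x∈p))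

-- Functors between free Markov categories

module _ {QL QH : Signature} where
  open Diagrams QL hiding (Free)
  open Reasoning (Free QL) hiding (refl; sym; trans)
  private
    module QL = Signature QL
    module QH = Signature QH
    open DiagramProperties QL

  φ*⇐ : (π : MarkovFunctor (Free QH) (Free QL)) → ∀ A → Diagram (MarkovFunctor.F₀ π A) (onTypes π A)
  φ*⇐ π []      = MarkovFunctor.ε⇐ π
  φ*⇐ π (x ∷ A) = (id {onType π x} ⊗ φ*⇐ π A) ∘ MarkovFunctor.φ⇐ π (x ∷ []) A

  φ*-isoʳ : (π : MarkovFunctor (Free QH) (Free QL)) → ∀ A → φ* π A ∘ φ*⇐ π A ≈ id
  φ*-isoʳ π []      = MarkovFunctor.ε-isoʳ π
  φ*-isoʳ π (x ∷ A) =
    ∘-iso (MarkovFunctor.φ-isoʳ π (x ∷ []) A) (⊗-iso {A = onType π x} {f = id} identityˡ (φ*-isoʳ π A))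

  -- Applies to functors whose structure isomorphisms are themselves reorderings. All of these can
  -- then be inverted and moved into the two permutations that `SendsToQuery` asks for.
  permuted-generator : (F : MarkovFunctor (Free QH) (Free QL)) →
    (t : ∀ A → onTypes F A ↭ MarkovFunctor.F₀ F A) → (∀ A → φ* F A ≈ permute (t A)) →
    ∀ {q q′} (s : MarkovFunctor.F₀ F (QH.dom q) ↭ QL.dom q′) (r : QL.cod q′ ↭ MarkovFunctor.F₀ F (QH.cod q)) →
    MarkovFunctor.F₁ F (Diagrams.gen q) ≈ permute r ∘ (gen q′ ∘ permute s) → SendsToQuery F q q′
  permuted-generator F t t-φ* {q} {q′} s r F-gen =
    _↭_.trans (↭-sym s) (↭-sym (t (QH.dom q))) , _↭_.trans r (↭-sym (t (QH.cod q))) , (begin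
    F.F₁ (Diagrams.gen q) ∘ (φ* F (QH.dom q) ∘ (permute (↭-sym (t (QH.dom q))) ∘ permute (↭-sym s)))
      ≈⟨ ∘-respʳ (∘-respˡ (t-φ* (QH.dom q))) ⟩
    F.F₁ (Diagrams.gen q) ∘ (permute (t (QH.dom q)) ∘ (permute (↭-sym (t (QH.dom q))) ∘ permute (↭-sym s)))
      ≈⟨ ∘-respʳ (cancelˡ (permute-isoʳ (t (QH.dom q)))) ⟩
    F.F₁ (Diagrams.gen q) ∘ permute (↭-sym s)
      ≈⟨ ∘-respˡ (trans F-gen (sym assoc)) ⟩
    ((permute r ∘ gen q′) ∘ permute s) ∘ permute (↭-sym s)
      ≈⟨ cancelʳ (permute-isoʳ s) ⟩
    permute r ∘ gen q′
      ≈⟨ cancelˡ (permute-isoʳ (t (QH.cod q))) ⟨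
    permute (t (QH.cod q)) ∘ (permute (↭-sym (t (QH.cod q))) ∘ (permute r ∘ gen q′))
      ≈⟨ ∘-resp-≈ (sym (t-φ* (QH.cod q))) (sym assoc) ⟩
    φ* F (QH.cod q) ∘ ((permute (↭-sym (t (QH.cod q))) ∘ permute r) ∘ gen q′) ∎)
    where
    module F = MarkovFunctor F

  module _ {F G : MarkovFunctor (Free QH) (Free QL)} (M : MonoidalFamily F G)
           (w : ∀ (x : QH.Type) → onType F x ↭ onType G x) where
    open MonoidalFamily M
    private
      module F = MarkovFunctor F
      module G = MarkovFunctor G

    family-φ* : (∀ x → η (x ∷ []) ≈ permute (w x)) →
                ∀ A → η A ∘ φ* F A ≈ φ* G A ∘ permute (concatMap-↭ w A)
    family-φ* p []      = trans monoidal-unit (sym identityʳ)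
    family-φ* p (x ∷ A) = begin
      η (x ∷ A) ∘ (F.φ⇒ (x ∷ []) A ∘ (id {onType F x} ⊗ φ* F A))
        ≈⟨ extendʳ (monoidal (x ∷ []) A) ⟩
      G.φ⇒ (x ∷ []) A ∘ ((η (x ∷ []) ⊗ η A) ∘ (id {onType F x} ⊗ φ* F A))
        ≈⟨ ∘-respʳ (trans (sym ⊗-∘) (⊗-resp-≈ (trans identityʳ (trans (p x) (sym identityˡ))) (family-φ* p A))) ⟩
      G.φ⇒ (x ∷ []) A ∘ ((id {onType G x} ∘ permute (w x)) ⊗ (φ* G A ∘ permute (concatMap-↭ w A)))
        ≈⟨ ∘-respʳ (trans ⊗-∘ (∘-resp-≈ refl (sym (permute-++⁺ (w x) (concatMap-↭ w A))))) ⟩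
      G.φ⇒ (x ∷ []) A ∘ ((id {onType G x} ⊗ φ* G A) ∘ permute (concatMap-↭ w (x ∷ A)))
        ≈⟨ sym assoc ⟩
      φ* G (x ∷ A) ∘ permute (concatMap-↭ w (x ∷ A)) ∎

    -- Both functors send `q` to the same `q′` between two permutations. The composites to be
    -- compared start at the domain or codomain of `q′`, which has no repetitions, so coherence
    -- identifies them.
    generator-natural : (∀ x → η (x ∷ []) ≈ permute (w x)) →
      ∀ {q q′} → Unique (QL.dom q′) → Unique (QL.cod q′) → SendsToQuery F q q′ → SendsToQuery G q q′ →
      η (QH.cod q) ∘ F.F₁ (Diagrams.gen q) ≈ G.F₁ (Diagrams.gen q) ∘ η (QH.dom q)
    generator-natural η≈w {q} {q′} dom! cod! (p , r , eq) (p′ , r′ , eq′) =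
      epi (∘-iso (φ*-isoʳ F (QH.dom q)) (permute-isoʳ p)) (begin
      (η (QH.cod q) ∘ F.F₁ (Diagrams.gen q)) ∘ (φ* F (QH.dom q) ∘ permute p)
        ≈⟨ pullʳ eq ⟩
      η (QH.cod q) ∘ (φ* F (QH.cod q) ∘ (permute r ∘ gen q′))
        ≈⟨ extendʳ (family-φ* η≈w (QH.cod q)) ⟩
      φ* G (QH.cod q) ∘ (permute (concatMap-↭ w (QH.cod q)) ∘ (permute r ∘ gen q′))
        ≈⟨ ∘-respʳ (pullˡ (permute-coherent cod! (_↭_.trans r (concatMap-↭ w (QH.cod q))) r′)) ⟩
      φ* G (QH.cod q) ∘ (permute r′ ∘ gen q′)
        ≈⟨ eq′ ⟨
      G.F₁ (Diagrams.gen q) ∘ (φ* G (QH.dom q) ∘ permute p′)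
        ≈⟨ ∘-respʳ (∘-respʳ (permute-coherent dom! (_↭_.trans p (concatMap-↭ w (QH.dom q))) p′)) ⟨
      G.F₁ (Diagrams.gen q) ∘ (φ* G (QH.dom q) ∘ (permute (concatMap-↭ w (QH.dom q)) ∘ permute p))
        ≈⟨ ∘-respʳ (extendʳ (family-φ* η≈w (QH.dom q))) ⟨
      G.F₁ (Diagrams.gen q) ∘ (η (QH.dom q) ∘ (φ* F (QH.dom q) ∘ permute p))
        ≈⟨ assoc ⟨
      (G.F₁ (Diagrams.gen q) ∘ η (QH.dom q)) ∘ (φ* F (QH.dom q) ∘ permute p) ∎)

module _ {o ℓ e} {C : MarkovCategory o ℓ e} {QL QH : Signature}
         {L : MarkovFunctor (Free QL) C} {H : MarkovFunctor (Free QH) C} where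
  open MarkovCategory C
  open Reasoning C
  private
    module L = MarkovFunctor L
    module QL = Signature QL
    module QH = Signature QH
    module DL = Diagrams QL
    module DLP = DiagramProperties QL

  whisker : ∀ {F G : MarkovFunctor (Free QH) (Free QL)} →
            MonoidalFamily F G → MonoidalFamily (L ∘F F) (L ∘F G)
  whisker {F} {G} M = record
    { η             = λ A → L.F₁ (η A)
    ; monoidal      = λ A B → begin
        L.F₁ (η (A ++ B)) ∘ (L.F₁ (F.φ⇒ A B) ∘ L.φ⇒ (F.F₀ A) (F.F₀ B))
          ≈⟨ pullˡ (trans (sym L.F-∘) (trans (L.F-resp-≈ (monoidal A B)) L.F-∘)) ⟩
        (L.F₁ (G.φ⇒ A B) ∘ L.F₁ (η A DL.⊗ η B)) ∘ L.φ⇒ (F.F₀ A) (F.F₀ B)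
          ≈⟨ pullʳ (L.φ-natural (η A) (η B)) ⟩
        L.F₁ (G.φ⇒ A B) ∘ (L.φ⇒ (G.F₀ A) (G.F₀ B) ∘ (L.F₁ (η A) ⊗₁ L.F₁ (η B)))
          ≈⟨ assoc ⟨
        (L.F₁ (G.φ⇒ A B) ∘ L.φ⇒ (G.F₀ A) (G.F₀ B)) ∘ (L.F₁ (η A) ⊗₁ L.F₁ (η B)) ∎
    ; monoidal-unit = pullˡ (trans (sym L.F-∘) (L.F-resp-≈ monoidal-unit))
    }
    where
    open MonoidalFamily M
    module F = MarkovFunctor F
    module G = MarkovFunctor G

  -- The isomorphism is the extension of the reorderings `w` from types to lists. Its naturality on
  -- generators needs a common image for each query, which is the last hypothesis; inverses and
  -- agreement with `τ` need only be checked on single types.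
  sameDownward : (D D′ : DownwardAbstraction L H) →
    (w : ∀ x → onType (DownwardAbstraction.π D) x ↭ onType (DownwardAbstraction.π D′) x) →
    (∀ x → Transformation.η (DownwardAbstraction.τ D′) (x ∷ []) ∘ L.F₁ (DL.permute (w x))
             ≈ Transformation.η (DownwardAbstraction.τ D) (x ∷ [])) →
    (∀ q → ∃[ q′ ] Unique (QL.dom q′) × Unique (QL.cod q′) ×
                   SendsToQuery (DownwardAbstraction.π D) q q′ ×
                   SendsToQuery (DownwardAbstraction.π D′) q q′) →
    SameDownward L H D D′
  sameDownward D D′ w agree same-query = record
    { iso = record
      { forward = transformation D.π D′.π E.family
          (E.extend-deterministic (λ x → DLP.permute-deterministic (w x)))
          (λ q → let _ , dom! , cod! , s , s′ = same-query q in
            generator-natural E.family w E.extend-single dom! cod! s s′)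
      ; η⇐     = E⇐.extend
      ; η-isoˡ = family-unique (∘-family E⇐.family E.family) id-family λ x →
          DL.trans (DL.∘-resp-≈ (E⇐.extend-single x) (E.extend-single x)) (DLP.permute-isoˡ (w x))
      ; η-isoʳ = family-unique (∘-family E.family E⇐.family) id-family λ x →
          DL.trans (DL.∘-resp-≈ (E.extend-single x) (E⇐.extend-single x)) (DL.permute-isoʳ (w x))
      }
    ; reorders = λ x → w x , E.extend-single x
    ; τ-agree  = family-unique (∘-family (transformation-family D′.τ) (whisker E.family))
        (transformation-family D.τ)
        (λ x → trans (∘-respʳ (L.F-resp-≈ (E.extend-single x))) (agree x))
    }
    where
    module D = DownwardAbstraction D
    module D′ = DownwardAbstraction D′
    module E  = Extension D.π D′.π (λ x → DL.permute (w x))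
    module E⇐ = Extension D′.π D.π (λ x → DL.permute (↭-sym (w x)))

-- Constructive abstractions and Do queries

module DoProperties {o ℓ e} {C : MarkovCategory o ℓ e} (M : CausalModel C) where
  open MarkovCategory C
  open CausalModel M
  open DoQuery
  open InterpretationProperties (DoSignature M) C obj
    (λ q → doChannel M (intervened q) (observed q)) public
  open TensorProperties C obj public

  dom-unique : ∀ S → .(S ⊆ nonInputs) → Unique (elements inputs ++ elements S)
  dom-unique S S⊆ = Unique.++⁺ (elements-unique inputs) (elements-unique S) λ (i , j) →
    ⊥-elim-irr (x∈∁p⇒x∉p (S⊆ (∈-elements⁻ j)) (∈-elements⁻ i))

  query-dom-unique : ∀ q → Unique (Signature.dom (DoSignature M) q)
  query-dom-unique record { intervened = S ; intervened⊆ = S⊆ } = dom-unique S S⊆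

  doChannel-marginal : ∀ S → .(S ⊆ nonInputs) → ∀ O O′ (O⊆ : O ⊆ O′) →
    select (elements O) (λ i → ∈-elements⁺ (O⊆ (∈-elements⁻ i))) ∘ doChannel M S O′ ≈ doChannel M S O
  doChannel-marginal S S⊆ O O′ O⊆ =
    ScheduleProperties.composite-marginal (Do M S) (dom-unique S S⊆) _ _ covers
      (elements O) (elements O′) _
    where
    covers : elements inputs ++ elements S ⊆ₗ elements (inputs ∪ S)
    covers i with ∈-++⁻ (elements inputs) i
    ... | inj₁ j = ∈-elements⁺ (x∈p∪q⁺ (inj₁ (∈-elements⁻ j)))
    ... | inj₂ j = ∈-elements⁺ (x∈p∪q⁺ (inj₂ (∈-elements⁻ j)))

module _ {o ℓ e} {C : MarkovCategory o ℓ e} (L H : CausalModel C) where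
  open MarkovCategory C
  open Reasoning C
  open Coherence C
  open MarkovProperties C
  private
    module L = CausalModel L
    module H = CausalModel H
    module LP = DoProperties L
    module HP = DoProperties H
    module IL = MarkovFunctor (doModel L)
    module IH = MarkovFunctor (doModel H)
    module DL = Diagrams (DoSignature L)
    module DH = Diagrams (DoSignature H)
    module DLP = DiagramProperties (DoSignature L)
    module QL = Signature (DoSignature L)
    module QH = Signature (DoSignature H)
    module D = DoAbstraction {C = C} {L = L} {H = H}
    module A = ConstructiveAbstraction {C = C} {L = L} {H = H}

    -- The superscript ᵈ fixes the two signatures: unification can recover Q from
    -- Free Q only by unfolding Free.
    Functorᵈ : Set
    Functorᵈ = MarkovFunctor (Free (DoSignature H)) (Free (DoSignature L))

    onTypeᵈ : Functorᵈ → H.Vertex → List L.Vertex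
    onTypeᵈ = onType {DoSignature L} {DoSignature H}

    onTypesᵈ : Functorᵈ → List H.Vertex → List L.Vertex
    onTypesᵈ = onTypes {DoSignature L} {DoSignature H}

    φ*ᵈ : ∀ (F : Functorᵈ) A → DL.Diagram (onTypesᵈ F A) (MarkovFunctor.F₀ F A)
    φ*ᵈ = φ* {DoSignature L} {DoSignature H}

    SendsToQueryᵈ : Functorᵈ → DoQuery H → DoQuery L → Set
    SendsToQueryᵈ = SendsToQuery {DoSignature L} {DoSignature H}

    component-of : ∀ (D : DoAbstraction L H) x → L.⨂ (onTypeᵈ (D.π D) x) ⇒ H.⨂ (x ∷ [])
    component-of D x = Transformation.η (D.τ D) (x ∷ [])

  module _ {π : H.Vertex → Subset L.size} (τ : ∀ x → L.⨂ (elements (π x)) ⇒ H.obj x) where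
    open Images L H π

    module _ {F : Functorᵈ}
             (M : MonoidalFamily {D = C} {Q = DoSignature H} (doModel L ∘F F) (doModel H))
             (p : ∀ x → onTypeᵈ F x ↭ elements (π x)) where
      open MonoidalFamily M
      private
        module F = MarkovFunctor F

      -- The bridge between naturality squares and consistency equations, crossed in both
      -- directions. `φ*ᵈ` splits `F₀ A` into blocks; on the block of `x` the family is `τ x` after
      -- a reordering, with a trailing unit that `ρ⇒` removes.
      family-tensor : (∀ x → τ x ∘ L.permute (p x) ≈ ρ⇒ ∘ η (x ∷ [])) →
        ∀ A → η A ∘ IL.F₁ (φ*ᵈ F A) ≈ tensor τ A ∘ L.permute (concatMap-↭ p A)
      family-tensor sq []      = trans (∘-respʳ (sym identityʳ)) (trans monoidal-unit (sym identityˡ))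
      family-tensor sq (x ∷ A) = epi (IL.φ-isoʳ (onTypeᵈ F x) (onTypesᵈ F A)) (begin
        (η (x ∷ A) ∘ (IL.F₁ (F.φ⇒ (x ∷ []) A) ∘ IL.F₁ (DL.id {onTypeᵈ F x} DL.⊗ φ*ᵈ F A)))
          ∘ IL.φ⇒ (onTypeᵈ F x) (onTypesᵈ F A)
          ≈⟨ pullʳ (pullʳ (IL.φ-natural (DL.id {onTypeᵈ F x}) (φ*ᵈ F A))) ⟩
        η (x ∷ A) ∘ (IL.F₁ (F.φ⇒ (x ∷ []) A) ∘ (IL.φ⇒ (onTypeᵈ F x) (F.F₀ A) ∘ (id ⊗₁ IL.F₁ (φ*ᵈ F A))))
          ≈⟨ ∘-respʳ (sym assoc) ⟩
        η (x ∷ A) ∘ ((IL.F₁ (F.φ⇒ (x ∷ []) A) ∘ IL.φ⇒ (onTypeᵈ F x) (F.F₀ A)) ∘ (id ⊗₁ IL.F₁ (φ*ᵈ F A)))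
          ≈⟨ extendʳ (monoidal (x ∷ []) A) ⟩
        IH.φ⇒ (x ∷ []) A ∘ ((η (x ∷ []) ⊗₁ η A) ∘ (id ⊗₁ IL.F₁ (φ*ᵈ F A)))
          ≈⟨ ∘-resp-≈ (HP.⨂-∷⇒ x A) (trans (sym ⊗-∘) (⊗-resp-≈ identityʳ (family-tensor sq A))) ⟩
        (ρ⇒ ⊗₁ id) ∘ (η (x ∷ []) ⊗₁ (tensor τ A ∘ L.permute (concatMap-↭ p A)))
          ≈⟨ trans (sym ⊗-∘) (⊗-resp-≈ (sym (sq x)) identityˡ) ⟩
        (τ x ∘ L.permute (p x)) ⊗₁ (tensor τ A ∘ L.permute (concatMap-↭ p A))
          ≈⟨ ⊗-∘ ⟩
        (τ x ⊗₁ tensor τ A) ∘ (L.permute (p x) ⊗₁ L.permute (concatMap-↭ p A))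
          ≈⟨ ∘-respʳ (cancelˡ (IL.φ-isoˡ (elements (π x)) (πs A))) ⟨
        (τ x ⊗₁ tensor τ A) ∘ (L.⨂-++⇐ (elements (π x)) (πs A) ∘
          (L.⨂-++⇒ (elements (π x)) (πs A) ∘ (L.permute (p x) ⊗₁ L.permute (concatMap-↭ p A))))
          ≈⟨ ∘-respʳ (∘-respʳ (LP.permute-++⁺ (p x) (concatMap-↭ p A))) ⟨
        (τ x ⊗₁ tensor τ A) ∘ (L.⨂-++⇐ (elements (π x)) (πs A) ∘
          (L.permute (concatMap-↭ p (x ∷ A)) ∘ L.⨂-++⇒ (onTypeᵈ F x) (onTypesᵈ F A)))
          ≈⟨ trans (sym assoc) (sym assoc) ⟩
        (tensor τ (x ∷ A) ∘ L.permute (concatMap-↭ p (x ∷ A))) ∘ L.⨂-++⇒ (onTypeᵈ F x) (onTypesᵈ F A) ∎)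

  -- A reordering of listings forces the subsets to be equal. It is then a reordering of a list
  -- without repetitions to itself, hence acts as the identity.
  component-unique : ∀ {x} {P P′ : Subset L.size} {f : L.⨂ (elements P) ⇒ H.obj x}
    {f′ : L.⨂ (elements P′) ⇒ H.obj x} (r : elements P ↭ elements P′) → f ≈ f′ ∘ L.permute r →
    Σ[ eq ∈ P ≡ P′ ] ≡.subst (λ P → L.⨂ (elements P) ⇒ H.obj x) eq f ≈ f′
  component-unique {P = P} r f≈ with elements-injective r
  ... | ≡.refl = ≡.refl ,
    trans f≈ (trans (∘-respʳ (LP.permute-coherent (elements-unique P) r _↭_.refl)) identityʳ)

  component-transport : ∀ {x A X} {P P′ : Subset L.size} {f : L.⨂ (elements P) ⇒ H.obj x}
    {f′ : L.⨂ (elements P′) ⇒ H.obj x} {g : L.⨂ A ⇒ X} {k : X ⇒ H.obj x} →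
    Σ[ eq ∈ P ≡ P′ ] ≡.subst (λ P → L.⨂ (elements P) ⇒ H.obj x) eq f ≈ f′ →
    Σ[ p ∈ A ↭ elements P′ ] f′ ∘ L.permute p ≈ k ∘ g →
    Σ[ p ∈ A ↭ elements P ] f ∘ L.permute p ≈ k ∘ g
  component-transport (≡.refl , f≈f′) (p , sq) = p , trans (∘-respˡ f≈f′) sq

  -- The clause `reorders` is essential: it makes the isomorphism of functors a permutation on each
  -- type, so that both abstractions assign the same subset to a variable.
  restrictsTo-cong : ∀ {D D′ : DoAbstraction L H} {A A′ : ConstructiveAbstraction L H} →
    SameDownward (doModel L) (doModel H) (D.downward D) (D.downward D′) →
    RestrictsTo L H D A → RestrictsTo L H D′ A′ → SameConstructive L H A A′
  restrictsTo-cong {D} {D′} {A} {A′} s R R′ x with R x | R′ x | SameDownward.reorders s x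
  ... | p , sq | p′ , sq′ | w , η≈w = component-unique (_↭_.trans (_↭_.trans (↭-sym p) w) p′) (begin
    A.τ A x
      ≈⟨ cancelʳ (LP.permute-isoʳ p) ⟨
    (A.τ A x ∘ L.permute p) ∘ L.permute (↭-sym p)
      ≈⟨ ∘-respˡ (trans sq (∘-respʳ (sym (SameDownward.τ-agree s (x ∷ []))))) ⟩
    (ρ⇒ ∘ (component-of D′ x ∘ IL.F₁ (SameDownward.iso s .MonoidalIsomorphism.η (x ∷ []))))
      ∘ L.permute (↭-sym p)
      ≈⟨ ∘-respˡ (pullˡ (sym sq′)) ⟩
    ((A.τ A′ x ∘ L.permute p′) ∘ IL.F₁ (SameDownward.iso s .MonoidalIsomorphism.η (x ∷ [])))
      ∘ L.permute (↭-sym p)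
      ≈⟨ ∘-respˡ (∘-respʳ (trans (IL.F-resp-≈ η≈w) (LP.⟦permute⟧ w))) ⟩
    ((A.τ A′ x ∘ L.permute p′) ∘ L.permute w) ∘ L.permute (↭-sym p)
      ≈⟨ trans assoc assoc ⟩
    A.τ A′ x ∘ (L.permute p′ ∘ (L.permute w ∘ L.permute (↭-sym p))) ∎)

  -- The intervened set can be recovered from the domain because it is disjoint from the inputs
  -- listed before it. The inclusions are irrelevant, so the two sets determine the query.
  query-unique : ∀ {q q′ : DoQuery L} → QL.dom q ↭ QL.dom q′ → QL.cod q ↭ QL.cod q′ → q ≡ q′
  query-unique {record { intervened = S ; observed = O ; intervened⊆ = S⊆ }}
               {record { intervened = S′ ; observed = O′ ; intervened⊆ = S′⊆ }} p r
    with ⊆-antisym (inclusion S⊆ p) (inclusion S′⊆ (↭-sym p)) | elements-injective r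
    where
    inclusion : ∀ {S S′} → .(S ⊆ L.nonInputs) →
      elements L.inputs ++ elements S ↭ elements L.inputs ++ elements S′ → S ⊆ S′
    inclusion S⊆ p x∈S with ∈-++⁻ (elements L.inputs) (∈-resp-↭ p (∈-++⁺ʳ (elements L.inputs) (∈-elements⁺ x∈S)))
    ... | inj₁ i = ⊥-elim-irr (x∈∁p⇒x∉p (S⊆ x∈S) (∈-elements⁻ i))
    ... | inj₂ i = ∈-elements⁻ i
  ... | ≡.refl | ≡.refl = ≡.refl

  common-query : ∀ (F G : Functorᵈ) →
    (∀ x → onTypeᵈ F x ↭ onTypeᵈ G x) →
    ∀ q → ∃[ q′ ] SendsToQueryᵈ F q q′ →
    ∃[ q′ ] SendsToQueryᵈ G q q′ →
    ∃[ q′ ] Unique (QL.dom q′) × Unique (QL.cod q′) ×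
      SendsToQueryᵈ F q q′ × SendsToQueryᵈ G q q′
  common-query F G w q (q₁ , s@(p , r , _)) (q₂ , s′@(p′ , r′ , _))
    with query-unique {q₁} {q₂}
           (_↭_.trans p (_↭_.trans (concatMap-↭ w (QH.dom q)) (↭-sym p′)))
           (_↭_.trans r (_↭_.trans (concatMap-↭ w (QH.cod q)) (↭-sym r′)))
  ... | ≡.refl = q₁ , LP.query-dom-unique q₁ , elements-unique (DoQuery.observed q₁) , s , s′

  restrictsTo-injective : ∀ {D D′ : DoAbstraction L H} {A : ConstructiveAbstraction L H} →
    RestrictsTo L H D A → RestrictsTo L H D′ A →
    SameDownward (doModel L) (doModel H) (D.downward D) (D.downward D′)
  restrictsTo-injective {D} {D′} {A} R R′ =
    sameDownward (D.downward D) (D.downward D′) w agree same-query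
    where
    w : ∀ x → onTypeᵈ (D.π D) x ↭ onTypeᵈ (D.π D′) x
    w x with R x | R′ x
    ... | p , _ | p′ , _ = _↭_.trans p (↭-sym p′)

    agree : ∀ x → component-of D′ x ∘ IL.F₁ (DL.permute (w x))
                    ≈ component-of D x
    agree x with R x | R′ x
    ... | p , sq | p′ , sq′ = mono ρ-isoˡ (begin
      ρ⇒ ∘ (component-of D′ x ∘ IL.F₁ (DL.permute (_↭_.trans p (↭-sym p′))))
        ≈⟨ pullˡ (sym sq′) ⟩
      (A.τ A x ∘ L.permute p′) ∘ IL.F₁ (DL.permute (_↭_.trans p (↭-sym p′)))
        ≈⟨ ∘-respʳ (LP.⟦permute⟧ (_↭_.trans p (↭-sym p′))) ⟩
      (A.τ A x ∘ L.permute p′) ∘ (L.permute (↭-sym p′) ∘ L.permute p)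
        ≈⟨ pullʳ (cancelˡ (LP.permute-isoʳ p′)) ⟩
      A.τ A x ∘ L.permute p
        ≈⟨ sq ⟩
      ρ⇒ ∘ component-of D x ∎)

    same-query : ∀ q → ∃[ q′ ] Unique (QL.dom q′) × Unique (QL.cod q′) ×
                   SendsToQuery (D.π D) q q′ × SendsToQuery (D.π D′) q q′
    same-query q = common-query (D.π D) (D.π D′) w q (D.queries D q) (D.queries D′ q)

  -- Action of an alignment on queries

  module Alignment (π : H.Vertex → Subset L.size) (disjoint : ∀ {x y} → x ≢ y → Empty (π x ∩ π y))
                   (π-inputs : ⋃ (map π (elements H.inputs)) ≡ L.inputs)
                   (π-outputs : ⋃ (map π (elements H.outputs)) ⊆ L.outputs) where
    open Images L H π

    πs-unique : ∀ {A} → Unique A → Unique (πs A)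
    πs-unique = Unique-concatMap⁺ (elements ∘′ π) (λ x → elements-unique (π x))
      (λ x≢y (i , j) → disjoint x≢y (_ , x∈p∩q⁺ (∈-elements⁻ i , ∈-elements⁻ j)))

    π*-↭ : ∀ S → πs (elements S) ↭ elements (π* S)
    π*-↭ S = elements-⋃ π disjoint (elements-unique S)

    π*-dom : ∀ S → πs (elements H.inputs ++ elements S) ↭ elements L.inputs ++ elements (π* S)
    π*-dom S = _↭_.trans (↭-reflexive (concatMap-++ (elements ∘′ π) (elements H.inputs) (elements S)))
      (++⁺ (≡.subst (λ I → πs (elements H.inputs) ↭ elements I) π-inputs (π*-↭ H.inputs)) (π*-↭ S))

    π*-∈⁻ : ∀ S {v} → v ∈ π* S → ∃[ x ] x ∈ S × v ∈ π x
    π*-∈⁻ S v∈ with find (∈-concatMap⁻ (elements ∘′ π) (∈-⋃⁻ π (elements S) v∈))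
    ... | x , i , j = x , ∈-elements⁻ i , ∈-elements⁻ j

    π*-∈⁺ : ∀ {S x v} → x ∈ S → v ∈ π x → v ∈ π* S
    π*-∈⁺ {S} x∈S v∈x =
      ∈-⋃⁺ π (elements S) (∈-concatMap⁺ (elements ∘′ π) (lose (∈-elements⁺ x∈S) (∈-elements⁺ v∈x)))

    π*-monotone : ∀ {S S′} → S ⊆ S′ → π* S ⊆ π* S′
    π*-monotone {S} S⊆S′ v∈ with π*-∈⁻ S v∈
    ... | x , x∈S , v∈x = π*-∈⁺ (S⊆S′ x∈S) v∈x

    -- By `π-inputs`, a low-level input lies in the block of a high-level input. Disjointness keeps
    -- it out of the blocks of the non-inputs.
    π*-nonInputs : ∀ {S} → S ⊆ H.nonInputs → π* S ⊆ L.nonInputs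
    π*-nonInputs {S} S⊆ {v} v∈ = x∉p⇒x∈∁p v∉
      where
      v∉ : v ∉ L.inputs
      v∉ v∈in with π*-∈⁻ S v∈ | π*-∈⁻ H.inputs (≡.subst (v ∈_) (≡.sym π-inputs) v∈in)
      ... | x , x∈S , v∈x | y , y∈in , v∈y with x Fin.≟ y
      ...   | yes ≡.refl = x∈∁p⇒x∉p (S⊆ x∈S) y∈in
      ...   | no x≢y     = disjoint x≢y (v , x∈p∩q⁺ (v∈x , v∈y))

    image : DoQuery H → DoQuery L
    image record { intervened = S ; observed = O ; intervened⊆ = S⊆ ; observed⊆ = O⊆ } = record
      { intervened  = π* S
      ; observed    = π* O
      ; intervened⊆ = π*-nonInputs S⊆
      ; observed⊆   = λ v∈ → π-outputs (π*-monotone O⊆ v∈)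
      }

    image-dom : ∀ q → πs (QH.dom q) ↭ QL.dom (image q)
    image-dom q = π*-dom (DoQuery.intervened q)

    image-cod : ∀ q → πs (QH.cod q) ↭ QL.cod (image q)
    image-cod q = π*-↭ (DoQuery.observed q)

  doQuery : ∀ S O → .(S ⊆ H.nonInputs) → .(O ⊆ H.outputs) → DoQuery H
  doQuery S O S⊆ O⊆ = record { intervened = S ; observed = O ; intervened⊆ = S⊆ ; observed⊆ = O⊆ }

  vertices : List H.Vertex
  vertices = elements H.inputs ++ elements H.nonInputs

  ∈-vertices : ∀ x → x ∈ₗ vertices
  ∈-vertices x with x ∈? H.inputs
  ... | yes x∈ = ∈-++⁺ˡ (∈-elements⁺ x∈)
  ... | no  x∉ = ∈-++⁺ʳ (elements H.inputs) (∈-elements⁺ (x∉p⇒x∈∁p x∉))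

  observed-outputs : ∀ (q : DoQuery L) {P} → elements (DoQuery.observed q) ↭ elements P → P ⊆ L.outputs
  observed-outputs record { observed = O ; observed⊆ = O⊆ } r with elements-injective {p = O} r
  ... | ≡.refl = ⊆-recompute O⊆

  -- From downward to constructive abstractions

  module Restriction
    (F : Functorᵈ)
    (queries : ∀ q → ∃[ q′ ] SendsToQueryᵈ F q q′)
    (M : MonoidalFamily {D = C} {Q = DoSignature H} (doModel L ∘F F) (doModel H))
    (inputs : onTypesᵈ F (elements H.inputs) ↭ elements L.inputs)
    where
    open MonoidalFamily M
    private
      module F = MarkovFunctor F

    -- Intervening on all non-inputs yields a query whose domain lists all of V_H, so
    -- distinctness of the domain of its image makes the π(X) disjoint.
    vertices-unique : Unique (concatMap (onTypeᵈ F) vertices)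
    vertices-unique =
      let q′ , p , _ = queries (doQuery H.nonInputs ⊥ (λ i → i) ⊥⊆) in
      Unique-resp-↭ p (LP.query-dom-unique q′)

    π : H.Vertex → Subset L.size
    π x = support (onTypeᵈ F x)

    p : ∀ x → onTypeᵈ F x ↭ elements (π x)
    p x = elements-support (Unique-concatMap⁻ (onTypeᵈ F) {vertices} vertices-unique (∈-vertices x))

    disjoint : ∀ {x y} → x ≢ y → Empty (π x ∩ π y)
    disjoint {x} {y} x≢y (v , v∈) =
      let v∈x , v∈y = x∈p∩q⁻ (π x) (π y) v∈ in
      Disjoint-concatMap⁻ (onTypeᵈ F) {vertices} vertices-unique (∈-vertices x) (∈-vertices y) x≢y
        (∈-support⁻ (onTypeᵈ F x) v∈x , ∈-support⁻ (onTypeᵈ F y) v∈y)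

    open Images L H π

    τ : ∀ x → L.⨂ (elements (π x)) ⇒ H.obj x
    τ x = ρ⇒ ∘ (η (x ∷ []) ∘ L.permute (↭-sym (p x)))

    τ-square : ∀ x → τ x ∘ L.permute (p x) ≈ ρ⇒ ∘ η (x ∷ [])
    τ-square x = pullʳ (cancelʳ (LP.permute-isoˡ (p x)))

    τ-tensor : ∀ A → η A ∘ IL.F₁ (φ*ᵈ F A) ≈ tensor τ A ∘ L.permute (concatMap-↭ p A)
    τ-tensor = family-tensor {π = π} τ {F = F} M p τ-square

    ⟦φ*⟧-isoʳ : ∀ A → IL.F₁ (φ*ᵈ F A) ∘ IL.F₁ (φ*⇐ {DoSignature L} {DoSignature H} F A) ≈ id
    ⟦φ*⟧-isoʳ A = IL.F-resp-≈ (φ*-isoʳ {DoSignature L} {DoSignature H} F A)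

    onTypes-↭ : ∀ S → onTypesᵈ F (elements S) ↭ elements (⋃ (map π (elements S)))
    onTypes-↭ S = _↭_.trans (concatMap-↭ p (elements S)) (elements-⋃ π disjoint (elements-unique S))

    π-inputs : π* H.inputs ≡ L.inputs
    π-inputs = elements-injective (_↭_.trans (↭-sym (onTypes-↭ H.inputs)) inputs)

    π-outputs : π* H.outputs ⊆ L.outputs
    π-outputs =
      -- The query without intervention that observes all outputs: its image observes exactly the
      -- blocks of the outputs, and a query of `L` observes only outputs of `L`.
      let q′ , _ , r , _ = queries (doQuery ⊥ H.outputs ⊥⊆ (λ i → i)) in
      observed-outputs q′ (_↭_.trans r (onTypes-↭ H.outputs))

    open Alignment π disjoint π-inputs π-outputs

    -- The low-level query is a parameter so that the statement can be transported from the query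
    -- provided by the functor to `image q`.
    Consistent : DoQuery H → DoQuery L → Set e
    Consistent q q′ =
      Σ[ s ∈ πs (QH.dom q) ↭ QL.dom q′ ]
      Σ[ r ∈ QL.cod q′ ↭ πs (QH.cod q) ]
        tensor τ (QH.cod q) ∘ (L.permute r ∘ (IL.F₁ (DL.gen q′) ∘ L.permute s))
          ≈ IH.F₁ (DH.gen q) ∘ tensor τ (QH.dom q)

    consistent : (∀ q → η (QH.cod q) ∘ IL.F₁ (F.F₁ (DH.gen q)) ≈ IH.F₁ (DH.gen q) ∘ η (QH.dom q)) →
                 ∀ q → Consistent q (image q)
    consistent natural q = from-query (queries q)
      where
      from-query : ∃[ q′ ] SendsToQueryᵈ F q q′ → Consistent q (image q)
      -- Naturality at `q`, precomposed with `φ*`, becomes an equation between tensors of the `τ x`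
      -- by `τ-tensor`. It concerns the unspecified `q′`, which `query-unique` identifies with
      -- `image q`.
      from-query (q′ , s , r , eq) = ≡.subst (Consistent q)
        (query-unique {q′} {image q}
          (_↭_.trans s (_↭_.trans (concatMap-↭ p (QH.dom q)) (image-dom q)))
          (_↭_.trans r (_↭_.trans (concatMap-↭ p (QH.cod q)) (image-cod q))))
        (_↭_.trans (↭-sym (concatMap-↭ p (QH.dom q))) (↭-sym s) ,
        _↭_.trans r (concatMap-↭ p (QH.cod q)) ,
        (begin
        tensor τ (QH.cod q) ∘ ((L.permute (concatMap-↭ p (QH.cod q)) ∘ L.permute r) ∘
          (IL.F₁ (DL.gen q′) ∘ (L.permute (↭-sym s) ∘ L.permute (↭-sym (concatMap-↭ p (QH.dom q))))))
          ≈⟨ trans (∘-respʳ assoc) (pullˡ (sym (τ-tensor (QH.cod q)))) ⟩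
        (η (QH.cod q) ∘ IL.F₁ (φ*ᵈ F (QH.cod q))) ∘ (L.permute r ∘
          (IL.F₁ (DL.gen q′) ∘ (L.permute (↭-sym s) ∘ L.permute (↭-sym (concatMap-↭ p (QH.dom q))))))
          ≈⟨ trans assoc (∘-respʳ (∘-respʳ (∘-respˡ (sym (LP.⟦permute⟧ r))))) ⟩
        η (QH.cod q) ∘ (IL.F₁ (φ*ᵈ F (QH.cod q)) ∘ (IL.F₁ (DL.permute r) ∘
          (IL.F₁ (DL.gen q′) ∘ (L.permute (↭-sym s) ∘ L.permute (↭-sym (concatMap-↭ p (QH.dom q)))))))
          ≈⟨ ∘-respʳ (trans (∘-respʳ (sym assoc)) (trans (sym assoc) (∘-respˡ (IL.F-resp-≈ (DL.sym eq))))) ⟩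
        η (QH.cod q) ∘ ((IL.F₁ (F.F₁ (DH.gen q)) ∘ (IL.F₁ (φ*ᵈ F (QH.dom q)) ∘ IL.F₁ (DL.permute s))) ∘
          (L.permute (↭-sym s) ∘ L.permute (↭-sym (concatMap-↭ p (QH.dom q)))))
          ≈⟨ ∘-respʳ (trans assoc (∘-respʳ (pullʳ (trans (∘-respˡ (LP.⟦permute⟧ s)) (cancelˡ (LP.permute-isoʳ s)))))) ⟩
        η (QH.cod q) ∘ (IL.F₁ (F.F₁ (DH.gen q)) ∘ (IL.F₁ (φ*ᵈ F (QH.dom q)) ∘
          L.permute (↭-sym (concatMap-↭ p (QH.dom q)))))
          ≈⟨ extendʳ (natural q) ⟩
        IH.F₁ (DH.gen q) ∘ (η (QH.dom q) ∘ (IL.F₁ (φ*ᵈ F (QH.dom q)) ∘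
          L.permute (↭-sym (concatMap-↭ p (QH.dom q)))))
          ≈⟨ ∘-respʳ (trans (pullˡ (τ-tensor (QH.dom q))) (cancelʳ (LP.permute-isoʳ (concatMap-↭ p (QH.dom q))))) ⟩
        IH.F₁ (DH.gen q) ∘ tensor τ (QH.dom q) ∎))

    constructive : (∀ q → η (QH.cod q) ∘ IL.F₁ (F.F₁ (DH.gen q)) ≈ IH.F₁ (DH.gen q) ∘ η (QH.dom q)) →
                   (∀ A → Deterministic (η A)) → (∀ A → Epic (η A)) → ConstructiveAbstraction L H
    constructive natural det epic = record
      { alignment = record
        { π               = π
        ; disjoint        = disjoint
        ; π-inputs        = π-inputs
        ; π-outputs       = π-outputs
        ; τ               = τ
        ; τ-epic          = λ x → epic-∘ (split-epic ρ-isoʳ)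
            (epic-∘ (epic (x ∷ [])) (split-epic (LP.permute-isoˡ (p x))))
        ; τ-deterministic = λ x → ∘-deterministic ρ-deterministic
            (∘-deterministic (det (x ∷ [])) (LP.permute-deterministic (↭-sym (p x))))
        -- By `τ-tensor`, a reordering followed by `tensor τ A` is a split epic followed by the epic
        -- `η A`. Maps that agree after `tensor τ A` therefore agree after this epic composite.
        ; τ⊗-epic         = λ A h k eq → epic-∘ (epic A) (split-epic (⟦φ*⟧-isoʳ A)) h k
            (trans (∘-respʳ (τ-tensor A)) (trans (sym assoc)
              (trans (∘-respˡ eq) (trans assoc (∘-respʳ (sym (τ-tensor A)))))))
        }
      ; consistent = λ S S⊆ → consistent natural (doQuery S H.outputs S⊆ (λ i → i))
      }

  restrict : ∀ D → Σ[ A ∈ ConstructiveAbstraction L H ] RestrictsTo L H D A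
  restrict D = constructive (λ q → T.natural (DH.gen q)) T.deterministic (D.τ-epic D) ,
    λ x → p x , τ-square x
    where
    module T = Transformation (D.τ D)
    open Restriction (D.π D) (D.queries D) (transformation-family (D.τ D)) (D.inputs D)

  -- Marginals of tensors of components

  module _ {π : H.Vertex → Subset L.size} (τ : ∀ x → L.⨂ (elements (π x)) ⇒ H.obj x) where
    open Images L H π

    ⨂-++⇐-deterministic : ∀ A B → Deterministic (L.⨂-++⇐ A B)
    ⨂-++⇐-deterministic A B =
      inverse-deterministic (IL.φ-isoʳ A B) (IL.φ-isoˡ A B) (IL.φ-deterministic A B)

    block-⊆ : ∀ {x A} → x ∈ₗ A → elements (π x) ⊆ₗ πs A
    block-⊆ i j = ∈-concatMap⁺ (elements ∘′ π) (lose i j)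

    tensor-deterministic : (∀ x → Deterministic (τ x)) → ∀ A → Deterministic (tensor τ A)
    tensor-deterministic d []      = id-deterministic
    tensor-deterministic d (x ∷ A) =
      ∘-deterministic (⊗-deterministic (d x) (tensor-deterministic d A))
        (⨂-++⇐-deterministic (elements (π x)) (πs A))

    project-tensor : ∀ {A} → Unique (πs A) → ∀ {x} (i : x ∈ₗ A) (πx⊆ : elements (π x) ⊆ₗ πs A) →
                     H.project i ∘ tensor τ A ≈ τ x ∘ L.select (elements (π x)) πx⊆
    project-tensor {x ∷ A} u (here ≡.refl) πx⊆ =
      trans (extendʳ fst-⊗) (∘-respʳ
        (LP.select-++ˡ (elements (π x)) (πs A) πx⊆ u (⨂-++⇐-deterministic (elements (π x)) (πs A))))
    project-tensor {y ∷ A} u {x} (there i) πx⊆ = begin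
      H.project (there i) ∘ ((τ y ⊗₁ tensor τ A) ∘ L.⨂-++⇐ (elements (π y)) (πs A))
        ≈⟨ trans (∘-respˡ (HP.project-there i)) (pullʳ (extendʳ snd-⊗)) ⟩
      H.project i ∘ (tensor τ A ∘ (snd ∘ L.⨂-++⇐ (elements (π y)) (πs A)))
        ≈⟨ pullˡ (project-tensor (proj₁ (proj₂ (Unique-++⁻ (elements (π y)) u))) i
             (block-⊆ i)) ⟩
      (τ x ∘ L.select (elements (π x)) (block-⊆ i)) ∘
        (snd ∘ L.⨂-++⇐ (elements (π y)) (πs A))
        ≈⟨ pullʳ (∘-respʳ (LP.select-++ʳ (elements (π y)) (πs A) (∈-++⁺ʳ (elements (π y))) u
             (⨂-++⇐-deterministic (elements (π y)) (πs A)))) ⟩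
      τ x ∘ (L.select (elements (π x)) (block-⊆ i) ∘
        L.select (πs A) (∈-++⁺ʳ (elements (π y))))
        ≈⟨ ∘-respʳ (LP.select-∘ u (πs A) (elements (π x)) (block-⊆ i)
             (∈-++⁺ʳ (elements (π y))) πx⊆) ⟩
      τ x ∘ L.select (elements (π x)) πx⊆ ∎

    -- Each output of `tensor τ` reads only its own block, so dropping outputs above amounts to
    -- dropping whole blocks below. Since the `τ x` are deterministic, this can be checked one
    -- output at a time.
    tensor-select : (∀ x → Deterministic (τ x)) → ∀ {A B} → Unique (πs A) → Unique (πs B) →
      (B⊆A : B ⊆ₗ A) (πsB⊆πsA : πs B ⊆ₗ πs A) →
      H.select B B⊆A ∘ tensor τ A ≈ tensor τ B ∘ L.select (πs B) πsB⊆πsA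
    tensor-select d {A} {B} A! B! B⊆A πsB⊆πsA = HP.⨂-unique B
      (∘-deterministic (HP.select-deterministic B B⊆A) (tensor-deterministic d A))
      (∘-deterministic (tensor-deterministic d B) (LP.select-deterministic (πs B) πsB⊆πsA))
      λ {x} i → begin
        H.project i ∘ (H.select B B⊆A ∘ tensor τ A)
          ≈⟨ pullˡ (HP.project-select B B⊆A i) ⟩
        H.project (B⊆A i) ∘ tensor τ A
          ≈⟨ project-tensor A! (B⊆A i) (λ j → πsB⊆πsA (block-⊆ i j)) ⟩
        τ x ∘ L.select (elements (π x)) (λ j → πsB⊆πsA (block-⊆ i j))
          ≈⟨ ∘-respʳ (LP.select-∘ A! (πs B) (elements (π x)) (block-⊆ i) πsB⊆πsA
               (λ j → πsB⊆πsA (block-⊆ i j))) ⟨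
        τ x ∘ (L.select (elements (π x)) (block-⊆ i) ∘ L.select (πs B) πsB⊆πsA)
          ≈⟨ extendʳ (project-tensor B! i (block-⊆ i)) ⟨
        H.project i ∘ (tensor τ B ∘ L.select (πs B) πsB⊆πsA) ∎

  -- From constructive to downward abstractions

  module Realization (A : ConstructiveAbstraction L H) where
    open ConstructiveAbstraction {C = C} {L = L} {H = H} A
    open Alignment π disjoint π-inputs π-outputs

    πs-⊆ : ∀ {A B} → A ⊆ₗ B → πs A ⊆ₗ πs B
    πs-⊆ = concatMap⁺ (elements ∘′ π)

    elements-⊆ : ∀ {n} {P Q : Subset n} → P ⊆ Q → elements P ⊆ₗ elements Q
    elements-⊆ P⊆Q i = ∈-elements⁺ (P⊆Q (∈-elements⁻ i))

    -- A constructive abstraction constrains only the queries observing all outputs;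
    -- the other queries are their marginals.
    consistent-marginal : ∀ S O → S ⊆ H.nonInputs → O ⊆ H.outputs →
      (p : πs (elements H.inputs ++ elements S) ↭ elements L.inputs ++ elements (π* S)) →
      (r : elements (π* O) ↭ πs (elements O)) →
      τ⊗ (elements O) ∘ (L.permute r ∘ (doChannel L (π* S) (π* O) ∘ L.permute p))
        ≈ doChannel H S O ∘ τ⊗ (elements H.inputs ++ elements S)
    consistent-marginal S O S⊆ O⊆ p r = from-outputs (consistent S S⊆)
      where
      Out = H.outputs

      selL : L.⨂ (elements (π* Out)) ⇒ L.⨂ (elements (π* O))
      selL = L.select (elements (π* O)) (elements-⊆ (π*-monotone O⊆))

      selπ : L.⨂ (πs (elements Out)) ⇒ L.⨂ (πs (elements O))
      selπ = L.select (πs (elements O)) (πs-⊆ (elements-⊆ O⊆))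

      selH : H.⨂ (elements Out) ⇒ H.⨂ (elements O)
      selH = H.select (elements O) (elements-⊆ O⊆)

      -- Both sides are selections from the same list without repetitions.
      reorder : (r₀ : elements (π* Out) ↭ πs (elements Out)) →
                L.permute r ∘ selL ≈ selπ ∘ L.permute r₀
      reorder r₀ = begin
        L.permute r ∘ selL
          ≈⟨ ∘-respˡ (LP.permute-select (elements-unique (π* O)) r (∈-resp-↭ (↭-sym r))) ⟩
        L.select (πs (elements O)) (∈-resp-↭ (↭-sym r)) ∘ selL
          ≈⟨ LP.select-∘ Out! (elements (π* O)) (πs (elements O)) (∈-resp-↭ (↭-sym r))
               (elements-⊆ (π*-monotone O⊆)) incl ⟩
        L.select (πs (elements O)) incl
          ≈⟨ LP.select-∘ Out! (πs (elements Out)) (πs (elements O)) (πs-⊆ (elements-⊆ O⊆))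
               (∈-resp-↭ (↭-sym r₀)) incl ⟨
        selπ ∘ L.select (πs (elements Out)) (∈-resp-↭ (↭-sym r₀))
          ≈⟨ ∘-respʳ (LP.permute-select Out! r₀ (∈-resp-↭ (↭-sym r₀))) ⟨
        selπ ∘ L.permute r₀ ∎
        where
        Out! : Unique (elements (π* Out))
        Out! = elements-unique (π* Out)
        incl : πs (elements O) ⊆ₗ elements (π* Out)
        incl i = ∈-resp-↭ (↭-sym r₀) (πs-⊆ (elements-⊆ O⊆) i)

      from-outputs :
        Σ[ p ∈ πs (elements H.inputs ++ elements S) ↭ elements L.inputs ++ elements (π* S) ]
        Σ[ r ∈ elements (π* Out) ↭ πs (elements Out) ]
          τ⊗ (elements Out) ∘ (L.permute r ∘ (doChannel L (π* S) (π* Out) ∘ L.permute p))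
            ≈ doChannel H S Out ∘ τ⊗ (elements H.inputs ++ elements S) →
        τ⊗ (elements O) ∘ (L.permute r ∘ (doChannel L (π* S) (π* O) ∘ L.permute p))
          ≈ doChannel H S O ∘ τ⊗ (elements H.inputs ++ elements S)
      from-outputs (p₀ , r₀ , eq) = begin
        τ⊗ (elements O) ∘ (L.permute r ∘ (doChannel L (π* S) (π* O) ∘ L.permute p))
          ≈⟨ ∘-respʳ (∘-respʳ (∘-resp-≈
               (LP.doChannel-marginal (π* S) (π*-nonInputs S⊆) (π* O) (π* Out) (π*-monotone O⊆))
               (LP.permute-coherent (πs-unique (HP.dom-unique S S⊆)) p₀ p))) ⟨
        τ⊗ (elements O) ∘ (L.permute r ∘ ((selL ∘ doChannel L (π* S) (π* Out)) ∘ L.permute p₀))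
          ≈⟨ ∘-respʳ (trans (∘-respʳ assoc) (extendʳ (reorder r₀))) ⟩
        τ⊗ (elements O) ∘ (selπ ∘ (L.permute r₀ ∘ (doChannel L (π* S) (π* Out) ∘ L.permute p₀)))
          ≈⟨ extendʳ (tensor-select τ τ-deterministic (πs-unique (elements-unique Out))
               (πs-unique (elements-unique O)) (elements-⊆ O⊆) (πs-⊆ (elements-⊆ O⊆))) ⟨
        selH ∘ (τ⊗ (elements Out) ∘ (L.permute r₀ ∘ (doChannel L (π* S) (π* Out) ∘ L.permute p₀)))
          ≈⟨ ∘-respʳ eq ⟩
        selH ∘ (doChannel H S Out ∘ τ⊗ (elements H.inputs ++ elements S))
          ≈⟨ pullˡ (HP.doChannel-marginal S S⊆ O Out O⊆) ⟩
        doChannel H S O ∘ τ⊗ (elements H.inputs ++ elements S) ∎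

    consistent-query : ∀ q (p : πs (QH.dom q) ↭ QL.dom (image q)) (r : QL.cod (image q) ↭ πs (QH.cod q)) →
      τ⊗ (QH.cod q) ∘ (L.permute r ∘ (IL.F₁ (DL.gen (image q)) ∘ L.permute p))
        ≈ IH.F₁ (DH.gen q) ∘ τ⊗ (QH.dom q)
    consistent-query record { intervened = S ; observed = O ; intervened⊆ = S⊆ ; observed⊆ = O⊆ } =
      consistent-marginal S O (⊆-recompute S⊆) (⊆-recompute O⊆)

    -- The parameters isolate what is asked of the functor: up to reordering, it sends each type to
    -- its block and each query to its image, and its structure isomorphisms `φ*ᵈ` are permutations.
    module _ (F : Functorᵈ)
      (t : ∀ (A : List H.Vertex) → onTypesᵈ F A ↭ MarkovFunctor.F₀ F A)
      (t-φ* : ∀ (A : List H.Vertex) → φ*ᵈ F A DL.≈ DL.permute (t A))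
      (p : ∀ (x : H.Vertex) → onTypeᵈ F x ↭ elements (π x))
      (s : ∀ (q : DoQuery H) → MarkovFunctor.F₀ F (QH.dom q) ↭ QL.dom (image q))
      (r : ∀ (q : DoQuery H) → QL.cod (image q) ↭ MarkovFunctor.F₀ F (QH.cod q))
      (F-gen : ∀ (q : DoQuery H) → MarkovFunctor.F₁ F (DH.gen q)
                 DL.≈ DL.permute (r q) DL.∘ (DL.gen (image q) DL.∘ DL.permute (s q)))
      where
      private
        module F = MarkovFunctor F

      component : ∀ x → L.⨂ (onTypeᵈ F x) ⇒ H.⨂ (x ∷ [])
      component x = ρ⇐ ∘ (τ x ∘ L.permute (p x))

      module E = Extension {D = C} {Q = DoSignature H} (doModel L ∘F F) (doModel H) component

      component-square : ∀ x → τ x ∘ L.permute (p x) ≈ ρ⇒ ∘ E.extend (x ∷ [])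
      component-square x = sym (trans (∘-respʳ (E.extend-single x)) (cancelˡ ρ-isoʳ))

      u : ∀ A → F.F₀ A ↭ πs A
      u A = _↭_.trans (↭-sym (t A)) (concatMap-↭ p A)

      extend-τ⊗ : ∀ A → E.extend A ≈ τ⊗ A ∘ L.permute (u A)
      extend-τ⊗ A = begin
        E.extend A
          ≈⟨ cancelʳ (LP.permute-isoʳ (t A)) ⟨
        (E.extend A ∘ L.permute (t A)) ∘ L.permute (↭-sym (t A))
          ≈⟨ ∘-respˡ (∘-respʳ (trans (sym (LP.⟦permute⟧ (t A))) (IL.F-resp-≈ (DL.sym (t-φ* A))))) ⟩
        (E.extend A ∘ IL.F₁ (φ*ᵈ F A)) ∘ L.permute (↭-sym (t A))
          ≈⟨ ∘-respˡ (family-tensor {π = π} τ {F = F} E.family p component-square A) ⟩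
        (τ⊗ A ∘ L.permute (concatMap-↭ p A)) ∘ L.permute (↭-sym (t A))
          ≈⟨ assoc ⟩
        τ⊗ A ∘ L.permute (u A) ∎

      extend-natural : ∀ q → E.extend (QH.cod q) ∘ IL.F₁ (F.F₁ (DH.gen q))
                               ≈ IH.F₁ (DH.gen q) ∘ E.extend (QH.dom q)
      extend-natural q = begin
        E.extend (QH.cod q) ∘ IL.F₁ (F.F₁ (DH.gen q))
          ≈⟨ ∘-resp-≈ (extend-τ⊗ (QH.cod q)) (trans (IL.F-resp-≈ (F-gen q))
               (∘-resp-≈ (LP.⟦permute⟧ (r q)) (∘-respʳ (LP.⟦permute⟧ (s q))))) ⟩
        (τ⊗ (QH.cod q) ∘ L.permute (u (QH.cod q))) ∘
          (L.permute (r q) ∘ (IL.F₁ (DL.gen (image q)) ∘ L.permute (s q)))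
          ≈⟨ trans assoc (∘-respʳ (sym assoc)) ⟩
        τ⊗ (QH.cod q) ∘ (L.permute (_↭_.trans (r q) (u (QH.cod q))) ∘
          (IL.F₁ (DL.gen (image q)) ∘ L.permute (s q)))
          -- The reordering `u` of the domain and its inverse are inserted, so that what precedes
          -- `u` is the left side of a consistency equation.
          ≈⟨ ∘-respʳ (∘-respʳ (∘-respʳ (cancelʳ (LP.permute-isoˡ (u (QH.dom q)))))) ⟨
        τ⊗ (QH.cod q) ∘ (L.permute (_↭_.trans (r q) (u (QH.cod q))) ∘
          (IL.F₁ (DL.gen (image q)) ∘ (L.permute (_↭_.trans (↭-sym (u (QH.dom q))) (s q)) ∘ L.permute (u (QH.dom q)))))
          ≈⟨ trans (∘-respʳ (trans (∘-respʳ (sym assoc)) (sym assoc))) (sym assoc) ⟩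
        (τ⊗ (QH.cod q) ∘ (L.permute (_↭_.trans (r q) (u (QH.cod q))) ∘
          (IL.F₁ (DL.gen (image q)) ∘ L.permute (_↭_.trans (↭-sym (u (QH.dom q))) (s q))))) ∘ L.permute (u (QH.dom q))
          ≈⟨ ∘-respˡ (consistent-query q (_↭_.trans (↭-sym (u (QH.dom q))) (s q))
               (_↭_.trans (r q) (u (QH.cod q)))) ⟩
        (IH.F₁ (DH.gen q) ∘ τ⊗ (QH.dom q)) ∘ L.permute (u (QH.dom q))
          ≈⟨ pullʳ (sym (extend-τ⊗ (QH.dom q))) ⟩
        IH.F₁ (DH.gen q) ∘ E.extend (QH.dom q) ∎

      component-deterministic : ∀ x → Deterministic (component x)
      component-deterministic x =
        ∘-deterministic (inverse-deterministic ρ-isoʳ ρ-isoˡ ρ-deterministic)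
          (∘-deterministic (τ-deterministic x) (LP.permute-deterministic (p x)))

      -- On a list the component is `τ⊗ A` up to reordering, so it is the epicness of the tensor
      -- that enters here.
      extend-epic : ∀ A → Epic (E.extend A)
      extend-epic A h k eq = epic-∘ (τ⊗-epic A) (split-epic (LP.permute-isoʳ (u A))) h k
        (trans (∘-respʳ (sym (extend-τ⊗ A))) (trans eq (∘-respʳ (extend-τ⊗ A))))

      sends : ∀ q → SendsToQueryᵈ F q (image q)
      sends q = permuted-generator {DoSignature L} {DoSignature H} F t t-φ* (s q) (r q) (F-gen q)

      doAbstraction : DoAbstraction L H
      doAbstraction = record
        { downward = record
          { π       = F
          ; queries = λ q → image q , sends q
          ; τ       = transformation {D = C} {Q = DoSignature H} (doModel L ∘F F) (doModel H) E.family
              (E.extend-deterministic component-deterministic) extend-natural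
          ; τ-epic  = extend-epic
          }
        ; inputs   = _↭_.trans (concatMap-↭ p (elements H.inputs))
            (≡.subst (λ I → πs (elements H.inputs) ↭ elements I) π-inputs (π*-↭ H.inputs))
        }

      doAbstraction-restricts : RestrictsTo L H doAbstraction A
      doAbstraction-restricts x = p x , component-square x

    F₀ : List H.Vertex → List L.Vertex
    F₀ = Tensor.⨂ (Free (DoSignature L)) (λ x → elements (π x))

    F₀≡πs : ∀ A → F₀ A ≡ πs A
    F₀≡πs []      = ≡.refl
    F₀≡πs (x ∷ A) = ≡.cong (elements (π x) ++_) (F₀≡πs A)

    F-dom : ∀ q → F₀ (QH.dom q) ↭ QL.dom (image q)
    F-dom q = _↭_.trans (↭-reflexive (F₀≡πs (QH.dom q))) (image-dom q)

    F-cod : ∀ q → QL.cod (image q) ↭ F₀ (QH.cod q)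
    F-cod q = _↭_.trans (↭-sym (image-cod q)) (↭-reflexive (≡.sym (F₀≡πs (QH.cod q))))

    F-query : ∀ q → DL.Diagram (F₀ (QH.dom q)) (F₀ (QH.cod q))
    F-query q = DL.permute (F-cod q) DL.∘ (DL.gen (image q) DL.∘ DL.permute (F-dom q))

    -- An instance of the universal property of the free category of `H`, with another free category
    -- as its target. On a generator it computes to `F-query`.
    F : Functorᵈ
    F = Interpretation.functor (DoSignature H) (Free (DoSignature L)) (λ x → elements (π x)) F-query

    -- The value of `F₀` on a one-element list is `elements (π x) ++ []`, so the concatenation of
    -- these values carries an extra empty list after each block.
    flatten : ∀ A → onTypesᵈ F A ↭ F₀ A
    flatten []      = _↭_.refl
    flatten (x ∷ A) = _↭_.trans (++⁺ˡ (elements (π x) ++ []) (flatten A))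
      (↭-reflexive (++-assoc (elements (π x)) [] (F₀ A)))

    flatten-φ* : ∀ A → φ*ᵈ F A DL.≈ DL.permute (flatten A)
    flatten-φ* []      = DL.refl
    flatten-φ* (x ∷ A) = DL.∘-resp-≈
      (DL.trans (DL.∘-resp-≈ DL.⊗-id DL.refl) (DL.trans DL.identityˡ
        (DL.sym (DLP.permute-reflexive (++-assoc (elements (π x)) [] (F₀ A))))))
      (DL.trans (DL.⊗-resp-≈ DL.refl (flatten-φ* A))
        (DL.sym (DLP.permute-++⁺ˡ (elements (π x) ++ []) (flatten A))))

    single : ∀ x → onTypeᵈ F x ↭ elements (π x)
    single x = ↭-reflexive (++-identityʳ (elements (π x)))

    realization : Σ[ D ∈ DoAbstraction L H ] RestrictsTo L H D A
    realization =
      doAbstraction F flatten flatten-φ* single F-dom F-cod (λ q → DL.refl) ,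
      doAbstraction-restricts F flatten flatten-φ* single F-dom F-cod (λ q → DL.refl)

-- The bijection

theorem25 : ∀ {o ℓ e} (C : MarkovCategory o ℓ e) (L H : CausalModel C) →
    CausalModel.nonInputs H ⊆ CausalModel.outputs H →
    Σ[ restrict ∈ Bijection (DoAbstractions L H) (Constructives L H) ]
      (∀ D → RestrictsTo L H D (Bijection.to restrict D))
theorem25 C L H _ = record
  { to        = λ D → proj₁ (restrict L H D)
  ; cong      = λ {D} {D′} s →
      restrictsTo-cong L H {D} {D′} {proj₁ (restrict L H D)} {proj₁ (restrict L H D′)} s
        (proj₂ (restrict L H D)) (proj₂ (restrict L H D′))
  ; bijective =
      -- The restriction of `D′` is transported along `same`, so that both abstractions restrict to
      -- one constructive abstraction.
      (λ {D} {D′} same → restrictsTo-injective L H {D} {D′} {proj₁ (restrict L H D)}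
        (proj₂ (restrict L H D))
        (λ x → component-transport L H (same x) (proj₂ (restrict L H D′) x))) ,
      -- The realization restricts to `A`, and so does, up to equality, every abstraction identified
      -- with it, because restriction respects the identification.
      (λ A → let D , D↦A = Realization.realization L H A in
        D , λ {D′} s → restrictsTo-cong L H {D′} {D} {proj₁ (restrict L H D′)} {A} s
          (proj₂ (restrict L H D′)) D↦A)
  } , λ D → proj₂ (restrict L H D)
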